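{- The Cartan subalgebra $\mathcal{U}_\mathcal{A}^0(\mathfrak{sl}_2)$ has a presentation given by the generators $\begin{bmatrix} K;c \\ t\end{bmatrix}$ for $c\in \mathbb{Z}$, $t\in \mathbb{N}_0$, the multiplication relation \[\begin{bmatrix} K; c \\ t\end{bmatrix}\begin{bmatrix} K; b \\ s\end{bmatrix}=\sum_{i\ge 0} \genfrac{\{}{\}}{0pt}{}{t-c+b}{i-c}_q\genfrac{\{}{\}}{0pt}{}{s-b+c}{i-b}_q\begin{bmatrix} K;i \\ t+s\end{bmatrix}\quad (b,c\in\mathbb{Z},\ s,t\in\mathbb{N}_0,\ t-c+b\ge0,\ s-b+c\ge0),\] and the relation \[\begin{bmatrix} K;c+2 \\ t\end{bmatrix}=(q^t+q^{ -t})\begin{bmatrix} K;c+1 \\ t\end{bmatrix}-\begin{bmatrix} K;c \\ t\end{bmatrix}+\begin{bmatrix} K;c \\ t-2\end{bmatrix}\quad (t\ge1,\ c\in\mathbb{Z}).\]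
   Context: Let $\mathcal{A}=\mathbb{Z}[q,q^{ -1}]$. In $\mathbb{Q}(q)[K,K^{ -1}]$, for $a\in\mathbb{Z}$ let $[K;a]=\frac{q^aK-q^{ -a}K^{ -1}}{q-q^{ -1}}$, $\{n\}_q=\frac{q^n-q^{ -n}}{q-q^{ -1}}$, $\{n\}_q!=\{n\}_q\cdots\{1\}_q$, and $\begin{bmatrix} K;c \\ t\end{bmatrix}=\frac{[K;c][K;c-1]\cdots[K;c-t+1]}{\{t\}_q!}$ ($=1$ for $t=0$, $=0$ for $t<0$). The quantum binomial is $\genfrac{\{}{\}}{0pt}{}{n}{k}_q=\frac{\{n\}_q!}{\{k\}_q!\{n-k\}_q!}$, zero if $n<k$ or $k<0$. $\mathcal{U}_\mathcal{A}^0(\mathfrak{sl}_2)$ is the Cartan subalgebra of Lusztig's integral form of $\mathcal{U}_q(\mathfrak{sl}_2)$, i.e. the $\mathcal{A}$-subalgebra of $\mathbb{Q}(q)[K,K^{ -1}]$ generated by $K$, $K^{ -1}$ and $\begin{bmatrix} K;0 \\ t\end{bmatrix}$ for $t\in\mathbb{N}$.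
   Formalization: The sum over i ≥ 0 is taken over all integers i (literally it fails, e.g. c=b=-1, s=t=0 gives 1=0), and the presentation is one of commutative, not necessarily unital algebras, since the stated relations alone do not identify the symbols with t=0 with 1. -}

module Defs where

open import Data.Nat as ℕ using (ℕ; zero; suc)
open import Data.Integer as ℤ using (ℤ; +_; -[1+_]; 0ℤ; 1ℤ; -1ℤ)
open import Data.List using (List; []; _∷_; _++_; map; concatMap; foldr; upTo)
open import Data.Product using (Σ; _×_; _,_)
open import Data.Empty using (⊥)
open import Relation.Nullary using (¬_; yes; no)
open import Relation.Binary.PropositionalEquality using (_≡_)

-- The ring A = ℤ[q,q⁻¹]: finite lists of monomials (coefficient, q-exponent),
-- compared by their coefficient functions.

Aelt : Set
Aelt = List (ℤ × ℤ)

coeffA : Aelt → ℤ → ℤ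
coeffA [] e = 0ℤ
coeffA ((c , d) ∷ p) e with d ℤ.≟ e
... | yes _ = c ℤ.+ coeffA p e
... | no  _ = coeffA p e

infix 4 _≈A_
_≈A_ : Aelt → Aelt → Set
p ≈A p' = ∀ e → coeffA p e ≡ coeffA p' e

infixl 6 _+A_
infixl 7 _*A_

_+A_ : Aelt → Aelt → Aelt
p +A p' = p ++ p'

_*A_ : Aelt → Aelt → Aelt
p *A p' = concatMap (λ { (c , d) → map (λ { (c' , d') → (c ℤ.* c' , d ℤ.+ d') }) p' }) p

1A : Aelt
1A = (1ℤ , 0ℤ) ∷ []

-1A : Aelt
-1A = (-1ℤ , 0ℤ) ∷ []

qt+q-t : ℕ → Aelt
qt+q-t t = (1ℤ , + t) ∷ (1ℤ , ℤ.- (+ t)) ∷ []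

-- {n}_q = q^{n-1} + q^{n-3} + ... + q^{-(n-1)}  (= (q^n - q^-n)/(q - q^-1))
qintA : ℕ → Aelt
qintA n = map (λ j → (1ℤ , (+ (2 ℕ.* j)) ℤ.- (+ n) ℤ.+ 1ℤ)) (upTo n)

-- Laurent polynomials in q and K over ℤ: monomials (coefficient, q-exp, K-exp)

LPoly : Set
LPoly = List (ℤ × ℤ × ℤ)

coeffL : LPoly → ℤ → ℤ → ℤ
coeffL [] i j = 0ℤ
coeffL ((c , a , b) ∷ p) i j with a ℤ.≟ i | b ℤ.≟ j
... | yes _ | yes _ = c ℤ.+ coeffL p i j
... | _     | _     = coeffL p i j

infix 4 _≈L_
_≈L_ : LPoly → LPoly → Set
p ≈L p' = ∀ i j → coeffL p i j ≡ coeffL p' i j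

_*L_ : LPoly → LPoly → LPoly
p *L p' = concatMap (λ { (c , a , b) → map (λ { (c' , a' , b') → (c ℤ.* c' , a ℤ.+ a' , b ℤ.+ b') }) p' }) p

-- ℚ(q)[K,K⁻¹] as the localisation of ℤ[q,q⁻¹,K,K⁻¹] at the nonzero
-- elements of ℤ[q]: an element is num / (d₁ ⋯ dₖ), each dᵢ ∈ ℤ[q] a
-- polynomial (coefficient list, constant term first) with nonzero constant
-- term.  (Every nonzero Laurent polynomial in q is a unit q^e times such a
-- polynomial, so this is all of ℚ(q)[K,K⁻¹].)

HeadNZ : List ℤ → Set
HeadNZ []      = ⊥
HeadNZ (c ∷ _) = ¬ (c ≡ 0ℤ)

Den : Set
Den = Σ (List ℤ) HeadNZ

polyToL : ℕ → List ℤ → LPoly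
polyToL e []       = []
polyToL e (c ∷ cs) = (c , + e , 0ℤ) ∷ polyToL (suc e) cs

denL : List Den → LPoly
denL []             = (1ℤ , 0ℤ , 0ℤ) ∷ []
denL ((d , _) ∷ ds) = polyToL 0 d *L denL ds

record R : Set where
  constructor _/_
  field
    num : LPoly
    den : List Den
open R public

infix 4 _≈R_
_≈R_ : R → R → Set
x ≈R y = num x *L denL (den y) ≈L num y *L denL (den x)

infixl 6 _+R_
infixl 7 _*R_

_+R_ : R → R → R
x +R y = (num x *L denL (den y) ++ num y *L denL (den x)) / (den x ++ den y)

_*R_ : R → R → R
x *R y = (num x *L num y) / (den x ++ den y)

zeroR oneR KR K⁻¹R : R
zeroR = [] / []
oneR  = ((1ℤ , 0ℤ , 0ℤ) ∷ []) / []
KR    = ((1ℤ , 0ℤ , 1ℤ) ∷ []) / []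
K⁻¹R  = ((1ℤ , 0ℤ , -1ℤ) ∷ []) / []

embA : Aelt → R
embA p = map (λ { (c , e) → (c , e , 0ℤ) }) p / []

-- [K;a] = (q^a K - q^{-a} K^{-1}) / (q - q^{-1})
--       = q (q^a K - q^{-a} K^{-1}) / (q² - 1)

q²-1 : Den
q²-1 = (-1ℤ ∷ 0ℤ ∷ 1ℤ ∷ []) , (λ ())

Kbr : ℤ → R
Kbr a = ((1ℤ , a ℤ.+ 1ℤ , 1ℤ) ∷ (-1ℤ , 1ℤ ℤ.- a , -1ℤ) ∷ []) / (q²-1 ∷ [])

evens : ℕ → List ℤ
evens zero    = 1ℤ ∷ []
evens (suc m) = 1ℤ ∷ 0ℤ ∷ evens m

evens-nz : ∀ m → HeadNZ (evens m)
evens-nz zero    = λ ()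
evens-nz (suc m) = λ ()

-- 1 / {m+1}_q = q^m / (1 + q² + ... + q^{2m})
inv-qint-suc : ℕ → R
inv-qint-suc m = ((1ℤ , + m , 0ℤ) ∷ []) / ((evens m , evens-nz m) ∷ [])

qfact : ℕ → R
qfact zero    = oneR
qfact (suc n) = embA (qintA (suc n)) *R qfact n

inv-qfact : ℕ → R
inv-qfact zero    = oneR
inv-qfact (suc n) = inv-qint-suc n *R inv-qfact n

qbinℕ : ℕ → ℕ → R
qbinℕ n k with k ℕ.≤? n
... | yes _ = qfact n *R inv-qfact k *R inv-qfact (n ℕ.∸ k)
... | no  _ = zeroR

qbin : ℤ → ℤ → R
qbin (+ n)    (+ k)    = qbinℕ n k
qbin _        _        = zeroR

Kprod : ℤ → ℕ → R
Kprod c zero    = oneR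
Kprod c (suc t) = Kbr c *R Kprod (c ℤ.- 1ℤ) t

Kbin : ℤ → ℕ → R
Kbin c t = Kprod c t *R inv-qfact t

data InU : R → Set where
  u-K    : InU KR
  u-K⁻¹  : InU K⁻¹R
  u-gen  : ∀ t → InU (Kbin 0ℤ t)
  u-A    : ∀ a → InU (embA a)
  u-+    : ∀ {x y} → InU x → InU y → InU (x +R y)
  u-*    : ∀ {x y} → InU x → InU y → InU (x *R y)
  u-resp : ∀ {x y} → x ≈R y → InU x → InU y

-- Terms of the free commutative (non-unital) A-algebra on symbols
-- X(c,t), c ∈ ℤ, t ∈ ℕ.

infixl 6 _⊕_
infixl 7 _⊗_
infixr 8 _·_

data Tm : Set where
  X    : ℤ → ℕ → Tm
  𝟘    : Tm
  _⊕_  : Tm → Tm → Tm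
  _⊗_  : Tm → Tm → Tm
  _·_  : Aelt → Tm → Tm

Xℤ : ℤ → ℤ → Tm
Xℤ c (+ t)    = X c t
Xℤ c -[1+ _ ] = 𝟘

ΣT : List Tm → Tm
ΣT = foldr _⊕_ 𝟘

eval : Tm → R
eval (X c t)  = Kbin c t
eval 𝟘        = zeroR
eval (u ⊕ v)  = eval u +R eval v
eval (u ⊗ v)  = eval u *R eval v
eval (a · u)  = embA a *R eval u

-- The congruence on terms: axioms of a commutative A-algebra (not
-- necessarily unital) plus the two families of defining relations; i.e.
-- u ~ v iff u - v lies in the ideal generated by the relations.
infix 4 _~_
data _~_ : Tm → Tm → Set where
  ~refl  : ∀ {u} → u ~ u
  ~sym   : ∀ {u v} → u ~ v → v ~ u
  ~trans : ∀ {u v w} → u ~ v → v ~ w → u ~ w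
  ~⊕     : ∀ {u u' v v'} → u ~ u' → v ~ v' → u ⊕ v ~ u' ⊕ v'
  ~⊗     : ∀ {u u' v v'} → u ~ u' → v ~ v' → u ⊗ v ~ u' ⊗ v'
  ~·     : ∀ {a a' u u'} → a ≈A a' → u ~ u' → a · u ~ a' · u'
  ⊕-assoc : ∀ u v w → (u ⊕ v) ⊕ w ~ u ⊕ (v ⊕ w)
  ⊕-comm  : ∀ u v → u ⊕ v ~ v ⊕ u
  ⊕-zero  : ∀ u → u ⊕ 𝟘 ~ u
  ⊕-inv   : ∀ u → u ⊕ (-1A · u) ~ 𝟘
  ⊗-assoc : ∀ u v w → (u ⊗ v) ⊗ w ~ u ⊗ (v ⊗ w)
  ⊗-comm  : ∀ u v → u ⊗ v ~ v ⊗ u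
  ⊗-distr : ∀ u v w → u ⊗ (v ⊕ w) ~ u ⊗ v ⊕ u ⊗ w
  ·-distrA : ∀ a b u → (a +A b) · u ~ a · u ⊕ b · u
  ·-distrT : ∀ a u v → a · (u ⊕ v) ~ a · u ⊕ a · v
  ·-assoc  : ∀ a b u → (a *A b) · u ~ a · (b · u)
  ·-one    : ∀ u → 1A · u ~ u
  ·-⊗      : ∀ a u v → a · (u ⊗ v) ~ (a · u) ⊗ v
  -- multiplication relation, for t - c + b = n ≥ 0 and s - b + c = m ≥ 0.
  -- The sum over i runs over i = c + j, j = 0..n, which contains the
  -- support of {t-c+b over i-c}; α j, β j are the elements of A equal to
  -- the two quantum binomials.
  rel-mult : ∀ (c b : ℤ) (t s n m : ℕ)
    → + n ≡ + t ℤ.- c ℤ.+ b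
    → + m ≡ + s ℤ.- b ℤ.+ c
    → (α β : ℕ → Aelt)
    → (∀ j → embA (α j) ≈R qbin (+ t ℤ.- c ℤ.+ b) ((c ℤ.+ + j) ℤ.- c))
    → (∀ j → embA (β j) ≈R qbin (+ s ℤ.- b ℤ.+ c) ((c ℤ.+ + j) ℤ.- b))
    → X c t ⊗ X b s ~ ΣT (map (λ j → α j · β j · X (c ℤ.+ + j) (t ℕ.+ s)) (upTo (suc n)))
  rel-rec : ∀ (c : ℤ) (t : ℕ) → 1 ℕ.≤ t
    → X (c ℤ.+ + 2) t ~ qt+q-t t · X (c ℤ.+ 1ℤ) t ⊕ -1A · X c t ⊕ Xℤ c (+ t ℤ.- + 2)

{-# OPTIONS --safe #-}

-- Terms are compared through a normal form.  The recurrence reduces every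
-- X(c,t) to X(0,t), X(1,t) and terms with smaller t, and the multiplication
-- relation does the same for products, once all X(c,0) are known to coincide.
-- They do because each of them fixes all the others: X(c,0) fixes X(c,1) and
-- X(c+1,1), hence all X(b,1) by the recurrence; it fixes X(c,2), hence all
-- X(b,2) because X(b,1)² = X(b,2) + X(b+1,2); hence it fixes all X(b,0) by the
-- recurrence at t = 2.  The normal forms are independent in ℚ(q)[K,K⁻¹]: the
-- leading coefficients at K^t and K^{-t} of [K;0;t] and [K;1;t] differ by the
-- factors q^t and q^{-t}.
-- In the ring itself the recurrence is the difference of the two forms of
-- Pascal's rule for K-binomials, and the multiplication relation is proved by
-- induction on t - c + b.
module Submission where

-- The terms have no unit, and no relation compares two of the X(c,0) directly: for s = t = 0 the
-- conditions of the multiplication relation force b = c and leave only X(c,0)² = X(c,0), while the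
-- recurrence is stated for t ≥ 1. At t = 2 its last summand is X(c,0), hence the detour through t =
-- 1 and t = 2. Normal forms keep two generators for every t ≥ 1 because the recurrence has order
-- two in c. The choice c = 0, 1 is also forced by products: the multiplication relation applies to
-- all t and s only if the two values of c are equal or, with s ≥ 1, neighbours. In the ring, the
-- induction for the product formula passes through negative t and s, so K-binomials are extended by
-- zero to all integers. The identities are proved over any commutative ring in which the quantum
-- integers are invertible, and only afterwards specialised to fractions. Independence needs actual
-- coefficients, which a fraction does not show, so denominators are cleared before the rows K^t and
-- K^(-t) are read off.

open import Defs
open import Algebra.Bundles using (AbelianGroup; CommutativeRing; RawRing)
open import Algebra.Core using (Op₁; Op₂)
import Algebra.Definitions
import Algebra.Properties.Group
import Algebra.Properties.Ring
import Algebra.Properties.Semiring.Mult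
import Algebra.Solver.Ring
import Algebra.Solver.Ring.AlmostCommutativeRing as ACR
open import Data.Empty using (⊥-elim)
open import Data.Integer as ℤ using (ℤ; +_; -[1+_]; 0ℤ; 1ℤ; -1ℤ)
import Data.Integer.Properties as ℤ
import Data.Integer.Tactic.RingSolver as ℤ-Solver
open import Data.List using (List; []; _∷_; _++_; map; upTo; applyUpTo)
import Data.List.Properties as List
open import Data.Maybe using (Maybe; just; nothing)
open import Data.Nat as ℕ using (ℕ; zero; suc)
import Data.Nat.Properties as ℕ
open import Data.Product using (Σ; _×_; _,_; proj₁; proj₂)
open import Data.Sum using (inj₁; inj₂)
open import Function using (_∘_; _$_)
open import Level using (0ℓ; _⊔_)
open import Relation.Binary using (IsEquivalence; Rel)
import Relation.Binary.Reasoning.Setoid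
open import Relation.Nullary using (¬_; yes; no)
open import Relation.Binary.PropositionalEquality as ≡ using (_≡_; _≢_)

-- Integer coefficients are encoded as formal differences of naturals, so that
-- the homomorphism laws need no case distinction on signs.
module RingSolver {a ℓ} (𝓡 : CommutativeRing a ℓ) where
  open CommutativeRing 𝓡
  private
    open Algebra.Properties.Semiring.Mult semiring using (×-homo-+; ×1-homo-*) renaming (_×_ to _×′_)
    open Algebra.Properties.Ring ring using (-‿distribˡ-*; -‿distribʳ-*; -0#≈0#; -‿involutive; -‿+-comm)
    open Relation.Binary.Reasoning.Setoid setoid

    diffRing : RawRing _ _
    diffRing = record
      { Carrier = ℕ × ℕ
      ; _≈_ = _≡_
      ; _+_ = λ { (a , b) (c , d) → a ℕ.+ c , b ℕ.+ d }
      ; _*_ = λ { (a , b) (c , d) → a ℕ.* c ℕ.+ b ℕ.* d , a ℕ.* d ℕ.+ b ℕ.* c }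
      ; -_ = λ { (a , b) → b , a }
      ; 0# = 0 , 0
      ; 1# = 1 , 0
      }

    ⟦_⟧ : ℕ × ℕ → Carrier
    ⟦ a , b ⟧ = a ×′ 1# - b ×′ 1#

    middle4 : ∀ w x y z → (w + x) + (y + z) ≈ (w + y) + (x + z)
    middle4 w x y z = begin
      (w + x) + (y + z) ≈⟨ +-assoc w x _ ⟩
      w + (x + (y + z)) ≈⟨ +-congˡ (+-assoc x y z) ⟨
      w + ((x + y) + z) ≈⟨ +-congˡ (+-congʳ (+-comm x y)) ⟩
      w + ((y + x) + z) ≈⟨ +-congˡ (+-assoc y x z) ⟩
      w + (y + (x + z)) ≈⟨ +-assoc w y _ ⟨
      (w + y) + (x + z) ∎

    +-diff : ∀ w x y z → (w + x) - (y + z) ≈ (w - y) + (x - z)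
    +-diff w x y z = trans (+-congˡ (sym (-‿+-comm y z))) (middle4 w x (- y) (- z))

    *-diff : ∀ w x y z → (w * y + x * z) - (w * z + x * y) ≈ (w - x) * (y - z)
    *-diff w x y z = sym (begin
      (w - x) * (y - z)                               ≈⟨ distribʳ _ w (- x) ⟩
      w * (y - z) + - x * (y - z)                     ≈⟨ +-cong (distribˡ w y _) (distribˡ (- x) y _) ⟩
      (w * y + w * - z) + (- x * y + - x * - z)       ≈⟨ +-cong (+-congˡ (sym (-‿distribʳ-* w z)))
                                                            (+-cong (sym (-‿distribˡ-* x y)) -x-z) ⟩
      (w * y - w * z) + (- (x * y) + x * z)           ≈⟨ +-congˡ (+-comm _ _) ⟩
      (w * y - w * z) + (x * z - x * y)               ≈⟨ +-diff (w * y) (x * z) (w * z) (x * y) ⟨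
      (w * y + x * z) - (w * z + x * y)               ∎)
      where
      -x-z : - x * - z ≈ x * z
      -x-z = begin
        - x * - z     ≈⟨ -‿distribˡ-* x (- z) ⟨
        - (x * - z)   ≈⟨ -‿cong (-‿distribʳ-* x z) ⟨
        - - (x * z)   ≈⟨ -‿involutive _ ⟩
        x * z         ∎

    -‿diff : ∀ x y → y - x ≈ - (x - y)
    -‿diff x y = begin
      y - x         ≈⟨ +-comm y (- x) ⟩
      - x + y       ≈⟨ +-congˡ (-‿involutive y) ⟨
      - x + - - y   ≈⟨ -‿+-comm x (- y) ⟩
      - (x - y)     ∎

    homomorphism : diffRing ACR.-Raw-AlmostCommutative⟶ ACR.fromCommutativeRing 𝓡
    homomorphism = record
      { ⟦_⟧ = ⟦_⟧
      ; +-homo = λ { (a , b) (c , d) → trans (+-cong (×-homo-+ 1# a c) (-‿cong (×-homo-+ 1# b d)))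
                                             (+-diff (a ×′ 1#) (c ×′ 1#) (b ×′ 1#) (d ×′ 1#)) }
      ; *-homo = λ { (a , b) (c , d) → trans
          (+-cong (trans (×-homo-+ 1# (a ℕ.* c) (b ℕ.* d)) (+-cong (×1-homo-* a c) (×1-homo-* b d)))
                  (-‿cong (trans (×-homo-+ 1# (a ℕ.* d) (b ℕ.* c)) (+-cong (×1-homo-* a d) (×1-homo-* b c)))))
          (*-diff (a ×′ 1#) (b ×′ 1#) (c ×′ 1#) (d ×′ 1#)) }
      ; -‿homo = λ { (a , b) → -‿diff (a ×′ 1#) (b ×′ 1#) }
      ; 0-homo = trans (+-congˡ -0#≈0#) (+-identityʳ 0#)
      ; 1-homo = trans (+-congˡ -0#≈0#) (trans (+-identityʳ _) (+-identityʳ 1#))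
      }

    diff-cancel : ∀ w x y z → w + z ≈ y + x → w - x ≈ y - z
    diff-cancel w x y z eq = begin
      w - x                     ≈⟨ +-identityʳ _ ⟨
      (w - x) + 0#              ≈⟨ +-congˡ (-‿inverseʳ z) ⟨
      (w - x) + (z - z)         ≈⟨ middle4 w (- x) z (- z) ⟩
      (w + z) + (- x - z)       ≈⟨ +-congʳ eq ⟩
      (y + x) + (- x - z)       ≈⟨ +-assoc y x _ ⟩
      y + (x + (- x - z))       ≈⟨ +-congˡ (+-assoc x (- x) (- z)) ⟨
      y + ((x - x) - z)         ≈⟨ +-congˡ (+-congʳ (-‿inverseʳ x)) ⟩
      y + (0# - z)              ≈⟨ +-congˡ (+-identityˡ (- z)) ⟩
      y - z                     ∎

    -- Pairs are not normalised: (1 , 1) and (0 , 0) denote the same coefficient. Testing by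
    -- cross-addition lets the solver recognise such cancellations.
    _coeff≟_ : ∀ p r → Maybe (⟦ p ⟧ ≈ ⟦ r ⟧)
    (a , b) coeff≟ (c , d) with a ℕ.+ d ℕ.≟ c ℕ.+ b
    ... | yes eq = just (diff-cancel (a ×′ 1#) (b ×′ 1#) (c ×′ 1#) (d ×′ 1#)
                     (trans (sym (×-homo-+ 1# a d)) (trans (reflexive (≡.cong (_×′ 1#) eq)) (×-homo-+ 1# c b))))
    ... | no _   = nothing

  open Algebra.Solver.Ring diffRing (ACR.fromCommutativeRing 𝓡) homomorphism _coeff≟_ public
    using (solve; _:=_; _:+_; _:*_; _:-_; :-_)

-- Quantum integers and K-binomials in a commutative ring

module FiniteSums {a ℓ} (𝓡 : CommutativeRing a ℓ) where
  open CommutativeRing 𝓡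
  open RingSolver 𝓡

  ∑< : ℕ → (ℕ → Carrier) → Carrier
  ∑< zero    f = 0#
  ∑< (suc n) f = f 0 + ∑< n (f ∘ suc)

  ∑-cong : ∀ n {f g} → (∀ j → f j ≈ g j) → ∑< n f ≈ ∑< n g
  ∑-cong zero    f≈g = refl
  ∑-cong (suc n) f≈g = +-cong (f≈g 0) (∑-cong n (f≈g ∘ suc))

  ∑-+ : ∀ n f g → ∑< n (λ j → f j + g j) ≈ ∑< n f + ∑< n g
  ∑-+ zero    f g = sym (+-identityˡ 0#)
  ∑-+ (suc n) f g = trans (+-congˡ (∑-+ n (f ∘ suc) (g ∘ suc)))
    (solve 4 (λ w x y z → (w :+ x) :+ (y :+ z) := (w :+ y) :+ (x :+ z)) refl _ _ _ _)

  ∑-* : ∀ n x f → x * ∑< n f ≈ ∑< n (λ j → x * f j)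
  ∑-* zero    x f = zeroʳ x
  ∑-* (suc n) x f = trans (distribˡ x _ _) (+-congˡ (∑-* n x (f ∘ suc)))

  ∑-last : ∀ n f → ∑< (suc n) f ≈ ∑< n f + f n
  ∑-last zero    f = +-comm (f 0) 0#
  ∑-last (suc n) f = trans (+-congˡ (∑-last n (f ∘ suc))) (sym (+-assoc (f 0) _ _))

module QuantumIntegers {𝓁 ℓ} (𝓡 : CommutativeRing 𝓁 ℓ) where
  open CommutativeRing 𝓡
  open RingSolver 𝓡
  open FiniteSums 𝓡
  open Relation.Binary.Reasoning.Setoid setoid

  module _ (qp : ℤ → Carrier) (qp-+ : ∀ a b → qp (a ℤ.+ b) ≈ qp a * qp b)
    (δ : Carrier) (δ-inverse : (qp 1ℤ - qp -1ℤ) * δ ≈ 1#) where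

    -- Multiplication by q - q⁻¹ turns each summand into a difference of neighbouring terms. `N` is
    -- kept apart from the number of summands so that the induction can vary the latter alone.
    ∑-telescope : ∀ N n → ∑< n (λ j → qp (+ (2 ℕ.* j) ℤ.- N ℤ.+ 1ℤ)) * (qp 1ℤ - qp -1ℤ) ≈ qp (+ (2 ℕ.* n) ℤ.- N) - qp (ℤ.- N)
    ∑-telescope N zero    = trans (zeroˡ _) (sym (trans (+-congʳ (reflexive (≡.cong qp (ℤ.+-identityˡ (ℤ.- N))))) (-‿inverseʳ (qp (ℤ.- N)))))
    ∑-telescope N (suc n) = begin
      ∑< (suc n) f * w                 ≈⟨ *-congʳ (∑-last n f) ⟩
      (∑< n f + f n) * w               ≈⟨ distribʳ w (∑< n f) (f n) ⟩
      ∑< n f * w + f n * w             ≈⟨ +-congʳ (∑-telescope N n) ⟩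
      (a - b) + f n * w
        ≈⟨ solve 5 (λ a b x y z → (a :- b) :+ x :* (y :- z) := (a :- b) :+ (x :* y :- x :* z)) refl a b (f n) (qp 1ℤ) (qp -1ℤ) ⟩
      (a - b) + (f n * qp 1ℤ - f n * qp -1ℤ)
        ≈⟨ +-congˡ (+-cong (trans (sym (qp-+ _ 1ℤ)) (reflexive (≡.cong qp (≡.trans (e₁ (+ (2 ℕ.* n)) N) (≡.cong (λ m → + m ℤ.- N) (≡.sym (ℕ.*-suc 2 n)))))))
             (-‿cong (trans (sym (qp-+ _ -1ℤ)) (reflexive (≡.cong qp (e₂ (+ (2 ℕ.* n)) N)))))) ⟩
      (a - b) + (c - a)
        ≈⟨ solve 3 (λ a b c → (a :- b) :+ (c :- a) := c :- b) refl a b c ⟩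
      c - b ∎
      where
      f : ℕ → Carrier
      f j = qp (+ (2 ℕ.* j) ℤ.- N ℤ.+ 1ℤ)
      w = qp 1ℤ - qp -1ℤ
      a = qp (+ (2 ℕ.* n) ℤ.- N)
      b = qp (ℤ.- N)
      c = qp (+ (2 ℕ.* suc n) ℤ.- N)
      e₁ : ∀ x N → x ℤ.- N ℤ.+ 1ℤ ℤ.+ 1ℤ ≡ + 2 ℤ.+ x ℤ.- N
      e₁ = ℤ-Solver.solve-∀
      e₂ : ∀ x N → x ℤ.- N ℤ.+ 1ℤ ℤ.+ -1ℤ ≡ x ℤ.- N
      e₂ = ℤ-Solver.solve-∀

    qint-sum : ∀ n → ∑< n (λ j → qp (+ (2 ℕ.* j) ℤ.- + n ℤ.+ 1ℤ)) ≈ (qp (+ n) - qp (ℤ.- + n)) * δ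
    qint-sum n = begin
      s                ≈⟨ *-identityʳ s ⟨
      s * 1#           ≈⟨ *-congˡ δ-inverse ⟨
      s * (w * δ)      ≈⟨ *-assoc s w δ ⟨
      s * w * δ        ≈⟨ *-congʳ (∑-telescope (+ n) n) ⟩
      (qp (+ (2 ℕ.* n) ℤ.- + n) - qp (ℤ.- + n)) * δ
        ≈⟨ *-congʳ (+-congʳ (reflexive (≡.cong qp (≡.trans (≡.cong (λ m → + m ℤ.- + n) (≡.cong (λ z → n ℕ.+ z) (ℕ.+-identityʳ n))) (e (+ n)))))) ⟩
      (qp (+ n) - qp (ℤ.- + n)) * δ ∎
      where
      s = ∑< n (λ j → qp (+ (2 ℕ.* j) ℤ.- + n ℤ.+ 1ℤ))
      w = qp 1ℤ - qp -1ℤ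
      e : ∀ n → n ℤ.+ n ℤ.- n ≡ n
      e = ℤ-Solver.solve-∀

-- q^a = qp a, K = κ, K⁻¹ = κ⁻¹, 1/(q - q⁻¹) = δ and 1/{m+1}_q = ι m.
record QuantumParameters {𝓁 ℓ} (𝓡 : CommutativeRing 𝓁 ℓ) : Set (𝓁 ⊔ ℓ) where
  open CommutativeRing 𝓡
  field
    qp        : ℤ → Carrier
    qp-+      : ∀ a b → qp (a ℤ.+ b) ≈ qp a * qp b
    qp-0      : qp 0ℤ ≈ 1#
    κ κ⁻¹ δ   : Carrier
    κκ⁻¹≈1    : κ * κ⁻¹ ≈ 1#
    δ-inverse : (qp 1ℤ - qp -1ℤ) * δ ≈ 1#
    ι         : ℕ → Carrier
    ι-inverse : ∀ m → (qp (+ suc m) - qp (ℤ.- (+ suc m))) * δ * ι m ≈ 1#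

-- Identities for K-binomials and quantum binomials

module QuantumBinomials {𝓁 ℓ} {𝓡 : CommutativeRing 𝓁 ℓ} (parameters : QuantumParameters 𝓡) where
  open CommutativeRing 𝓡
  open QuantumParameters parameters
  open RingSolver 𝓡
  open FiniteSums 𝓡 public
  open Relation.Binary.Reasoning.Setoid setoid

  -- ⦅ n ⦆ = {n}_q, y c = [K;c], kbin c t = [K;c;t] and B n k = {n over k};
  -- kbinℤ and Bℤ extend the latter two by 0 to negative t and k.
  ⦅_⦆ : ℤ → Carrier
  ⦅ n ⦆ = (qp n - qp (ℤ.- n)) * δ

  y : ℤ → Carrier
  y c = (qp c * κ - qp (ℤ.- c) * κ⁻¹) * δ

  qp-≡ : ∀ {a b} → a ≡ b → qp a ≈ qp b
  qp-≡ ≡.refl = refl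

  qp-inverse : ∀ a → qp a * qp (ℤ.- a) ≈ 1#
  qp-inverse a = trans (sym (qp-+ a (ℤ.- a))) (trans (qp-≡ (ℤ.+-inverseʳ a)) qp-0)

  qp-neg-+ : ∀ a b → qp (ℤ.- (a ℤ.+ b)) ≈ qp (ℤ.- a) * qp (ℤ.- b)
  qp-neg-+ a b = trans (qp-≡ (ℤ.neg-distrib-+ a b)) (qp-+ (ℤ.- a) (ℤ.- b))

  y-+ : ∀ a s → y (a ℤ.+ s) ≈ (qp a * qp s * κ - qp (ℤ.- a) * qp (ℤ.- s) * κ⁻¹) * δ
  y-+ a s = *-congʳ (+-cong (*-congʳ (qp-+ a s)) (-‿cong (*-congʳ (qp-neg-+ a s))))

  -- The factor q^s gives [K;a+s] the same K⁻¹-part as [K;a], so the two differ by a multiple of K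
  -- only. One form of Pascal's rule and the product formula both rest on this.
  y-shift : ∀ u a s → qp (u ℤ.+ s) * y (a ℤ.+ s) ≈ qp u * y a + κ * qp (u ℤ.+ a ℤ.+ s) * ⦅ s ⦆
  y-shift u a s = begin
    qp (u ℤ.+ s) * y (a ℤ.+ s)
      ≈⟨ *-cong (qp-+ u s) (y-+ a s) ⟩
    qp u * qp s * ((qp a * qp s * κ - qp (ℤ.- a) * qp (ℤ.- s) * κ⁻¹) * δ)
      ≈⟨ solve 8 (λ U S A A' S' k k' d →
           U :* S :* ((A :* S :* k :- A' :* S' :* k') :* d)
             := S :* S' :* (U :* ((A :* k :- A' :* k') :* d)) :+ k :* (U :* A :* S) :* ((S :- S') :* d))
           refl (qp u) (qp s) (qp a) (qp (ℤ.- a)) (qp (ℤ.- s)) κ κ⁻¹ δ ⟩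
    qp s * qp (ℤ.- s) * (qp u * y a) + κ * (qp u * qp a * qp s) * ⦅ s ⦆
      ≈⟨ +-cong (trans (*-congʳ (qp-inverse s)) (*-identityˡ _))
           (*-congʳ (*-congˡ (trans (*-congʳ (sym (qp-+ u a))) (sym (qp-+ (u ℤ.+ a) s))))) ⟩
    qp u * y a + κ * qp (u ℤ.+ a ℤ.+ s) * ⦅ s ⦆ ∎

  -- The mirror image: q^(-s) makes the K-parts agree, and a multiple of K⁻¹ remains.
  y-shift⁻¹ : ∀ u a s → qp (u ℤ.- s) * y (a ℤ.+ s) ≈ qp u * y a + κ⁻¹ * qp (u ℤ.- a ℤ.- s) * ⦅ s ⦆
  y-shift⁻¹ u a s = begin
    qp (u ℤ.- s) * y (a ℤ.+ s)
      ≈⟨ *-cong (qp-+ u (ℤ.- s)) (y-+ a s) ⟩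
    qp u * qp (ℤ.- s) * ((qp a * qp s * κ - qp (ℤ.- a) * qp (ℤ.- s) * κ⁻¹) * δ)
      ≈⟨ solve 8 (λ U S A A' S' k k' d →
           U :* S' :* ((A :* S :* k :- A' :* S' :* k') :* d)
             := S :* S' :* (U :* ((A :* k :- A' :* k') :* d)) :+ k' :* (U :* A' :* S') :* ((S :- S') :* d))
           refl (qp u) (qp s) (qp a) (qp (ℤ.- a)) (qp (ℤ.- s)) κ κ⁻¹ δ ⟩
    qp s * qp (ℤ.- s) * (qp u * y a) + κ⁻¹ * (qp u * qp (ℤ.- a) * qp (ℤ.- s)) * ⦅ s ⦆
      ≈⟨ +-cong (trans (*-congʳ (qp-inverse s)) (*-identityˡ _))
           (*-congʳ (*-congˡ (trans (*-congʳ (sym (qp-+ u (ℤ.- a)))) (sym (qp-+ (u ℤ.- a) (ℤ.- s)))))) ⟩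
    qp u * y a + κ⁻¹ * qp (u ℤ.- a ℤ.- s) * ⦅ s ⦆ ∎

  ⦅⦆-+ : ∀ a b → ⦅ a ℤ.+ b ⦆ ≈ qp b * ⦅ a ⦆ + qp (ℤ.- a) * ⦅ b ⦆
  ⦅⦆-+ a b = trans (*-congʳ (+-cong (qp-+ a b) (-‿cong (qp-neg-+ a b))))
    (solve 5 (λ A B A' B' d → (A :* B :- A' :* B') :* d
                := B :* ((A :- A') :* d) :+ A' :* ((B :- B') :* d))
       refl (qp a) (qp b) (qp (ℤ.- a)) (qp (ℤ.- b)) δ)

  ⦅0⦆≈0 : ⦅ 0ℤ ⦆ ≈ 0#
  ⦅0⦆≈0 = trans (*-congʳ (-‿inverseʳ (qp 0ℤ))) (zeroˡ δ)

  ⦅⦆-≡ : ∀ {a b} → a ≡ b → ⦅ a ⦆ ≈ ⦅ b ⦆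
  ⦅⦆-≡ ≡.refl = refl

  y-≡ : ∀ {a b} → a ≡ b → y a ≈ y b
  y-≡ ≡.refl = refl

  -- Replaces division by {m+1}: K-binomial identities are proved after multiplication by a quantum
  -- integer, which turns them into identities between falling products.
  ⦅suc⦆-cancel : ∀ m {u v} → ⦅ + suc m ⦆ * u ≈ ⦅ + suc m ⦆ * v → u ≈ v
  ⦅suc⦆-cancel m {u} {v} eq = begin
    u                          ≈⟨ expand u ⟩
    ι m * (⦅ + suc m ⦆ * u)    ≈⟨ *-congˡ eq ⟩
    ι m * (⦅ + suc m ⦆ * v)    ≈⟨ expand v ⟨
    v                          ∎
    where
    expand : ∀ w → w ≈ ι m * (⦅ + suc m ⦆ * w)
    expand w = begin
      w                        ≈⟨ *-identityˡ w ⟨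
      1# * w                   ≈⟨ *-congʳ (ι-inverse m) ⟨
      ⦅ + suc m ⦆ * ι m * w    ≈⟨ *-congʳ (*-comm _ _) ⟩
      ι m * ⦅ + suc m ⦆ * w    ≈⟨ *-assoc _ _ _ ⟩
      ι m * (⦅ + suc m ⦆ * w)  ∎

  fact ifact : ℕ → Carrier
  fact zero     = 1#
  fact (suc n)  = ⦅ + suc n ⦆ * fact n
  ifact zero    = 1#
  ifact (suc n) = ι n * ifact n

  fact-inverse : ∀ n → fact n * ifact n ≈ 1#
  fact-inverse zero    = *-identityˡ 1#
  fact-inverse (suc n) = begin
    ⦅ + suc n ⦆ * fact n * (ι n * ifact n)
      ≈⟨ solve 4 (λ a b c d → a :* b :* (c :* d) := (a :* c) :* (b :* d)) refl ⦅ + suc n ⦆ (fact n) (ι n) (ifact n) ⟩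
    ⦅ + suc n ⦆ * ι n * (fact n * ifact n) ≈⟨ *-cong (ι-inverse n) (fact-inverse n) ⟩
    1# * 1#                                ≈⟨ *-identityˡ 1# ⟩
    1#                                     ∎

  falling : ℤ → ℕ → Carrier
  falling c zero    = 1#
  falling c (suc t) = y c * falling (c ℤ.- 1ℤ) t

  falling-+ : ∀ c s t → falling c (s ℕ.+ t) ≈ falling c s * falling (c ℤ.- + s) t
  falling-+ c zero    t = trans (reflexive (≡.cong (λ e → falling e t) (≡.sym (ℤ.+-identityʳ c)))) (sym (*-identityˡ _))
  falling-+ c (suc s) t = begin
    y c * falling (c ℤ.- 1ℤ) (s ℕ.+ t)                                  ≈⟨ *-congˡ (falling-+ (c ℤ.- 1ℤ) s t) ⟩
    y c * (falling (c ℤ.- 1ℤ) s * falling (c ℤ.- 1ℤ ℤ.- + s) t)         ≈⟨ *-assoc _ _ _ ⟨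
    y c * falling (c ℤ.- 1ℤ) s * falling (c ℤ.- 1ℤ ℤ.- + s) t           ≈⟨ *-congˡ (reflexive (≡.cong (λ e → falling e t) (shift c (+ s)))) ⟩
    y c * falling (c ℤ.- 1ℤ) s * falling (c ℤ.- + suc s) t              ∎
    where
    shift : ∀ c s → c ℤ.- 1ℤ ℤ.- s ≡ c ℤ.- (1ℤ ℤ.+ s)
    shift = ℤ-Solver.solve-∀

  kbin : ℤ → ℕ → Carrier
  kbin c t = falling c t * ifact t

  kbinℤ : ℤ → ℤ → Carrier
  kbinℤ c (+ t)    = kbin c t
  kbinℤ c -[1+ _ ] = 0#

  kbinℤ-≡ : ∀ {c c' t t'} → c ≡ c' → t ≡ t' → kbinℤ c t ≈ kbinℤ c' t'
  kbinℤ-≡ ≡.refl ≡.refl = refl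

  kbin-0 : ∀ c → kbin c 0 ≈ 1#
  kbin-0 c = *-identityˡ 1#

  fact-kbin : ∀ c t → fact t * kbin c t ≈ falling c t
  fact-kbin c t = begin
    fact t * (falling c t * ifact t) ≈⟨ solve 3 (λ a b c → a :* (b :* c) := (a :* c) :* b) refl (fact t) (falling c t) (ifact t) ⟩
    fact t * ifact t * falling c t   ≈⟨ *-congʳ (fact-inverse t) ⟩
    1# * falling c t                 ≈⟨ *-identityˡ _ ⟩
    falling c t                      ∎

  ⦅⦆-kbin : ∀ c t → ⦅ + suc t ⦆ * kbin c (suc t) ≈ falling c (suc t) * ifact t
  ⦅⦆-kbin c t = begin
    ⦅ + suc t ⦆ * (falling c (suc t) * (ι t * ifact t))
      ≈⟨ solve 4 (λ a b c d → a :* (b :* (c :* d)) := (a :* c) :* (b :* d)) refl ⦅ + suc t ⦆ (falling c (suc t)) (ι t) (ifact t) ⟩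
    ⦅ + suc t ⦆ * ι t * (falling c (suc t) * ifact t) ≈⟨ *-congʳ (ι-inverse t) ⟩
    1# * (falling c (suc t) * ifact t)                ≈⟨ *-identityˡ _ ⟩
    falling c (suc t) * ifact t                       ∎

  -- The extension by zero is compatible with peeling off a factor: at t = -1 the left-hand side
  -- vanishes because {0} = 0.
  kbinℤ-first : ∀ c t → ⦅ 1ℤ ℤ.+ t ⦆ * kbinℤ c (1ℤ ℤ.+ t) ≈ y c * kbinℤ (c ℤ.- 1ℤ) t
  kbinℤ-first c (+ t)          = trans (⦅⦆-kbin c t) (*-assoc _ _ _)
  kbinℤ-first c -[1+ zero ]    = trans (trans (*-congʳ ⦅0⦆≈0) (zeroˡ _)) (sym (zeroʳ _))
  kbinℤ-first c -[1+ suc t ]   = trans (zeroʳ _) (sym (zeroʳ _))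

  kbinℤ-last : ∀ c t → ⦅ 1ℤ ℤ.+ t ⦆ * kbinℤ c (1ℤ ℤ.+ t) ≈ kbinℤ c t * y (c ℤ.- t)
  kbinℤ-last c (+ t)          = begin
    ⦅ + suc t ⦆ * kbin c (suc t)                        ≈⟨ ⦅⦆-kbin c t ⟩
    falling c (suc t) * ifact t                         ≈⟨ *-congʳ (reflexive (≡.cong (falling c) (ℕ.+-comm 1 t))) ⟩
    falling c (t ℕ.+ 1) * ifact t                       ≈⟨ *-congʳ (falling-+ c t 1) ⟩
    falling c t * (y (c ℤ.- + t) * 1#) * ifact t        ≈⟨ *-congʳ (*-congˡ (*-identityʳ _)) ⟩
    falling c t * y (c ℤ.- + t) * ifact t               ≈⟨ solve 3 (λ a b c → a :* b :* c := a :* c :* b) refl (falling c t) (y (c ℤ.- + t)) (ifact t) ⟩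
    kbin c t * y (c ℤ.- + t)                            ∎
  kbinℤ-last c -[1+ zero ]    = trans (trans (*-congʳ ⦅0⦆≈0) (zeroˡ _)) (sym (zeroˡ _))
  kbinℤ-last c -[1+ suc t ]   = trans (zeroʳ _) (sym (zeroˡ _))

  private
    -- After multiplication by {t+1}, the binomials at c + 1 and at c are both [K;c;t] times one
    -- more factor, [K;c+1] in front or [K;c-t] behind. A linear relation between these factors is
    -- therefore one between the binomials.
    pascal-from-shift : ∀ c t {z w} → y (c ℤ.+ 1ℤ) ≈ z * y (c ℤ.- + t) + w * ⦅ + suc t ⦆ →
      kbin (c ℤ.+ 1ℤ) (suc t) ≈ z * kbin c (suc t) + w * kbin c t
    pascal-from-shift c t {z} {w} eq = ⦅suc⦆-cancel t (begin
      ⦅ + suc t ⦆ * kbin (c ℤ.+ 1ℤ) (suc t)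
        ≈⟨ kbinℤ-first (c ℤ.+ 1ℤ) (+ t) ⟩
      y (c ℤ.+ 1ℤ) * kbin (c ℤ.+ 1ℤ ℤ.- 1ℤ) t
        ≈⟨ *-cong eq (kbinℤ-≡ (shift c) (≡.refl {x = + t})) ⟩
      (z * y (c ℤ.- + t) + w * ⦅ + suc t ⦆) * kbin c t
        ≈⟨ solve 5 (λ z y w s k → (z :* y :+ w :* s) :* k := z :* (k :* y) :+ s :* (w :* k)) refl z (y (c ℤ.- + t)) w ⦅ + suc t ⦆ (kbin c t) ⟩
      z * (kbin c t * y (c ℤ.- + t)) + ⦅ + suc t ⦆ * (w * kbin c t)
        ≈⟨ +-congʳ (*-congˡ (kbinℤ-last c (+ t))) ⟨
      z * (⦅ + suc t ⦆ * kbin c (suc t)) + ⦅ + suc t ⦆ * (w * kbin c t)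
        ≈⟨ solve 4 (λ z s k r → z :* (s :* k) :+ s :* r := s :* (z :* k :+ r)) refl z ⦅ + suc t ⦆ (kbin c (suc t)) (w * kbin c t) ⟩
      ⦅ + suc t ⦆ * (z * kbin c (suc t) + w * kbin c t) ∎)
      where
      shift : ∀ c → c ℤ.+ 1ℤ ℤ.- 1ℤ ≡ c
      shift = ℤ-Solver.solve-∀

  -- `y-shift` leads from [K;c-t] to [K;c+1] in a step of length t + 1; taking u = -(t+1) makes the
  -- power of q on its left-hand side equal to 1.
  kbinℤ-pascal : ∀ c t → kbinℤ (c ℤ.+ 1ℤ) (1ℤ ℤ.+ t) ≈ qp (ℤ.- (1ℤ ℤ.+ t)) * kbinℤ c (1ℤ ℤ.+ t) + κ * qp (c ℤ.- t) * kbinℤ c t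
  kbinℤ-pascal c (+ t) = pascal-from-shift c t (begin
    y (c ℤ.+ 1ℤ)                                         ≈⟨ *-identityˡ _ ⟨
    1# * y (c ℤ.+ 1ℤ)                                    ≈⟨ *-cong (trans (sym qp-0) (qp-≡ (e₁ (+ t)))) (y-≡ (e₂ c (+ t))) ⟩
    qp (ℤ.- + suc t ℤ.+ + suc t) * y (c ℤ.- + t ℤ.+ + suc t) ≈⟨ y-shift (ℤ.- + suc t) (c ℤ.- + t) (+ suc t) ⟩
    qp (ℤ.- + suc t) * y (c ℤ.- + t) + κ * qp (ℤ.- + suc t ℤ.+ (c ℤ.- + t) ℤ.+ + suc t) * ⦅ + suc t ⦆
      ≈⟨ +-congˡ (*-congʳ (*-congˡ (qp-≡ (e₃ c (+ t))))) ⟩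
    qp (ℤ.- + suc t) * y (c ℤ.- + t) + κ * qp (c ℤ.- + t) * ⦅ + suc t ⦆ ∎)
    where
    e₁ : ∀ t → 0ℤ ≡ ℤ.- (1ℤ ℤ.+ t) ℤ.+ (1ℤ ℤ.+ t)
    e₁ = ℤ-Solver.solve-∀
    e₂ : ∀ c t → c ℤ.+ 1ℤ ≡ c ℤ.- t ℤ.+ (1ℤ ℤ.+ t)
    e₂ = ℤ-Solver.solve-∀
    e₃ : ∀ c t → ℤ.- (1ℤ ℤ.+ t) ℤ.+ (c ℤ.- t) ℤ.+ (1ℤ ℤ.+ t) ≡ c ℤ.- t
    e₃ = ℤ-Solver.solve-∀
  kbinℤ-pascal c -[1+ zero ] = trans (kbin-0 (c ℤ.+ 1ℤ)) (sym (trans (+-cong (trans (*-cong qp-0 (kbin-0 c)) (*-identityˡ 1#)) (zeroʳ _)) (+-identityʳ 1#)))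
  kbinℤ-pascal c -[1+ suc t ] = sym (trans (+-cong (zeroʳ _) (zeroʳ _)) (+-identityˡ 0#))

  kbinℤ-pascal⁻¹ : ∀ c t → kbinℤ (c ℤ.+ 1ℤ) (1ℤ ℤ.+ t) ≈ qp (1ℤ ℤ.+ t) * kbinℤ c (1ℤ ℤ.+ t) + κ⁻¹ * qp (t ℤ.- c) * kbinℤ c t
  kbinℤ-pascal⁻¹ c (+ t) = pascal-from-shift c t (begin
    y (c ℤ.+ 1ℤ)                                         ≈⟨ *-identityˡ _ ⟨
    1# * y (c ℤ.+ 1ℤ)                                    ≈⟨ *-cong (trans (sym qp-0) (qp-≡ (e₁ (+ t)))) (y-≡ (e₂ c (+ t))) ⟩
    qp (+ suc t ℤ.- + suc t) * y (c ℤ.- + t ℤ.+ + suc t) ≈⟨ y-shift⁻¹ (+ suc t) (c ℤ.- + t) (+ suc t) ⟩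
    qp (+ suc t) * y (c ℤ.- + t) + κ⁻¹ * qp (+ suc t ℤ.- (c ℤ.- + t) ℤ.- + suc t) * ⦅ + suc t ⦆
      ≈⟨ +-congˡ (*-congʳ (*-congˡ (qp-≡ (e₃ c (+ t))))) ⟩
    qp (+ suc t) * y (c ℤ.- + t) + κ⁻¹ * qp (+ t ℤ.- c) * ⦅ + suc t ⦆ ∎)
    where
    e₁ : ∀ t → 0ℤ ≡ (1ℤ ℤ.+ t) ℤ.- (1ℤ ℤ.+ t)
    e₁ = ℤ-Solver.solve-∀
    e₂ : ∀ c t → c ℤ.+ 1ℤ ≡ c ℤ.- t ℤ.+ (1ℤ ℤ.+ t)
    e₂ = ℤ-Solver.solve-∀
    e₃ : ∀ c t → (1ℤ ℤ.+ t) ℤ.- (c ℤ.- t) ℤ.- (1ℤ ℤ.+ t) ≡ t ℤ.- c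
    e₃ = ℤ-Solver.solve-∀
  kbinℤ-pascal⁻¹ c -[1+ zero ] = trans (kbin-0 (c ℤ.+ 1ℤ)) (sym (trans (+-cong (trans (*-cong qp-0 (kbin-0 c)) (*-identityˡ 1#)) (zeroʳ _)) (+-identityʳ 1#)))
  kbinℤ-pascal⁻¹ c -[1+ suc t ] = sym (trans (+-cong (zeroʳ _) (zeroʳ _)) (+-identityˡ 0#))

  -- Since q^(t+1) is a unit, Pascal's rule also runs downwards in c; membership in the Cartan
  -- subalgebra is carried to negative c this way.
  kbin-pascal⁻¹-solved : ∀ c t → kbin c (suc t) ≈ qp (ℤ.- + suc t) * (kbin (c ℤ.+ 1ℤ) (suc t) - κ⁻¹ * qp (+ t ℤ.- c) * kbin c t)
  kbin-pascal⁻¹-solved c t = begin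
    kbin c (suc t)
      ≈⟨ *-identityˡ _ ⟨
    1# * kbin c (suc t)
      ≈⟨ *-congʳ (qp-inverse (+ suc t)) ⟨
    qp (+ suc t) * qp (ℤ.- + suc t) * kbin c (suc t)
      ≈⟨ solve 4 (λ s r k x → s :* r :* k := r :* (s :* k :+ x :- x)) refl (qp (+ suc t)) (qp (ℤ.- + suc t)) (kbin c (suc t)) (κ⁻¹ * qp (+ t ℤ.- c) * kbin c t) ⟩
    qp (ℤ.- + suc t) * (qp (+ suc t) * kbin c (suc t) + κ⁻¹ * qp (+ t ℤ.- c) * kbin c t - κ⁻¹ * qp (+ t ℤ.- c) * kbin c t)
      ≈⟨ *-congˡ (+-congʳ (kbinℤ-pascal⁻¹ c (+ t))) ⟨
    qp (ℤ.- + suc t) * (kbin (c ℤ.+ 1ℤ) (suc t) - κ⁻¹ * qp (+ t ℤ.- c) * kbin c t) ∎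

  private
    extract : ∀ {x a b k} → x ≈ a + k * qp 0ℤ * b → b ≈ 1# → k ≈ x - a
    extract {x} {a} {b} {k} eq b≈1 = begin
      k                          ≈⟨ *-identityʳ k ⟨
      k * 1#                     ≈⟨ *-identityʳ _ ⟨
      k * 1# * 1#                ≈⟨ *-cong (*-congˡ qp-0) b≈1 ⟨
      k * qp 0ℤ * b              ≈⟨ solve 2 (λ a y → y := a :+ y :- a) refl a (k * qp 0ℤ * b) ⟩
      a + k * qp 0ℤ * b - a      ≈⟨ +-congʳ eq ⟨
      x - a                      ∎

  -- At c = t = 0 the last summand of Pascal's rule is K itself, because [K;0;0] = 1. This recovers
  -- the generator K from K-binomials.
  κ≈kbin : κ ≈ kbin 1ℤ 1 - qp -1ℤ * kbin 0ℤ 1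
  κ≈kbin = extract (kbinℤ-pascal 0ℤ 0ℤ) (kbin-0 0ℤ)

  κ⁻¹≈kbin : κ⁻¹ ≈ kbin 1ℤ 1 - qp 1ℤ * kbin 0ℤ 1
  κ⁻¹≈kbin = extract (kbinℤ-pascal⁻¹ 0ℤ 0ℤ) (kbin-0 0ℤ)

  -- Both sides are compared with [K;c+1;t] through the κ- and κ⁻¹-forms of
  -- Pascal's rule: the first differences in c cancel and leave [K;c;t-2].
  kbinℤ-recurrence : ∀ c w → let t = 1ℤ ℤ.+ (1ℤ ℤ.+ w) in
    kbinℤ (c ℤ.+ + 2) t ≈ (qp t + qp (ℤ.- t)) * kbinℤ (c ℤ.+ 1ℤ) t - kbinℤ c t + kbinℤ c w
  kbinℤ-recurrence c w = begin
    kbinℤ (c ℤ.+ + 2) t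
      ≈⟨ kbinℤ-≡ (≡.sym (ℤ.+-assoc c 1ℤ 1ℤ)) (≡.refl {x = t}) ⟩
    kbinℤ (c ℤ.+ 1ℤ ℤ.+ 1ℤ) t
      ≈⟨ kbinℤ-pascal⁻¹ (c ℤ.+ 1ℤ) (1ℤ ℤ.+ w) ⟩
    qp t * a₁ + κ⁻¹ * qp (1ℤ ℤ.+ w ℤ.- (c ℤ.+ 1ℤ)) * kbinℤ (c ℤ.+ 1ℤ) (1ℤ ℤ.+ w)
      ≈⟨ +-congˡ (*-cong (*-congˡ (qp-≡ (e₁ c w))) (kbinℤ-pascal c w)) ⟩
    qp t * a₁ + κ⁻¹ * qp (w ℤ.- c) * (qp (ℤ.- (1ℤ ℤ.+ w)) * b₀ + κ * qp (c ℤ.- w) * d)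
      ≈⟨ solve 8 (λ ta l r s b k r' d → ta :+ l :* r :* (s :* b :+ k :* r' :* d)
                     := ta :+ l :* (r :* s) :* b :+ (k :* l) :* (r :* r') :* d)
           refl (qp t * a₁) κ⁻¹ (qp (w ℤ.- c)) (qp (ℤ.- (1ℤ ℤ.+ w))) b₀ κ (qp (c ℤ.- w)) d ⟩
    qp t * a₁ + κ⁻¹ * (qp (w ℤ.- c) * qp (ℤ.- (1ℤ ℤ.+ w))) * b₀ + κ * κ⁻¹ * (qp (w ℤ.- c) * qp (c ℤ.- w)) * d
      ≈⟨ +-cong (+-congˡ (*-congʳ (*-congˡ (sym (qp-+ _ _)))))
           (*-congʳ (*-cong κκ⁻¹≈1 (trans (*-congˡ (qp-≡ (e₂ c w))) (qp-inverse (w ℤ.- c))))) ⟩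
    qp t * a₁ + κ⁻¹ * qp (w ℤ.- c ℤ.+ ℤ.- (1ℤ ℤ.+ w)) * b₀ + 1# * 1# * d
      ≈⟨ +-cong (+-congˡ back) (trans (*-congʳ (*-identityˡ 1#)) (*-identityˡ d)) ⟩
    qp t * a₁ + (qp (ℤ.- t) * a₁ - a₀) + d
      ≈⟨ solve 5 (λ s s' a b d → s :* a :+ (s' :* a :- b) :+ d := (s :+ s') :* a :- b :+ d) refl (qp t) (qp (ℤ.- t)) a₁ a₀ d ⟩
    (qp t + qp (ℤ.- t)) * a₁ - a₀ + d ∎
    where
    t = 1ℤ ℤ.+ (1ℤ ℤ.+ w)
    a₁ = kbinℤ (c ℤ.+ 1ℤ) t
    a₀ = kbinℤ c t
    b₀ = kbinℤ c (1ℤ ℤ.+ w)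
    d = kbinℤ c w
    e₁ : ∀ c w → 1ℤ ℤ.+ w ℤ.- (c ℤ.+ 1ℤ) ≡ w ℤ.- c
    e₁ = ℤ-Solver.solve-∀
    e₂ : ∀ c w → c ℤ.- w ≡ ℤ.- (w ℤ.- c)
    e₂ = ℤ-Solver.solve-∀
    e₃ : ∀ c w → 1ℤ ℤ.+ w ℤ.- c ℤ.+ ℤ.- (1ℤ ℤ.+ (1ℤ ℤ.+ w)) ≡ w ℤ.- c ℤ.+ ℤ.- (1ℤ ℤ.+ w)
    e₃ = ℤ-Solver.solve-∀
    back : κ⁻¹ * qp (w ℤ.- c ℤ.+ ℤ.- (1ℤ ℤ.+ w)) * b₀ ≈ qp (ℤ.- t) * a₁ - a₀
    back = begin
      κ⁻¹ * qp (w ℤ.- c ℤ.+ ℤ.- (1ℤ ℤ.+ w)) * b₀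
        ≈⟨ *-congʳ (*-congˡ (trans (qp-≡ (≡.sym (e₃ c w))) (qp-+ _ _))) ⟩
      κ⁻¹ * (qp (1ℤ ℤ.+ w ℤ.- c) * qp (ℤ.- t)) * b₀
        ≈⟨ solve 5 (λ l r s b a → l :* (r :* s) :* b := s :* (l :* r :* b) :+ (a :- a)) refl κ⁻¹ (qp (1ℤ ℤ.+ w ℤ.- c)) (qp (ℤ.- t)) b₀ a₀ ⟩
      qp (ℤ.- t) * (κ⁻¹ * qp (1ℤ ℤ.+ w ℤ.- c) * b₀) + (a₀ - a₀)
        ≈⟨ +-congˡ (+-congʳ (trans (sym (*-identityˡ a₀)) (*-congʳ (sym (trans (*-comm _ _) (qp-inverse t)))))) ⟩
      qp (ℤ.- t) * (κ⁻¹ * qp (1ℤ ℤ.+ w ℤ.- c) * b₀) + (qp (ℤ.- t) * qp t * a₀ - a₀)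
        ≈⟨ solve 4 (λ s' u t a → s' :* u :+ (s' :* t :* a :- a) := s' :* (t :* a :+ u) :- a) refl (qp (ℤ.- t)) (κ⁻¹ * qp (1ℤ ℤ.+ w ℤ.- c) * b₀) (qp t) a₀ ⟩
      qp (ℤ.- t) * (qp t * a₀ + κ⁻¹ * qp (1ℤ ℤ.+ w ℤ.- c) * b₀) - a₀
        ≈⟨ +-congʳ (*-congˡ (kbinℤ-pascal⁻¹ c (1ℤ ℤ.+ w))) ⟨
      qp (ℤ.- t) * a₁ - a₀ ∎

  -- Pascal's recursion rather than a quotient of factorials: it uses no division, so the same
  -- recursion can be run in ℤ[q,q⁻¹].
  B : ℕ → ℕ → Carrier
  B n       zero    = 1#
  B zero    (suc k) = 0#
  B (suc n) (suc k) = qp (+ suc k) * B n (suc k) + qp (+ k ℤ.- + n) * B n k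

  Bℤ : ℕ → ℤ → Carrier
  Bℤ n (+ k)    = B n k
  Bℤ n -[1+ _ ] = 0#

  Bℤ-≡ : ∀ {n k k'} → k ≡ k' → Bℤ n k ≈ Bℤ n k'
  Bℤ-≡ ≡.refl = refl

  B-vanishes : ∀ {n k} → n ℕ.< k → B n k ≈ 0#
  B-vanishes {zero}  {suc k} n<k         = refl
  B-vanishes {suc n} {suc k} (ℕ.s≤s n<k) = trans
    (+-cong (trans (*-congˡ (B-vanishes (ℕ.m<n⇒m<1+n n<k))) (zeroʳ _)) (trans (*-congˡ (B-vanishes n<k)) (zeroʳ _)))
    (+-identityˡ 0#)

  private
    split : ∀ n k → ⦅ + suc n ⦆ ≈ qp (+ suc k) * ⦅ + n ℤ.- + k ⦆ + qp (+ k ℤ.- + n) * ⦅ + suc k ⦆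
    split n k = trans (⦅⦆-≡ (e₁ (+ n) (+ k)))
      (trans (⦅⦆-+ (+ n ℤ.- + k) (+ suc k)) (+-congˡ (*-congʳ (qp-≡ (e₂ (+ n) (+ k))))))
      where
      e₁ : ∀ n k → 1ℤ ℤ.+ n ≡ n ℤ.- k ℤ.+ (1ℤ ℤ.+ k)
      e₁ = ℤ-Solver.solve-∀
      e₂ : ∀ n k → ℤ.- (n ℤ.- k) ≡ k ℤ.- n
      e₂ = ℤ-Solver.solve-∀

    combine : ∀ {p r b b' s s' t} → s' ≈ p * t + r * s → b * t ≈ b' * s → (p * b' + r * b) * s ≈ b * s'
    combine {p} {r} {b} {b'} {s} {s'} {t} eq eq' = begin
      (p * b' + r * b) * s       ≈⟨ solve 5 (λ p r b b' s → (p :* b' :+ r :* b) :* s := p :* (b' :* s) :+ r :* b :* s) refl p r b b' s ⟩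
      p * (b' * s) + r * b * s   ≈⟨ +-congʳ (*-congˡ eq') ⟨
      p * (b * t) + r * b * s    ≈⟨ solve 5 (λ p r b t s → p :* (b :* t) :+ r :* b :* s := b :* (p :* t :+ r :* s)) refl p r b t s ⟩
      b * (p * t + r * s)        ≈⟨ *-congˡ eq ⟨
      b * s'                     ∎

  -- The two absorption identities support each other: `B-suc-suc` at n uses `B-absorb` at n, which
  -- goes back to n - 1. When n and k are both successors, the two sides meet in {n over k+1} {n+1},
  -- written with the predecessors n and k.
  B-absorb : ∀ n k → B n k * ⦅ + n ℤ.- + k ⦆ ≈ B n (suc k) * ⦅ + suc k ⦆

  B-suc-suc : ∀ n k → B (suc n) (suc k) * ⦅ + suc k ⦆ ≈ B n k * ⦅ + suc n ⦆
  B-suc-suc n k = combine (split n k) (B-absorb n k)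

  B-absorb zero    zero    = trans (*-congˡ ⦅0⦆≈0) (trans (zeroʳ _) (sym (zeroˡ _)))
  B-absorb zero    (suc k) = trans (zeroˡ _) (sym (zeroˡ _))
  B-absorb (suc n) zero    = sym (trans (B-suc-suc n 0) (*-congˡ (⦅⦆-≡ (≡.sym (ℤ.+-identityʳ (+ suc n))))))
  B-absorb (suc n) (suc k) = begin
    B (suc n) (suc k) * ⦅ + suc n ℤ.- + suc k ⦆
      ≈⟨ *-cong (+-comm _ _) (⦅⦆-≡ (e (+ n) (+ k))) ⟩
    (qp (+ k ℤ.- + n) * B n k + qp (+ suc k) * B n (suc k)) * ⦅ + n ℤ.- + k ⦆
      ≈⟨ combine (trans (split n k) (+-comm _ _)) (sym (B-absorb n k)) ⟩
    B n (suc k) * ⦅ + suc n ⦆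
      ≈⟨ combine (split n (suc k)) (B-absorb n (suc k)) ⟨
    B (suc n) (suc (suc k)) * ⦅ + suc (suc k) ⦆ ∎
    where
    e : ∀ n k → 1ℤ ℤ.+ n ℤ.- (1ℤ ℤ.+ k) ≡ n ℤ.- k
    e = ℤ-Solver.solve-∀

  Bℤ-absorb : ∀ n k → Bℤ n k * ⦅ + n ℤ.- k ⦆ ≈ Bℤ n (1ℤ ℤ.+ k) * ⦅ 1ℤ ℤ.+ k ⦆
  Bℤ-absorb n (+ k)        = B-absorb n k
  Bℤ-absorb n -[1+ zero ]  = trans (zeroˡ _) (sym (trans (*-congˡ ⦅0⦆≈0) (zeroʳ _)))
  Bℤ-absorb n -[1+ suc k ] = trans (zeroˡ _) (sym (zeroˡ _))

  B-fact : ∀ k l → B (k ℕ.+ l) k * (fact k * fact l) ≈ fact (k ℕ.+ l)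
  B-fact zero    l = trans (*-identityˡ _) (*-identityˡ _)
  B-fact (suc k) l = begin
    B (suc k ℕ.+ l) (suc k) * (⦅ + suc k ⦆ * fact k * fact l)
      ≈⟨ solve 4 (λ a b c d → a :* (b :* c :* d) := a :* b :* (c :* d)) refl (B (suc k ℕ.+ l) (suc k)) ⦅ + suc k ⦆ (fact k) (fact l) ⟩
    B (suc k ℕ.+ l) (suc k) * ⦅ + suc k ⦆ * (fact k * fact l)
      ≈⟨ *-congʳ (B-suc-suc (k ℕ.+ l) k) ⟩
    B (k ℕ.+ l) k * ⦅ + suc (k ℕ.+ l) ⦆ * (fact k * fact l)
      ≈⟨ solve 3 (λ a b c → a :* b :* c := b :* (a :* c)) refl (B (k ℕ.+ l) k) ⦅ + suc (k ℕ.+ l) ⦆ (fact k * fact l) ⟩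
    ⦅ + suc (k ℕ.+ l) ⦆ * (B (k ℕ.+ l) k * (fact k * fact l))
      ≈⟨ *-congˡ (B-fact k l) ⟩
    ⦅ + suc (k ℕ.+ l) ⦆ * fact (k ℕ.+ l) ∎

  B-factorials : ∀ k l → B (k ℕ.+ l) k ≈ fact (k ℕ.+ l) * ifact k * ifact l
  B-factorials k l = sym (begin
    fact (k ℕ.+ l) * ifact k * ifact l
      ≈⟨ *-congʳ (*-congʳ (B-fact k l)) ⟨
    B (k ℕ.+ l) k * (fact k * fact l) * ifact k * ifact l
      ≈⟨ solve 5 (λ b f f' g g' → b :* (f :* g) :* f' :* g' := b :* ((f :* f') :* (g :* g'))) refl
           (B (k ℕ.+ l) k) (fact k) (ifact k) (fact l) (ifact l) ⟩
    B (k ℕ.+ l) k * ((fact k * ifact k) * (fact l * ifact l))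
      ≈⟨ *-congˡ (trans (*-cong (fact-inverse k) (fact-inverse l)) (*-identityˡ 1#)) ⟩
    B (k ℕ.+ l) k * 1#
      ≈⟨ *-identityʳ _ ⟩
    B (k ℕ.+ l) k ∎)

  -- Summation by parts: Pascal's recursion is moved from the binomials to the weights `f`. The
  -- first summand is adapted by 1 = q^0, and the surplus last one vanishes because {n over n+1} =
  -- 0.
  ∑-B-pascal : ∀ n (f : ℕ → Carrier) → ∑< (2 ℕ.+ n) (λ j → B (suc n) j * f j) ≈
    ∑< (suc n) (λ j → B n j * (qp (+ j) * f j + qp (+ j ℤ.- + n) * f (suc j)))
  ∑-B-pascal n f = begin
    1# * f 0 + ∑< (suc n) (λ j → B (suc n) (suc j) * f (suc j))
      ≈⟨ +-cong (trans (sym (*-identityˡ _)) (*-congˡ (*-congʳ (sym qp-0))))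
           (∑-cong (suc n) λ j → solve 5 (λ q b r b' x → (q :* b :+ r :* b') :* x := b :* (q :* x) :+ b' :* (r :* x)) refl
              (qp (+ suc j)) (B n (suc j)) (qp (+ j ℤ.- + n)) (B n j) (f (suc j))) ⟩
    g 0 + ∑< (suc n) (λ j → g (suc j) + h j)
      ≈⟨ +-congˡ (∑-+ (suc n) (g ∘ suc) h) ⟩
    g 0 + (∑< (suc n) (g ∘ suc) + ∑< (suc n) h)
      ≈⟨ +-assoc _ _ _ ⟨
    ∑< (2 ℕ.+ n) g + ∑< (suc n) h
      ≈⟨ +-congʳ (trans (∑-last (suc n) g) (trans (+-congˡ (trans (*-congʳ (B-vanishes (ℕ.n<1+n n))) (zeroˡ _))) (+-identityʳ _))) ⟩
    ∑< (suc n) g + ∑< (suc n) h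
      ≈⟨ ∑-+ (suc n) g h ⟨
    ∑< (suc n) (λ j → g j + h j)
      ≈⟨ ∑-cong (suc n) (λ j → distribˡ (B n j) (qp (+ j) * f j) (qp (+ j ℤ.- + n) * f (suc j))) ⟨
    ∑< (suc n) (λ j → B n j * (qp (+ j) * f j + qp (+ j ℤ.- + n) * f (suc j))) ∎
    where
    g h : ℕ → Carrier
    g j = B n j * (qp (+ j) * f j)
    h j = B n j * (qp (+ j ℤ.- + n) * f (suc j))

  -- The second falling product starts where the first ends, so they join into one; what remains is
  -- a quotient of quantum factorials.
  kbin-split : ∀ c k l → kbin c k * kbin (c ℤ.- + k) l ≈ B (k ℕ.+ l) k * kbin c (k ℕ.+ l)
  kbin-split c k l = begin
    falling c k * ifact k * (falling (c ℤ.- + k) l * ifact l)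
      ≈⟨ solve 4 (λ a b c d → a :* b :* (c :* d) := b :* d :* (a :* c)) refl (falling c k) (ifact k) (falling (c ℤ.- + k) l) (ifact l) ⟩
    ifact k * ifact l * (falling c k * falling (c ℤ.- + k) l)
      ≈⟨ *-congˡ (falling-+ c k l) ⟨
    ifact k * ifact l * falling c (k ℕ.+ l)
      ≈⟨ *-congˡ (fact-kbin c (k ℕ.+ l)) ⟨
    ifact k * ifact l * (fact (k ℕ.+ l) * kbin c (k ℕ.+ l))
      ≈⟨ solve 4 (λ a b c d → a :* b :* (c :* d) := c :* a :* b :* d) refl (ifact k) (ifact l) (fact (k ℕ.+ l)) (kbin c (k ℕ.+ l)) ⟩
    fact (k ℕ.+ l) * ifact k * ifact l * kbin c (k ℕ.+ l)
      ≈⟨ *-congʳ (B-factorials k l) ⟨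
    B (k ℕ.+ l) k * kbin c (k ℕ.+ l) ∎

  kbinℤ-split : ∀ c m t → kbinℤ c t * kbinℤ (c ℤ.- t) (+ m ℤ.- t) ≈ Bℤ m t * kbin c m
  kbinℤ-split c m -[1+ k ] = trans (zeroˡ _) (sym (zeroˡ _))
  kbinℤ-split c m (+ k) with k ℕ.≤? m
  ... | yes k≤m = ≡.subst (λ m → kbin c k * kbinℤ (c ℤ.- + k) (+ m ℤ.- + k) ≈ B m k * kbin c m) (ℕ.m+[n∸m]≡n k≤m)
                    (trans (*-congˡ (kbinℤ-≡ ≡.refl (e (+ k) (+ (m ℕ.∸ k))))) (kbin-split c k (m ℕ.∸ k)))
    where
    e : ∀ k l → k ℤ.+ l ℤ.- k ≡ l
    e = ℤ-Solver.solve-∀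
  ... | no k≰m = trans (trans (*-congˡ (negative (ℕ.≰⇒> k≰m))) (zeroʳ _)) (sym (trans (*-congʳ (B-vanishes (ℕ.≰⇒> k≰m))) (zeroˡ _)))
    where
    e : ∀ m l → m ℤ.- (1ℤ ℤ.+ m ℤ.+ l) ≡ ℤ.- (1ℤ ℤ.+ l)
    e = ℤ-Solver.solve-∀
    negative : ∀ {c k} → m ℕ.< k → kbinℤ c (+ m ℤ.- + k) ≈ 0#
    negative {c} {k} m<k = kbinℤ-≡ {t' = -[1+ k ℕ.∸ suc m ]} ≡.refl
      (≡.trans (≡.cong (λ k → + m ℤ.- + k) (≡.sym (ℕ.m+[n∸m]≡n m<k))) (e (+ m) (+ (k ℕ.∸ suc m))))

  -- Induction on n.  Multiplied by {n+m+1}_q, the left-hand side splits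
  -- through the cases d and d - 1, the right-hand side through Pascal's rule
  -- for {n+1 over j}; the two agree summand by summand.
  kbinℤ-product : ∀ n m d c → kbinℤ c (+ n ℤ.- d) * kbinℤ (c ℤ.+ d) (+ m ℤ.+ d) ≈
    ∑< (suc n) (λ j → B n j * (Bℤ m (+ j ℤ.- d) * kbin (c ℤ.+ + j) (n ℕ.+ m)))
  kbinℤ-product zero m d c = begin
    -- For n = 0 the two binomials are consecutive, since c - t = c + d when t = -d, and one summand
    -- is enough.
    kbinℤ c (0ℤ ℤ.- d) * kbinℤ (c ℤ.+ d) (+ m ℤ.+ d)
      ≈⟨ *-congˡ (kbinℤ-≡ (e c d) (e (+ m) d)) ⟩
    kbinℤ c (0ℤ ℤ.- d) * kbinℤ (c ℤ.- (0ℤ ℤ.- d)) (+ m ℤ.- (0ℤ ℤ.- d))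
      ≈⟨ kbinℤ-split c m (0ℤ ℤ.- d) ⟩
    Bℤ m (0ℤ ℤ.- d) * kbin c m
      ≈⟨ *-congˡ (kbinℤ-≡ (≡.sym (ℤ.+-identityʳ c)) (≡.refl {x = + m})) ⟩
    Bℤ m (0ℤ ℤ.- d) * kbin (c ℤ.+ 0ℤ) m
      ≈⟨ *-identityˡ _ ⟨
    1# * (Bℤ m (0ℤ ℤ.- d) * kbin (c ℤ.+ 0ℤ) m)
      ≈⟨ +-identityʳ _ ⟨
    1# * (Bℤ m (0ℤ ℤ.- d) * kbin (c ℤ.+ 0ℤ) m) + 0# ∎
    where
    e : ∀ c d → c ℤ.+ d ≡ c ℤ.- (0ℤ ℤ.- d)
    e = ℤ-Solver.solve-∀
  kbinℤ-product (suc n) m d c = ⦅suc⦆-cancel N (begin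
    ⦅ + suc N ⦆ * (kbinℤ c a * kbinℤ (c ℤ.+ d) b)
      ≈⟨ *-congʳ (trans (⦅⦆-≡ (e₁ (+ n) (+ m) d)) (⦅⦆-+ a b)) ⟩
    (qp b * ⦅ a ⦆ + qp (ℤ.- a) * ⦅ b ⦆) * (kbinℤ c a * kbinℤ (c ℤ.+ d) b)
      ≈⟨ solve 6 (λ q s r s' x z → (q :* s :+ r :* s') :* (x :* z) := q :* (s :* x) :* z :+ r :* (s' :* z) :* x) refl
           (qp b) ⦅ a ⦆ (qp (ℤ.- a)) ⦅ b ⦆ (kbinℤ c a) (kbinℤ (c ℤ.+ d) b) ⟩
    qp b * (⦅ a ⦆ * kbinℤ c a) * kbinℤ (c ℤ.+ d) b + qp (ℤ.- a) * (⦅ b ⦆ * kbinℤ (c ℤ.+ d) b) * kbinℤ c a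
      -- The first summand loses the last factor of the left binomial and keeps d; the second loses
      -- the first factor of the right binomial, which replaces d by d - 1.
      ≈⟨ +-cong (*-congʳ (*-congˡ lastStep)) (*-congʳ (*-congˡ firstStep)) ⟩
    qp b * (kbinℤ c (+ n ℤ.- d) * y (c ℤ.- (+ n ℤ.- d))) * kbinℤ (c ℤ.+ d) b
      + qp (ℤ.- a) * (y (c ℤ.+ d) * kbinℤ (c ℤ.+ (d ℤ.- 1ℤ)) (+ m ℤ.+ (d ℤ.- 1ℤ))) * kbinℤ c a
      ≈⟨ +-cong (solve 4 (λ q x w z → q :* (x :* w) :* z := q :* w :* (x :* z)) refl (qp b) (kbinℤ c (+ n ℤ.- d)) (y (c ℤ.- (+ n ℤ.- d))) (kbinℤ (c ℤ.+ d) b))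
           (trans (solve 4 (λ q w z x → q :* (w :* z) :* x := q :* w :* (x :* z)) refl (qp (ℤ.- a)) (y (c ℤ.+ d)) (kbinℤ (c ℤ.+ (d ℤ.- 1ℤ)) (+ m ℤ.+ (d ℤ.- 1ℤ))) (kbinℤ c a))
             (*-congˡ (*-congʳ (kbinℤ-≡ ≡.refl (e₂ (+ n) d))))) ⟩
    P * (kbinℤ c (+ n ℤ.- d) * kbinℤ (c ℤ.+ d) b)
      + Q * (kbinℤ c (+ n ℤ.- (d ℤ.- 1ℤ)) * kbinℤ (c ℤ.+ (d ℤ.- 1ℤ)) (+ m ℤ.+ (d ℤ.- 1ℤ)))
      ≈⟨ +-cong (*-congˡ (kbinℤ-product n m d c)) (*-congˡ (kbinℤ-product n m (d ℤ.- 1ℤ) c)) ⟩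
    P * ∑< (suc n) (g d) + Q * ∑< (suc n) (g (d ℤ.- 1ℤ))
      ≈⟨ +-cong (∑-* (suc n) P (g d)) (∑-* (suc n) Q (g (d ℤ.- 1ℤ))) ⟩
    ∑< (suc n) (λ j → P * g d j) + ∑< (suc n) (λ j → Q * g (d ℤ.- 1ℤ) j)
      ≈⟨ ∑-+ (suc n) (λ j → P * g d j) (λ j → Q * g (d ℤ.- 1ℤ) j) ⟨
    ∑< (suc n) (λ j → P * g d j + Q * g (d ℤ.- 1ℤ) j)
      ≈⟨ ∑-cong (suc n) summand ⟩
    ∑< (suc n) (λ j → ⦅ + suc N ⦆ * (B n j * (qp (+ j) * f j + qp (+ j ℤ.- + n) * f (suc j))))
      ≈⟨ ∑-* (suc n) ⦅ + suc N ⦆ (λ j → B n j * (qp (+ j) * f j + qp (+ j ℤ.- + n) * f (suc j))) ⟨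
    ⦅ + suc N ⦆ * ∑< (suc n) (λ j → B n j * (qp (+ j) * f j + qp (+ j ℤ.- + n) * f (suc j)))
      ≈⟨ *-congˡ (∑-B-pascal n f) ⟨
    ⦅ + suc N ⦆ * ∑< (2 ℕ.+ n) (λ j → B (suc n) j * f j) ∎)
    where
    N = n ℕ.+ m
    a = + suc n ℤ.- d
    b = + m ℤ.+ d
    P = qp b * y (c ℤ.- (+ n ℤ.- d))
    Q = qp (ℤ.- a) * y (c ℤ.+ d)
    g : ℤ → ℕ → Carrier
    g d j = B n j * (Bℤ m (+ j ℤ.- d) * kbin (c ℤ.+ + j) N)
    f : ℕ → Carrier
    f j = Bℤ m (+ j ℤ.- d) * kbin (c ℤ.+ + j) (suc N)

    e₁ : ∀ n m d → 1ℤ ℤ.+ (n ℤ.+ m) ≡ 1ℤ ℤ.+ n ℤ.- d ℤ.+ (m ℤ.+ d)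
    e₁ = ℤ-Solver.solve-∀
    e₂ : ∀ n d → 1ℤ ℤ.+ n ℤ.- d ≡ n ℤ.- (d ℤ.- 1ℤ)
    e₂ = ℤ-Solver.solve-∀
    e₃ : ∀ n d → 1ℤ ℤ.+ n ℤ.- d ≡ 1ℤ ℤ.+ (n ℤ.- d)
    e₃ = ℤ-Solver.solve-∀
    e₄ : ∀ m d → m ℤ.+ d ≡ 1ℤ ℤ.+ (m ℤ.+ (d ℤ.- 1ℤ))
    e₄ = ℤ-Solver.solve-∀
    e₅ : ∀ c d → c ℤ.+ d ℤ.- 1ℤ ≡ c ℤ.+ (d ℤ.- 1ℤ)
    e₅ = ℤ-Solver.solve-∀

    lastStep : ⦅ a ⦆ * kbinℤ c a ≈ kbinℤ c (+ n ℤ.- d) * y (c ℤ.- (+ n ℤ.- d))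
    lastStep = trans (*-cong (⦅⦆-≡ (e₃ (+ n) d)) (kbinℤ-≡ ≡.refl (e₃ (+ n) d))) (kbinℤ-last c (+ n ℤ.- d))

    firstStep : ⦅ b ⦆ * kbinℤ (c ℤ.+ d) b ≈ y (c ℤ.+ d) * kbinℤ (c ℤ.+ (d ℤ.- 1ℤ)) (+ m ℤ.+ (d ℤ.- 1ℤ))
    firstStep = trans (*-cong (⦅⦆-≡ (e₄ (+ m) d)) (kbinℤ-≡ ≡.refl (e₄ (+ m) d)))
      (trans (kbinℤ-first (c ℤ.+ d) (+ m ℤ.+ (d ℤ.- 1ℤ))) (*-congˡ (kbinℤ-≡ (e₅ c d) (≡.refl {x = + m ℤ.+ (d ℤ.- 1ℤ)}))))

    -- `y-shift` moves the factors in `P` and `Q` to the two that extend [K;c+j;N] to the binomials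
    -- with N + 1. Both moves leave an error K q^h times a quantum integer, with the same h, and
    -- `Bℤ-absorb` makes the two errors cancel.
    bracket : ∀ j → let k = + j ℤ.- d in
      P * Bℤ m k + Q * Bℤ m (1ℤ ℤ.+ k) ≈
      qp (+ j) * y (c ℤ.+ + j ℤ.- + N) * Bℤ m k + qp (+ j ℤ.- + n) * y (c ℤ.+ (1ℤ ℤ.+ + j)) * Bℤ m (1ℤ ℤ.+ k)
    bracket j = begin
      P * β₀ + Q * β₁
        ≈⟨ +-congʳ (*-congʳ Pshift) ⟩
      (qp (+ j) * y (c ℤ.+ + j ℤ.- + N) + κ * qp h * ⦅ + m ℤ.- k ⦆) * β₀ + Q * β₁
        ≈⟨ solve 5 (λ u w s b v → (u :+ w :* s) :* b :+ v := u :* b :+ (v :+ w :* (b :* s))) refl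
             (qp (+ j) * y (c ℤ.+ + j ℤ.- + N)) (κ * qp h) ⦅ + m ℤ.- k ⦆ β₀ (Q * β₁) ⟩
      qp (+ j) * y (c ℤ.+ + j ℤ.- + N) * β₀ + (Q * β₁ + κ * qp h * (β₀ * ⦅ + m ℤ.- k ⦆))
        ≈⟨ +-congˡ (+-congˡ (*-congˡ (Bℤ-absorb m k))) ⟩
      qp (+ j) * y (c ℤ.+ + j ℤ.- + N) * β₀ + (Q * β₁ + κ * qp h * (β₁ * ⦅ 1ℤ ℤ.+ k ⦆))
        ≈⟨ +-congˡ (solve 4 (λ u w s b → u :* b :+ w :* (b :* s) := (u :+ w :* s) :* b) refl Q (κ * qp h) ⦅ 1ℤ ℤ.+ k ⦆ β₁) ⟩
      qp (+ j) * y (c ℤ.+ + j ℤ.- + N) * β₀ + (Q + κ * qp h * ⦅ 1ℤ ℤ.+ k ⦆) * β₁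
        ≈⟨ +-congˡ (*-congʳ Qshift) ⟨
      qp (+ j) * y (c ℤ.+ + j ℤ.- + N) * β₀ + qp (+ j ℤ.- + n) * y (c ℤ.+ (1ℤ ℤ.+ + j)) * β₁ ∎
      where
      k = + j ℤ.- d
      β₀ = Bℤ m k
      β₁ = Bℤ m (1ℤ ℤ.+ k)
      h = c ℤ.+ + j ℤ.- + n ℤ.+ d
      i₁ : ∀ m d j → m ℤ.+ d ≡ j ℤ.+ (m ℤ.- (j ℤ.- d))
      i₁ = ℤ-Solver.solve-∀
      i₂ : ∀ c n m d j → c ℤ.- (n ℤ.- d) ≡ c ℤ.+ j ℤ.- (n ℤ.+ m) ℤ.+ (m ℤ.- (j ℤ.- d))
      i₂ = ℤ-Solver.solve-∀
      i₃ : ∀ c n m d j → j ℤ.+ (c ℤ.+ j ℤ.- (n ℤ.+ m)) ℤ.+ (m ℤ.- (j ℤ.- d)) ≡ c ℤ.+ j ℤ.- n ℤ.+ d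
      i₃ = ℤ-Solver.solve-∀
      i₄ : ∀ n d j → j ℤ.- n ≡ ℤ.- (1ℤ ℤ.+ n ℤ.- d) ℤ.+ (1ℤ ℤ.+ (j ℤ.- d))
      i₄ = ℤ-Solver.solve-∀
      i₅ : ∀ c d j → c ℤ.+ (1ℤ ℤ.+ j) ≡ c ℤ.+ d ℤ.+ (1ℤ ℤ.+ (j ℤ.- d))
      i₅ = ℤ-Solver.solve-∀
      i₆ : ∀ c n d j → ℤ.- (1ℤ ℤ.+ n ℤ.- d) ℤ.+ (c ℤ.+ d) ℤ.+ (1ℤ ℤ.+ (j ℤ.- d)) ≡ c ℤ.+ j ℤ.- n ℤ.+ d
      i₆ = ℤ-Solver.solve-∀
      Pshift : P ≈ qp (+ j) * y (c ℤ.+ + j ℤ.- + N) + κ * qp h * ⦅ + m ℤ.- k ⦆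
      Pshift = trans (*-cong (qp-≡ (i₁ (+ m) d (+ j))) (y-≡ (i₂ c (+ n) (+ m) d (+ j))))
        (trans (y-shift (+ j) (c ℤ.+ + j ℤ.- + N) (+ m ℤ.- k))
               (+-congˡ (*-congʳ (*-congˡ (qp-≡ (i₃ c (+ n) (+ m) d (+ j)))))))
      Qshift : qp (+ j ℤ.- + n) * y (c ℤ.+ (1ℤ ℤ.+ + j)) ≈ Q + κ * qp h * ⦅ 1ℤ ℤ.+ k ⦆
      Qshift = trans (*-cong (qp-≡ (i₄ (+ n) d (+ j))) (y-≡ (i₅ c d (+ j))))
        (trans (y-shift (ℤ.- a) (c ℤ.+ d) (1ℤ ℤ.+ k))
               (+-congˡ (*-congʳ (*-congˡ (qp-≡ (i₆ c (+ n) d (+ j)))))))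

    -- After `bracket`, `y₀` joins [K;c+j;N] as a new last factor and `y₁` joins it as a new first
    -- factor, the latter raising c + j by one.
    summand : ∀ j → P * g d j + Q * g (d ℤ.- 1ℤ) j ≈ ⦅ + suc N ⦆ * (B n j * (qp (+ j) * f j + qp (+ j ℤ.- + n) * f (suc j)))
    summand j = begin
      P * (B n j * (β₀ * x)) + Q * (B n j * (Bℤ m (+ j ℤ.- (d ℤ.- 1ℤ)) * x))
        ≈⟨ +-congˡ (*-congˡ (*-congˡ (*-congʳ (Bℤ-≡ (i₁ d (+ j)))))) ⟩
      P * (B n j * (β₀ * x)) + Q * (B n j * (β₁ * x))
        ≈⟨ solve 6 (λ p b u x q v → p :* (b :* (u :* x)) :+ q :* (b :* (v :* x)) := b :* (p :* u :+ q :* v) :* x) refl P (B n j) β₀ x Q β₁ ⟩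
      B n j * (P * β₀ + Q * β₁) * x
        ≈⟨ *-congʳ (*-congˡ (bracket j)) ⟩
      B n j * (qp (+ j) * y₀ * β₀ + qp (+ j ℤ.- + n) * y₁ * β₁) * x
        ≈⟨ solve 8 (λ b q w u r w' v x → b :* (q :* w :* u :+ r :* w' :* v) :* x := b :* (q :* u :* (x :* w) :+ r :* v :* (w' :* x))) refl
             (B n j) (qp (+ j)) y₀ β₀ (qp (+ j ℤ.- + n)) y₁ β₁ x ⟩
      B n j * (qp (+ j) * β₀ * (x * y₀) + qp (+ j ℤ.- + n) * β₁ * (y₁ * x))
        ≈⟨ *-congˡ (+-cong (*-congˡ (kbinℤ-last (c ℤ.+ + j) (+ N)))
                           (*-congˡ (trans (kbinℤ-first (c ℤ.+ (1ℤ ℤ.+ + j)) (+ N)) (*-congˡ (kbinℤ-≡ (i₂ c (+ j)) (≡.refl {x = + N})))))) ⟨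
      B n j * (qp (+ j) * β₀ * (⦅ + suc N ⦆ * x₀) + qp (+ j ℤ.- + n) * β₁ * (⦅ + suc N ⦆ * x₁))
        ≈⟨ *-congˡ (+-congˡ (*-congʳ (*-congˡ (Bℤ-≡ (i₃ d (+ j)))))) ⟩
      B n j * (qp (+ j) * β₀ * (⦅ + suc N ⦆ * x₀) + qp (+ j ℤ.- + n) * Bℤ m (+ suc j ℤ.- d) * (⦅ + suc N ⦆ * x₁))
        ≈⟨ solve 8 (λ b q u s z r v z' → b :* (q :* u :* (s :* z) :+ r :* v :* (s :* z')) := s :* (b :* (q :* (u :* z) :+ r :* (v :* z')))) refl
             (B n j) (qp (+ j)) β₀ ⦅ + suc N ⦆ x₀ (qp (+ j ℤ.- + n)) (Bℤ m (+ suc j ℤ.- d)) x₁ ⟩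
      ⦅ + suc N ⦆ * (B n j * (qp (+ j) * f j + qp (+ j ℤ.- + n) * f (suc j))) ∎
      where
      x = kbin (c ℤ.+ + j) N
      x₀ = kbin (c ℤ.+ + j) (suc N)
      x₁ = kbin (c ℤ.+ + suc j) (suc N)
      y₀ = y (c ℤ.+ + j ℤ.- + N)
      y₁ = y (c ℤ.+ (1ℤ ℤ.+ + j))
      β₀ = Bℤ m (+ j ℤ.- d)
      β₁ = Bℤ m (1ℤ ℤ.+ (+ j ℤ.- d))
      i₁ : ∀ d j → j ℤ.- (d ℤ.- 1ℤ) ≡ 1ℤ ℤ.+ (j ℤ.- d)
      i₁ = ℤ-Solver.solve-∀
      i₂ : ∀ c j → c ℤ.+ (1ℤ ℤ.+ j) ℤ.- 1ℤ ≡ c ℤ.+ j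
      i₂ = ℤ-Solver.solve-∀
      i₃ : ∀ d j → 1ℤ ℤ.+ (j ℤ.- d) ≡ 1ℤ ℤ.+ j ℤ.- d
      i₃ = ℤ-Solver.solve-∀

  -- Clearing denominators in K-binomials

  qdiff : ℤ → Carrier
  qdiff n = qp n - qp (ℤ.- n)

  -- kcleared c t and qcleared t are the numerator and the denominator of
  -- [K;c;t] once the powers of q - q⁻¹ are cleared.
  kcleared : ℤ → ℕ → Carrier
  kcleared c zero    = 1#
  kcleared c (suc t) = (qp c * κ - qp (ℤ.- c) * κ⁻¹) * kcleared (c ℤ.- 1ℤ) t

  qcleared : ℕ → Carrier
  qcleared zero    = 1#
  qcleared (suc t) = qdiff (+ suc t) * qcleared t

  qcleared-kbin : ∀ c t → qcleared t * kbin c t ≈ kcleared c t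
  qcleared-kbin c zero    = trans (*-identityˡ _) (kbin-0 c)
  qcleared-kbin c (suc t) = begin
    qdiff (+ suc t) * qcleared t * kbin c (suc t)
      ≈⟨ *-identityˡ _ ⟨
    1# * (qdiff (+ suc t) * qcleared t * kbin c (suc t))
      -- The inserted 1 = (q - q⁻¹)δ is used up separately: δ makes `qdiff` a quantum integer, and q
      -- - q⁻¹ later cancels the δ inside [K;c].
      ≈⟨ *-congʳ δ-inverse ⟨
    qdiff 1ℤ * δ * (qdiff (+ suc t) * qcleared t * kbin c (suc t))
      ≈⟨ solve 5 (λ w d s q k → w :* d :* (s :* q :* k) := w :* q :* (s :* d :* k)) refl (qdiff 1ℤ) δ (qdiff (+ suc t)) (qcleared t) (kbin c (suc t)) ⟩
    qdiff 1ℤ * qcleared t * (⦅ + suc t ⦆ * kbin c (suc t))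
      ≈⟨ *-congˡ (kbinℤ-first c (+ t)) ⟩
    qdiff 1ℤ * qcleared t * (y c * kbin (c ℤ.- 1ℤ) t)
      ≈⟨ solve 5 (λ w q n d k → w :* q :* (n :* d :* k) := w :* d :* (n :* (q :* k))) refl
           (qdiff 1ℤ) (qcleared t) (qp c * κ - qp (ℤ.- c) * κ⁻¹) δ (kbin (c ℤ.- 1ℤ) t) ⟩
    qdiff 1ℤ * δ * ((qp c * κ - qp (ℤ.- c) * κ⁻¹) * (qcleared t * kbin (c ℤ.- 1ℤ) t))
      ≈⟨ *-cong δ-inverse (*-congˡ (qcleared-kbin (c ℤ.- 1ℤ) t)) ⟩
    1# * kcleared c (suc t)
      ≈⟨ *-identityˡ _ ⟩
    kcleared c (suc t) ∎

  -- One level of clearing a normal form: the top pair needs a denominator with one more factor, by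
  -- which the part already cleared has to be multiplied.
  qcleared-pair : ∀ t u w a b → qcleared t * u ≈ w →
    qcleared (suc t) * (u + (a * kbin 0ℤ (suc t) + b * kbin 1ℤ (suc t))) ≈
    qdiff (+ suc t) * w + (a * kcleared 0ℤ (suc t) + b * kcleared 1ℤ (suc t))
  qcleared-pair t u w a b eq = begin
    qcleared (suc t) * (u + (a * kbin 0ℤ (suc t) + b * kbin 1ℤ (suc t)))
      ≈⟨ solve 7 (λ d q u a x b z → d :* q :* (u :+ (a :* x :+ b :* z)) := d :* (q :* u) :+ (a :* (d :* q :* x) :+ b :* (d :* q :* z))) refl
           (qdiff (+ suc t)) (qcleared t) u a (kbin 0ℤ (suc t)) b (kbin 1ℤ (suc t)) ⟩
    qdiff (+ suc t) * (qcleared t * u) + (a * (qcleared (suc t) * kbin 0ℤ (suc t)) + b * (qcleared (suc t) * kbin 1ℤ (suc t)))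
      ≈⟨ +-cong (*-congˡ eq) (+-cong (*-congˡ (qcleared-kbin 0ℤ (suc t))) (*-congˡ (qcleared-kbin 1ℤ (suc t)))) ⟩
    qdiff (+ suc t) * w + (a * kcleared 0ℤ (suc t) + b * kcleared 1ℤ (suc t)) ∎

-- Commutative rings from one-sided laws

module _ {A : Set} {_≈_ : Rel A 0ℓ} (isEquivalence : IsEquivalence _≈_)
  {_+_ _*_ : Op₂ A} { -_ : Op₁ A} {0# 1# : A} where
  open Algebra.Definitions _≈_
  open IsEquivalence isEquivalence

  mkCommutativeRing : Congruent₂ _+_ → Congruent₂ _*_ → Congruent₁ -_ →
    Associative _+_ → Commutative _+_ → LeftIdentity 0# _+_ → RightInverse 0# -_ _+_ →
    Associative _*_ → Commutative _*_ → LeftIdentity 1# _*_ → _DistributesOverʳ_ _*_ _+_ →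
    CommutativeRing 0ℓ 0ℓ
  mkCommutativeRing +-cong *-cong -‿cong +-assoc +-comm +-idˡ -‿inverseʳ *-assoc *-comm *-idˡ distribʳ = record
    { isCommutativeRing = record
      { isRing = record
        { +-isAbelianGroup = record
          { isGroup = record
            { isMonoid = record
              { isSemigroup = record
                { isMagma = record { isEquivalence = isEquivalence ; ∙-cong = +-cong }
                ; assoc = +-assoc }
              ; identity = +-idˡ , λ x → trans (+-comm x 0#) (+-idˡ x) }
            ; inverse = (λ x → trans (+-comm (- x) x) (-‿inverseʳ x)) , -‿inverseʳ
            ; ⁻¹-cong = -‿cong }
          ; comm = +-comm }
        ; *-cong = *-cong
        ; *-assoc = *-assoc
        ; *-identity = *-idˡ , λ x → trans (*-comm x 1#) (*-idˡ x)
        ; distrib = (λ x y z → trans (*-comm x (y + z)) (trans (distribʳ x y z) (+-cong (*-comm y x) (*-comm z x)))) , distribʳ }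
      ; *-comm = *-comm } }

-- ℤ[q,q⁻¹,K,K⁻¹]

-- The record wrapper makes both sides recoverable from the type of a proof.
infix 4 _≋_
record _≋_ (p r : LPoly) : Set where
  constructor coeffwise
  field coeff≡ : p ≈L r
open _≋_ public

Monomial : Set
Monomial = ℤ × ℤ × ℤ

-- Kronecker's delta, which turns the case distinctions of `coeffL` into integer arithmetic.
[_≟_] : ℤ → ℤ → ℤ
[ a ≟ i ] with a ℤ.≟ i
... | yes _ = 1ℤ
... | no  _ = 0ℤ

[≟]-≢ : ∀ {a i} → a ≢ i → [ a ≟ i ] ≡ 0ℤ
[≟]-≢ {a} {i} a≢i with a ℤ.≟ i
... | yes a≡i = ⊥-elim (a≢i a≡i)
... | no _    = ≡.refl

[≟]-shift : ∀ a a' i → [ a ℤ.+ a' ≟ i ] ≡ [ a' ≟ i ℤ.- a ]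
[≟]-shift a a' i with a ℤ.+ a' ℤ.≟ i | a' ℤ.≟ i ℤ.- a
... | yes _  | yes _  = ≡.refl
... | no  _  | no  _  = ≡.refl
... | yes eq | no neq = ⊥-elim (neq (≡.trans (e a a') (≡.cong (ℤ._- a) eq)))
  where
  e : ∀ a a' → a' ≡ a ℤ.+ a' ℤ.- a
  e = ℤ-Solver.solve-∀
... | no neq | yes eq = ⊥-elim (neq (≡.trans (≡.cong (λ z → a ℤ.+ z) eq) (e a i)))
  where
  e : ∀ a i → a ℤ.+ (i ℤ.- a) ≡ i
  e = ℤ-Solver.solve-∀

coeffL-∷ : ∀ c a b p i j → coeffL ((c , a , b) ∷ p) i j ≡ c ℤ.* ([ a ≟ i ] ℤ.* [ b ≟ j ]) ℤ.+ coeffL p i j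
coeffL-∷ c a b p i j with a ℤ.≟ i | b ℤ.≟ j
... | yes _ | yes _ = ≡.cong (ℤ._+ coeffL p i j) (≡.sym (ℤ.*-identityʳ c))
... | yes _ | no  _ = e c (coeffL p i j)
  where
  e : ∀ c x → x ≡ c ℤ.* 0ℤ ℤ.+ x
  e = ℤ-Solver.solve-∀
... | no _  | yes _ = e c (coeffL p i j)
  where
  e : ∀ c x → x ≡ c ℤ.* 0ℤ ℤ.+ x
  e = ℤ-Solver.solve-∀
... | no _  | no  _ = e c (coeffL p i j)
  where
  e : ∀ c x → x ≡ c ℤ.* 0ℤ ℤ.+ x
  e = ℤ-Solver.solve-∀

coeffL-++ : ∀ p r i j → coeffL (p ++ r) i j ≡ coeffL p i j ℤ.+ coeffL r i j
coeffL-++ []                r i j = ≡.sym (ℤ.+-identityˡ _)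
coeffL-++ ((c , a , b) ∷ p) r i j = begin
  coeffL ((c , a , b) ∷ p ++ r) i j                                          ≡⟨ coeffL-∷ c a b (p ++ r) i j ⟩
  x ℤ.+ coeffL (p ++ r) i j                                                  ≡⟨ ≡.cong (λ z → x ℤ.+ z) (coeffL-++ p r i j) ⟩
  x ℤ.+ (coeffL p i j ℤ.+ coeffL r i j)                                      ≡⟨ ℤ.+-assoc x _ _ ⟨
  x ℤ.+ coeffL p i j ℤ.+ coeffL r i j                                        ≡⟨ ≡.cong (ℤ._+ coeffL r i j) (coeffL-∷ c a b p i j) ⟨
  coeffL ((c , a , b) ∷ p) i j ℤ.+ coeffL r i j                              ∎
  where
  open ≡.≡-Reasoning
  x = c ℤ.* ([ a ≟ i ] ℤ.* [ b ≟ j ])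

infixr 7 _·ₘ_
_·ₘ_ : Monomial → LPoly → LPoly
(c , a , b) ·ₘ p = map (λ { (c' , a' , b') → c ℤ.* c' , a ℤ.+ a' , b ℤ.+ b' }) p

coeffL-·ₘ : ∀ c a b p i j → coeffL ((c , a , b) ·ₘ p) i j ≡ c ℤ.* coeffL p (i ℤ.- a) (j ℤ.- b)
coeffL-·ₘ c a b []                  i j = ≡.sym (ℤ.*-zeroʳ c)
coeffL-·ₘ c a b ((c' , a' , b') ∷ p) i j = begin
  coeffL ((c , a , b) ·ₘ ((c' , a' , b') ∷ p)) i j
    ≡⟨ coeffL-∷ (c ℤ.* c') (a ℤ.+ a') (b ℤ.+ b') _ i j ⟩
  c ℤ.* c' ℤ.* ([ a ℤ.+ a' ≟ i ] ℤ.* [ b ℤ.+ b' ≟ j ]) ℤ.+ coeffL ((c , a , b) ·ₘ p) i j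
    ≡⟨ ≡.cong₂ ℤ._+_ (≡.cong (c ℤ.* c' ℤ.*_) (≡.cong₂ ℤ._*_ ([≟]-shift a a' i) ([≟]-shift b b' j))) (coeffL-·ₘ c a b p i j) ⟩
  c ℤ.* c' ℤ.* ([ a' ≟ i ℤ.- a ] ℤ.* [ b' ≟ j ℤ.- b ]) ℤ.+ c ℤ.* coeffL p (i ℤ.- a) (j ℤ.- b)
    ≡⟨ e c c' _ _ ⟩
  c ℤ.* (c' ℤ.* ([ a' ≟ i ℤ.- a ] ℤ.* [ b' ≟ j ℤ.- b ]) ℤ.+ coeffL p (i ℤ.- a) (j ℤ.- b))
    ≡⟨ ≡.cong (c ℤ.*_) (coeffL-∷ c' a' b' p (i ℤ.- a) (j ℤ.- b)) ⟨
  c ℤ.* coeffL ((c' , a' , b') ∷ p) (i ℤ.- a) (j ℤ.- b) ∎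
  where
  open ≡.≡-Reasoning
  e : ∀ c c' x y → c ℤ.* c' ℤ.* x ℤ.+ c ℤ.* y ≡ c ℤ.* (c' ℤ.* x ℤ.+ y)
  e = ℤ-Solver.solve-∀

-- The pattern-matching lambdas of _*L_ and _·ₘ_ are different functions to
-- Agda.
*L-∷ : ∀ m p r → (m ∷ p) *L r ≡ m ·ₘ r ++ p *L r
*L-∷ m p r = ≡.cong (_++ p *L r) (List.map-cong (λ _ → ≡.refl) r)

≋-isEquivalence : IsEquivalence _≋_
≋-isEquivalence = record
  { refl  = coeffwise λ i j → ≡.refl
  ; sym   = λ eq → coeffwise λ i j → ≡.sym (coeff≡ eq i j)
  ; trans = λ eq eq' → coeffwise λ i j → ≡.trans (coeff≡ eq i j) (coeff≡ eq' i j)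
  }

open IsEquivalence ≋-isEquivalence using () renaming (refl to ≋-refl; sym to ≋-sym; trans to ≋-trans; reflexive to ≋-reflexive)

++-cong : ∀ {p p' r r'} → p ≋ p' → r ≋ r' → p ++ r ≋ p' ++ r'
++-cong {p} {p'} {r} {r'} eq eq' = coeffwise λ i j →
  ≡.trans (coeffL-++ p r i j) (≡.trans (≡.cong₂ ℤ._+_ (coeff≡ eq i j) (coeff≡ eq' i j)) (≡.sym (coeffL-++ p' r' i j)))

++-comm : ∀ p r → p ++ r ≋ r ++ p
++-comm p r = coeffwise λ i j → ≡.trans (coeffL-++ p r i j) (≡.trans (ℤ.+-comm (coeffL p i j) _) (≡.sym (coeffL-++ r p i j)))

++-swap : ∀ p r s → p ++ (r ++ s) ≋ r ++ (p ++ s)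
++-swap p r s = ≋-trans (≋-reflexive (≡.sym (List.++-assoc p r s))) (≋-trans (++-cong (++-comm p r) ≋-refl) (≋-reflexive (List.++-assoc r p s)))

·ₘ-cong : ∀ m {p r} → p ≋ r → m ·ₘ p ≋ m ·ₘ r
·ₘ-cong (c , a , b) {p} {r} eq = coeffwise λ i j →
  ≡.trans (coeffL-·ₘ c a b p i j) (≡.trans (≡.cong (c ℤ.*_) (coeff≡ eq (i ℤ.- a) (j ℤ.- b))) (≡.sym (coeffL-·ₘ c a b r i j)))

*L-congˡ : ∀ p {r r'} → r ≋ r' → p *L r ≋ p *L r'
*L-congˡ []      eq = ≋-refl
*L-congˡ (m ∷ p) {r} {r'} eq = ≋-trans (≋-reflexive (*L-∷ m p r))
  (≋-trans (++-cong (·ₘ-cong m eq) (*L-congˡ p eq)) (≋-reflexive (≡.sym (*L-∷ m p r'))))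

·ₘ-comm : ∀ m n → m ·ₘ (n ∷ []) ≡ n ·ₘ (m ∷ [])
·ₘ-comm (c , a , b) (c' , a' , b') = ≡.cong (_∷ []) (≡.cong₂ _,_ (ℤ.*-comm c c') (≡.cong₂ _,_ (ℤ.+-comm a a') (ℤ.+-comm b b')))

*L-zeroʳ : ∀ p → p *L [] ≡ []
*L-zeroʳ []      = ≡.refl
*L-zeroʳ (m ∷ p) = *L-zeroʳ p

*L-∷ʳ : ∀ p m r → p *L (m ∷ r) ≋ m ·ₘ p ++ p *L r
*L-∷ʳ []      m r = ≋-refl
*L-∷ʳ (n ∷ p) m r = ≋-trans (≋-reflexive (*L-∷ n p (m ∷ r)))
  (≋-trans (++-cong (≋-reflexive (≡.cong (_++ n ·ₘ r) (·ₘ-comm n m))) (*L-∷ʳ p m r))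
  (≋-trans (++-cong (≋-refl {m ·ₘ (n ∷ [])}) (++-swap (n ·ₘ r) (m ·ₘ p) (p *L r)))
           (≋-reflexive (≡.cong (λ s → m ·ₘ (n ∷ p) ++ s) (≡.sym (*L-∷ n p r))))))

*L-comm : ∀ p r → p *L r ≋ r *L p
*L-comm []      r = ≋-reflexive (≡.sym (*L-zeroʳ r))
*L-comm (m ∷ p) r = ≋-trans (≋-reflexive (*L-∷ m p r))
  (≋-trans (++-cong (≋-refl {m ·ₘ r}) (*L-comm p r)) (≋-sym (*L-∷ʳ r m p)))

*L-cong : ∀ {p p' r r'} → p ≋ p' → r ≋ r' → p *L r ≋ p' *L r'
*L-cong {p} {p'} {r} {r'} eq eq' = ≋-trans (*L-congˡ p eq')
  (≋-trans (*L-comm p r') (≋-trans (*L-congˡ r' eq) (*L-comm r' p')))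

*L-distribʳ : ∀ s p r → (p ++ r) *L s ≡ p *L s ++ r *L s
*L-distribʳ s []      r = ≡.refl
*L-distribʳ s (m ∷ p) r = begin
  (m ∷ p ++ r) *L s             ≡⟨ *L-∷ m (p ++ r) s ⟩
  m ·ₘ s ++ (p ++ r) *L s       ≡⟨ ≡.cong (m ·ₘ s ++_) (*L-distribʳ s p r) ⟩
  m ·ₘ s ++ (p *L s ++ r *L s)  ≡⟨ List.++-assoc (m ·ₘ s) _ _ ⟨
  (m ·ₘ s ++ p *L s) ++ r *L s  ≡⟨ ≡.cong (_++ r *L s) (*L-∷ m p s) ⟨
  (m ∷ p) *L s ++ r *L s        ∎
  where open ≡.≡-Reasoning

·ₘ-assoc : ∀ m n r → (m ·ₘ (n ∷ [])) *L r ≡ m ·ₘ n ·ₘ r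
·ₘ-assoc m@(c , a , b) n@(c' , a' , b') r = ≡.trans (List.++-identityʳ _)
  (≡.trans (List.map-cong (λ { (c″ , a″ , b″) → ≡.cong₂ _,_ (ℤ.*-assoc c c' c″) (≡.cong₂ _,_ (ℤ.+-assoc a a' a″) (ℤ.+-assoc b b' b″)) }) r)
           (List.map-∘ r))

·ₘ-*L-assoc : ∀ m p r → (m ·ₘ p) *L r ≡ m ·ₘ (p *L r)
·ₘ-*L-assoc m []      r = ≡.refl
·ₘ-*L-assoc m (n ∷ p) r = begin
  (m ·ₘ (n ∷ p)) *L r                      ≡⟨ *L-distribʳ r (m ·ₘ (n ∷ [])) (m ·ₘ p) ⟩
  (m ·ₘ (n ∷ [])) *L r ++ (m ·ₘ p) *L r    ≡⟨ ≡.cong₂ _++_ (·ₘ-assoc m n r) (·ₘ-*L-assoc m p r) ⟩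
  m ·ₘ n ·ₘ r ++ m ·ₘ (p *L r)             ≡⟨ List.map-++ _ (n ·ₘ r) (p *L r) ⟨
  m ·ₘ (n ·ₘ r ++ p *L r)                  ≡⟨ ≡.cong (m ·ₘ_) (*L-∷ n p r) ⟨
  m ·ₘ ((n ∷ p) *L r)                      ∎
  where open ≡.≡-Reasoning

*L-assoc : ∀ p r s → (p *L r) *L s ≡ p *L (r *L s)
*L-assoc []      r s = ≡.refl
*L-assoc (m ∷ p) r s = begin
  ((m ∷ p) *L r) *L s                 ≡⟨ ≡.cong (_*L s) (*L-∷ m p r) ⟩
  (m ·ₘ r ++ p *L r) *L s             ≡⟨ *L-distribʳ s (m ·ₘ r) (p *L r) ⟩
  (m ·ₘ r) *L s ++ (p *L r) *L s      ≡⟨ ≡.cong₂ _++_ (·ₘ-*L-assoc m r s) (*L-assoc p r s) ⟩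
  m ·ₘ (r *L s) ++ p *L (r *L s)      ≡⟨ *L-∷ m p (r *L s) ⟨
  (m ∷ p) *L (r *L s)                 ∎
  where open ≡.≡-Reasoning

mon : ℤ → ℤ → ℤ → LPoly
mon c a b = (c , a , b) ∷ []

1L : LPoly
1L = mon 1ℤ 0ℤ 0ℤ

mon-*L : ∀ c a b p → mon c a b *L p ≡ (c , a , b) ·ₘ p
mon-*L c a b p = ≡.trans (*L-∷ (c , a , b) [] p) (List.++-identityʳ _)

coeffL-mon-* : ∀ c a b p i j → coeffL (mon c a b *L p) i j ≡ c ℤ.* coeffL p (i ℤ.- a) (j ℤ.- b)
coeffL-mon-* c a b p i j = ≡.trans (≡.cong (λ r → coeffL r i j) (mon-*L c a b p)) (coeffL-·ₘ c a b p i j)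

*L-identityˡ : ∀ p → 1L *L p ≋ p
*L-identityˡ p = coeffwise λ i j → ≡.trans (coeffL-mon-* 1ℤ 0ℤ 0ℤ p i j)
  (≡.trans (ℤ.*-identityˡ _) (≡.cong₂ (coeffL p) (ℤ.+-identityʳ i) (ℤ.+-identityʳ j)))

-L_ : LPoly → LPoly
-L p = (-1ℤ , 0ℤ , 0ℤ) ·ₘ p

coeffL-neg : ∀ p i j → coeffL (-L p) i j ≡ ℤ.- coeffL p i j
coeffL-neg p i j = ≡.trans (coeffL-·ₘ -1ℤ 0ℤ 0ℤ p i j)
  (≡.trans (ℤ.-1*i≡-i _) (≡.cong ℤ.-_ (≡.cong₂ (coeffL p) (ℤ.+-identityʳ i) (ℤ.+-identityʳ j))))

laurentRing : CommutativeRing 0ℓ 0ℓ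
laurentRing = mkCommutativeRing ≋-isEquivalence {_++_} {_*L_} { -L_ } {[]} {1L}
  ++-cong *L-cong (λ {p} {r} → ·ₘ-cong (-1ℤ , 0ℤ , 0ℤ) {p} {r})
  (λ p r s → ≋-reflexive (List.++-assoc p r s)) ++-comm (λ _ → ≋-refl)
  (λ p → coeffwise λ i j → ≡.trans (coeffL-++ p (-L p) i j) (≡.trans (≡.cong (λ z → coeffL p i j ℤ.+ z) (coeffL-neg p i j)) (ℤ.+-inverseʳ (coeffL p i j))))
  (λ p r s → ≋-reflexive (*L-assoc p r s)) *L-comm *L-identityˡ
  (λ s p r → ≋-reflexive (*L-distribʳ s p r))

-- Polynomials in q with nonzero constant term are not zero divisors

coeffL-bounded : ∀ p → Σ ℕ λ M → ∀ i j → M ℕ.< ℤ.∣ i ∣ → coeffL p i j ≡ 0ℤ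
coeffL-bounded []                = 0 , λ _ _ _ → ≡.refl
coeffL-bounded ((c , a , b) ∷ p) with coeffL-bounded p
... | M , vanish = ℤ.∣ a ∣ ℕ.⊔ M , λ i j M<i → ≡.trans (coeffL-∷ c a b p i j)
  (≡.trans (≡.cong₂ ℤ._+_ (≡.cong (c ℤ.*_) (≡.cong (ℤ._* [ b ≟ j ]) ([≟]-≢ {a} {i} λ a≡i →
      ℕ.<-irrefl (≡.cong ℤ.∣_∣ a≡i) (ℕ.≤-<-trans (ℕ.m≤m⊔n ℤ.∣ a ∣ M) M<i))))
    (vanish i j (ℕ.≤-<-trans (ℕ.m≤n⊔m ℤ.∣ a ∣ M) M<i)))
  (≡.trans (ℤ.+-identityʳ _) (ℤ.*-zeroʳ c)))

module _ (f : ℤ → ℤ) where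
  -- The coefficient at q^i of the product of the polynomial `ds` with the series whose coefficients
  -- are `f`.
  convolve : List ℤ → ℤ → ℤ
  convolve []       i = 0ℤ
  convolve (d ∷ ds) i = d ℤ.* f i ℤ.+ convolve ds (i ℤ.- 1ℤ)

  convolve-vanishes : ∀ ds i → (∀ i' → i' ℤ.≤ i → f i' ≡ 0ℤ) → convolve ds i ≡ 0ℤ
  convolve-vanishes []       i f≡0 = ≡.refl
  convolve-vanishes (d ∷ ds) i f≡0 = ≡.cong₂ ℤ._+_
    (≡.trans (≡.cong (d ℤ.*_) (f≡0 i ℤ.≤-refl)) (ℤ.*-zeroʳ d))
    (convolve-vanishes ds (i ℤ.- 1ℤ) λ i' i'≤ → f≡0 i' (ℤ.≤-trans i'≤ (ℤ.i≤j⇒i-k≤j 1ℤ ℤ.≤-refl)))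

  -- At the lowest exponent where `f` might be nonzero, only the constant term of the polynomial
  -- contributes to the product. Hence the zeros of `f` spread upwards from the bound `M`.
  convolve-injective : ∀ ds → HeadNZ ds → (M : ℤ) → (∀ i → i ℤ.< M → f i ≡ 0ℤ) →
    (∀ i → convolve ds i ≡ 0ℤ) → ∀ i → f i ≡ 0ℤ
  convolve-injective (d ∷ ds) d≢0 M low conv≡0 i = step (suc ℤ.∣ i ℤ.- M ∣) i
    (≡.subst (ℤ._< M ℤ.+ + suc ℤ.∣ i ℤ.- M ∣) (e M i)
      (ℤ.+-monoʳ-< M (ℤ.≤-<-trans (i≤∣i∣ (i ℤ.- M)) (ℤ.+<+ (ℕ.n<1+n _)))))
    where
    e : ∀ M i → M ℤ.+ (i ℤ.- M) ≡ i
    e = ℤ-Solver.solve-∀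
    i≤∣i∣ : ∀ i → i ℤ.≤ + ℤ.∣ i ∣
    i≤∣i∣ (+ n)    = ℤ.≤-refl
    i≤∣i∣ -[1+ n ] = ℤ.-≤+
    step : ∀ k i → i ℤ.< M ℤ.+ + k → f i ≡ 0ℤ
    step zero    i i<M = low i (≡.subst (i ℤ.<_) (ℤ.+-identityʳ M) i<M)
    step (suc k) i i<M with ℤ.i*j≡0⇒i≡0∨j≡0 d product≡0
      where
      lower : ∀ i' → i' ℤ.≤ i ℤ.- 1ℤ → i' ℤ.< M ℤ.+ + k
      lower i' i'≤ = ℤ.≤-<-trans i'≤ (≡.subst (i ℤ.- 1ℤ ℤ.<_) (e' M (+ k)) (ℤ.+-monoˡ-< -1ℤ i<M))
        where
        e' : ∀ M k → M ℤ.+ (1ℤ ℤ.+ k) ℤ.- 1ℤ ≡ M ℤ.+ k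
        e' = ℤ-Solver.solve-∀
      product≡0 : d ℤ.* f i ≡ 0ℤ
      product≡0 = ≡.trans (≡.sym (ℤ.+-identityʳ _)) (≡.trans (≡.cong (λ z → d ℤ.* f i ℤ.+ z)
        (≡.sym (convolve-vanishes ds (i ℤ.- 1ℤ) λ i' i'≤ → step k i' (lower i' i'≤)))) (conv≡0 i))
    ... | inj₁ d≡0  = ⊥-elim (d≢0 d≡0)
    ... | inj₂ fi≡0 = fi≡0

coeffL-polyToL : ∀ e ds p i j → coeffL (polyToL e ds *L p) i j ≡ convolve (λ i → coeffL p i j) ds (i ℤ.- + e)
coeffL-polyToL e []       p i j = ≡.refl
coeffL-polyToL e (d ∷ ds) p i j = begin
  coeffL (polyToL e (d ∷ ds) *L p) i j
    ≡⟨ ≡.cong (λ r → coeffL r i j) (*L-distribʳ p (mon d (+ e) 0ℤ) (polyToL (suc e) ds)) ⟩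
  coeffL (mon d (+ e) 0ℤ *L p ++ polyToL (suc e) ds *L p) i j
    ≡⟨ coeffL-++ (mon d (+ e) 0ℤ *L p) _ i j ⟩
  coeffL (mon d (+ e) 0ℤ *L p) i j ℤ.+ coeffL (polyToL (suc e) ds *L p) i j
    ≡⟨ ≡.cong₂ ℤ._+_ (≡.trans (coeffL-mon-* d (+ e) 0ℤ p i j) (≡.cong (λ j → d ℤ.* coeffL p (i ℤ.- + e) j) (ℤ.+-identityʳ j)))
         (≡.trans (coeffL-polyToL (suc e) ds p i j) (≡.cong (convolve (λ i → coeffL p i j) ds) (shift i (+ e)))) ⟩
  convolve (λ i → coeffL p i j) (d ∷ ds) (i ℤ.- + e) ∎
  where
  open ≡.≡-Reasoning
  shift : ∀ i e → i ℤ.- (1ℤ ℤ.+ e) ≡ i ℤ.- e ℤ.- 1ℤ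
  shift = ℤ-Solver.solve-∀

polyToL-injective : ∀ ds → HeadNZ ds → ∀ p → polyToL 0 ds *L p ≋ [] → p ≋ []
polyToL-injective ds nz p eq with coeffL-bounded p
... | M , vanish = coeffwise λ i j → convolve-injective (λ i → coeffL p i j) ds nz (ℤ.- + M)
  (λ i i<-M → vanish i j (beyond M i i<-M))
  (λ i → ≡.trans (≡.sym (≡.trans (coeffL-polyToL 0 ds p i j) (≡.cong (convolve _ ds) (ℤ.+-identityʳ i)))) (coeff≡ eq i j))
  i
  where
  beyond : ∀ M i → i ℤ.< ℤ.- + M → M ℕ.< ℤ.∣ i ∣
  beyond zero    -[1+ n ] _           = ℕ.z<s
  beyond zero    (+ n)    (ℤ.+<+ ())
  beyond (suc M) -[1+ n ] (ℤ.-<- M<n) = ℕ.s<s M<n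

denL-injective : ∀ ds p → denL ds *L p ≋ [] → p ≋ []
denL-injective []              p eq = ≋-trans (≋-sym (*L-identityˡ p)) eq
denL-injective ((d , nz) ∷ ds) p eq = denL-injective ds p (polyToL-injective d nz (denL ds *L p)
  (≋-trans (≋-reflexive (≡.sym (*L-assoc (polyToL 0 d) (denL ds) p))) eq))

denL-++ : ∀ ds es → denL (ds ++ es) ≋ denL ds *L denL es
denL-++ []              es = ≋-sym (*L-identityˡ (denL es))
denL-++ ((d , nz) ∷ ds) es = ≋-trans (*L-congˡ (polyToL 0 d) (denL-++ ds es))
  (≋-reflexive (≡.sym (*L-assoc (polyToL 0 d) (denL ds) (denL es))))

-- Cross-multiplication is transitive as an equality of fractions only because denominators can be
-- cancelled.
denL-cancel : ∀ ds p r → denL ds *L p ≋ denL ds *L r → p ≋ r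
denL-cancel ds p r eq = x∙y⁻¹≈ε⇒x≈y p r (denL-injective ds (p ++ -L r) (≋-trans (distribˡ (denL ds) p (-L r))
  (≋-trans (++-cong eq (≋-sym (-‿distribʳ-* (denL ds) r))) (-‿inverseʳ (denL ds *L r)))))
  where
  open CommutativeRing laurentRing using (distribˡ; -‿inverseʳ; ring; +-group)
  open import Algebra.Properties.Ring ring using (-‿distribʳ-*)
  open import Algebra.Properties.Group +-group using (x∙y⁻¹≈ε⇒x≈y)

-- ℚ(q)[K,K⁻¹]

record Denominators (𝓛 : CommutativeRing 0ℓ 0ℓ) (D : Set) : Set where
  open CommutativeRing 𝓛
  field
    ⟦_⟧       : List D → Carrier
    ⟦[]⟧≈1    : ⟦ [] ⟧ ≈ 1#
    ⟦++⟧      : ∀ ds es → ⟦ ds ++ es ⟧ ≈ ⟦ ds ⟧ * ⟦ es ⟧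
    ⟦⟧-cancel : ∀ ds x y → ⟦ ds ⟧ * x ≈ ⟦ ds ⟧ * y → x ≈ y

module Localisation {𝓛 : CommutativeRing 0ℓ 0ℓ} {D : Set} (denominators : Denominators 𝓛 D) where
  open CommutativeRing 𝓛
  open Denominators denominators
  open RingSolver 𝓛
  open Relation.Binary.Reasoning.Setoid setoid

  Fraction : Set
  Fraction = Carrier × List D

  infix 4 _≃_
  _≃_ : Rel Fraction 0ℓ
  (n , ds) ≃ (m , es) = n * ⟦ es ⟧ ≈ m * ⟦ ds ⟧

  _⊞_ _⊡_ : Fraction → Fraction → Fraction
  (n , ds) ⊞ (m , es) = n * ⟦ es ⟧ + m * ⟦ ds ⟧ , ds ++ es
  (n , ds) ⊡ (m , es) = n * m , ds ++ es

  ⊟_ : Fraction → Fraction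
  ⊟ (n , ds) = - n , ds

  -- Concatenated denominators are first rewritten as products; what is left is a polynomial
  -- identity for the solver.
  ≃-via : ∀ {n n' m m' d' e'} ds es → n ≈ n' → ⟦ ds ⟧ ≈ d' → m ≈ m' → ⟦ es ⟧ ≈ e' → n' * e' ≈ m' * d' → (n , ds) ≃ (m , es)
  ≃-via ds es n≈ d≈ m≈ e≈ eq = trans (*-cong n≈ e≈) (trans eq (sym (*-cong m≈ d≈)))

  ≃-trans : ∀ x y z → x ≃ y → y ≃ z → x ≃ z
  ≃-trans (n , ds) (m , es) (l , fs) eq eq' = ⟦⟧-cancel es _ _ (begin
    ⟦ es ⟧ * (n * ⟦ fs ⟧)   ≈⟨ solve 3 (λ e n f → e :* (n :* f) := (n :* e) :* f) refl ⟦ es ⟧ n ⟦ fs ⟧ ⟩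
    (n * ⟦ es ⟧) * ⟦ fs ⟧   ≈⟨ *-congʳ eq ⟩
    (m * ⟦ ds ⟧) * ⟦ fs ⟧   ≈⟨ solve 3 (λ m d f → (m :* d) :* f := (m :* f) :* d) refl m ⟦ ds ⟧ ⟦ fs ⟧ ⟩
    (m * ⟦ fs ⟧) * ⟦ ds ⟧   ≈⟨ *-congʳ eq' ⟩
    (l * ⟦ es ⟧) * ⟦ ds ⟧   ≈⟨ solve 3 (λ l e d → (l :* e) :* d := e :* (l :* d)) refl l ⟦ es ⟧ ⟦ ds ⟧ ⟩
    ⟦ es ⟧ * (l * ⟦ ds ⟧)   ∎)

  ⊞-cong : ∀ x x' y y' → x ≃ x' → y ≃ y' → x ⊞ y ≃ x' ⊞ y'
  ⊞-cong (n , ds) (n' , ds') (m , es) (m' , es') eq eq' = ≃-via (ds ++ es) (ds' ++ es') refl (⟦++⟧ ds es) refl (⟦++⟧ ds' es') (begin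
    (n * e + m * d) * (d' * e')
      ≈⟨ solve 6 (λ n m d e d' e' → (n :* e :+ m :* d) :* (d' :* e') := (n :* d') :* (e :* e') :+ (m :* e') :* (d :* d')) refl n m d e d' e' ⟩
    (n * d') * (e * e') + (m * e') * (d * d')
      ≈⟨ +-cong (*-congʳ eq) (*-congʳ eq') ⟩
    (n' * d) * (e * e') + (m' * e) * (d * d')
      ≈⟨ solve 6 (λ n m d e d' e' → (n :* d) :* (e :* e') :+ (m :* e) :* (d :* d') := (n :* e' :+ m :* d') :* (d :* e)) refl n' m' d e d' e' ⟩
    (n' * e' + m' * d') * (d * e) ∎)
    where
    d = ⟦ ds ⟧
    e = ⟦ es ⟧
    d' = ⟦ ds' ⟧
    e' = ⟦ es' ⟧

  ⊡-cong : ∀ x x' y y' → x ≃ x' → y ≃ y' → x ⊡ y ≃ x' ⊡ y'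
  ⊡-cong (n , ds) (n' , ds') (m , es) (m' , es') eq eq' = ≃-via (ds ++ es) (ds' ++ es') refl (⟦++⟧ ds es) refl (⟦++⟧ ds' es') (begin
    (n * m) * (d' * e')  ≈⟨ solve 4 (λ n m d' e' → (n :* m) :* (d' :* e') := (n :* d') :* (m :* e')) refl n m d' e' ⟩
    (n * d') * (m * e')  ≈⟨ *-cong eq eq' ⟩
    (n' * d) * (m' * e)  ≈⟨ solve 4 (λ n m d' e' → (n :* d') :* (m :* e') := (n :* m) :* (d' :* e')) refl n' m' d e ⟩
    (n' * m') * (d * e)  ∎)
    where
    d = ⟦ ds ⟧
    e = ⟦ es ⟧
    d' = ⟦ ds' ⟧
    e' = ⟦ es' ⟧

  ⊟-cong : ∀ x x' → x ≃ x' → ⊟ x ≃ ⊟ x'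
  ⊟-cong (n , ds) (m , es) eq = begin
    - n * ⟦ es ⟧    ≈⟨ solve 2 (λ n e → :- n :* e := :- (n :* e)) refl n ⟦ es ⟧ ⟩
    - (n * ⟦ es ⟧)  ≈⟨ -‿cong eq ⟩
    - (m * ⟦ ds ⟧)  ≈⟨ solve 2 (λ n e → :- n :* e := :- (n :* e)) refl m ⟦ ds ⟧ ⟨
    - m * ⟦ ds ⟧    ∎

  ⟦++++⟧ˡ : ∀ ds es fs → ⟦ (ds ++ es) ++ fs ⟧ ≈ ⟦ ds ⟧ * ⟦ es ⟧ * ⟦ fs ⟧
  ⟦++++⟧ˡ ds es fs = trans (⟦++⟧ (ds ++ es) fs) (*-congʳ (⟦++⟧ ds es))

  ⟦++++⟧ʳ : ∀ ds es fs → ⟦ ds ++ (es ++ fs) ⟧ ≈ ⟦ ds ⟧ * (⟦ es ⟧ * ⟦ fs ⟧)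
  ⟦++++⟧ʳ ds es fs = trans (⟦++⟧ ds (es ++ fs)) (*-congˡ (⟦++⟧ es fs))

  ⊞-assoc : ∀ x y z → (x ⊞ y) ⊞ z ≃ x ⊞ (y ⊞ z)
  ⊞-assoc (n , ds) (m , es) (l , fs) = ≃-via ((ds ++ es) ++ fs) (ds ++ (es ++ fs))
    (+-congˡ (*-congˡ (⟦++⟧ ds es))) (⟦++++⟧ˡ ds es fs) (+-congʳ (*-congˡ (⟦++⟧ es fs))) (⟦++++⟧ʳ ds es fs)
    (solve 6 (λ n m l d e f → ((n :* e :+ m :* d) :* f :+ l :* (d :* e)) :* (d :* (e :* f))
                := (n :* (e :* f) :+ (m :* f :+ l :* e) :* d) :* (d :* e :* f)) refl n m l ⟦ ds ⟧ ⟦ es ⟧ ⟦ fs ⟧)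

  ⊞-comm : ∀ x y → x ⊞ y ≃ y ⊞ x
  ⊞-comm (n , ds) (m , es) = ≃-via (ds ++ es) (es ++ ds) refl (⟦++⟧ ds es) refl (⟦++⟧ es ds)
    (solve 4 (λ n m d e → (n :* e :+ m :* d) :* (e :* d) := (m :* d :+ n :* e) :* (d :* e)) refl n m ⟦ ds ⟧ ⟦ es ⟧)

  ⊞-identityˡ : ∀ x → (0# , []) ⊞ x ≃ x
  ⊞-identityˡ (n , ds) = *-congʳ (trans (+-cong (zeroˡ _) (trans (*-congˡ ⟦[]⟧≈1) (*-identityʳ n))) (+-identityˡ n))

  ⊟-inverseʳ : ∀ x → x ⊞ (⊟ x) ≃ (0# , [])
  ⊟-inverseʳ (n , ds) = trans (*-cong (solve 2 (λ n d → n :* d :+ :- n :* d := d :- d) refl n ⟦ ds ⟧) ⟦[]⟧≈1)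
    (trans (*-identityʳ _) (trans (-‿inverseʳ ⟦ ds ⟧) (sym (zeroˡ _))))

  ⊡-assoc : ∀ x y z → (x ⊡ y) ⊡ z ≃ x ⊡ (y ⊡ z)
  ⊡-assoc (n , ds) (m , es) (l , fs) = ≃-via ((ds ++ es) ++ fs) (ds ++ (es ++ fs))
    refl (⟦++++⟧ˡ ds es fs) refl (⟦++++⟧ʳ ds es fs)
    (solve 6 (λ n m l d e f → ((n :* m) :* l) :* (d :* (e :* f)) := (n :* (m :* l)) :* (d :* e :* f)) refl n m l ⟦ ds ⟧ ⟦ es ⟧ ⟦ fs ⟧)

  ⊡-comm : ∀ x y → x ⊡ y ≃ y ⊡ x
  ⊡-comm (n , ds) (m , es) = ≃-via (ds ++ es) (es ++ ds) refl (⟦++⟧ ds es) refl (⟦++⟧ es ds)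
    (solve 4 (λ n m d e → (n :* m) :* (e :* d) := (m :* n) :* (d :* e)) refl n m ⟦ ds ⟧ ⟦ es ⟧)

  ⊡-identityˡ : ∀ x → (1# , []) ⊡ x ≃ x
  ⊡-identityˡ (n , ds) = *-congʳ (*-identityˡ n)

  ⊡-distribʳ : ∀ z x y → (x ⊞ y) ⊡ z ≃ (x ⊡ z) ⊞ (y ⊡ z)
  ⊡-distribʳ (l , fs) (n , ds) (m , es) = ≃-via ((ds ++ es) ++ fs) ((ds ++ fs) ++ (es ++ fs))
    refl (⟦++++⟧ˡ ds es fs) (+-cong (*-congˡ (⟦++⟧ es fs)) (*-congˡ (⟦++⟧ ds fs)))
    (trans (⟦++⟧ (ds ++ fs) (es ++ fs)) (*-cong (⟦++⟧ ds fs) (⟦++⟧ es fs)))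
    (solve 6 (λ n m l d e f → ((n :* e :+ m :* d) :* l) :* ((d :* f) :* (e :* f))
                := ((n :* l) :* (e :* f) :+ (m :* l) :* (d :* f)) :* (d :* e :* f)) refl n m l ⟦ ds ⟧ ⟦ es ⟧ ⟦ fs ⟧)

denominators : Denominators laurentRing Den
denominators = record { ⟦_⟧ = denL ; ⟦[]⟧≈1 = CommutativeRing.refl laurentRing ; ⟦++⟧ = denL-++ ; ⟦⟧-cancel = denL-cancel }

module Fractions = Localisation denominators

infix 4 _≃_
record _≃_ (x y : R) : Set where
  constructor crossMul
  field crossMul≈ : num x *L denL (den y) ≋ num y *L denL (den x)
open _≃_ public

≃⇒≈R : ∀ {x y} → x ≃ y → x ≈R y
≃⇒≈R eq = coeff≡ (crossMul≈ eq)

≈R⇒≃ : ∀ {x y} → x ≈R y → x ≃ y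
≈R⇒≃ eq = crossMul (coeffwise eq)

≃-isEquivalence : IsEquivalence _≃_
≃-isEquivalence = record
  { refl  = crossMul L.refl
  ; sym   = λ eq → crossMul (L.sym (crossMul≈ eq))
  ; trans = λ {x} {y} {z} eq eq' → crossMul (Fractions.≃-trans (toF x) (toF y) (toF z) (crossMul≈ eq) (crossMul≈ eq'))
  }
  where
  module L = CommutativeRing laurentRing
  toF : R → Fractions.Fraction
  toF x = num x , den x

-- The operations are opaque because Agda otherwise compares fractions by
-- unfolding them to lists of monomials.
opaque
  infixl 6 _+ᴿ_
  infixl 7 _*ᴿ_
  infix  8 -ᴿ_
  _+ᴿ_ _*ᴿ_ : R → R → R
  _+ᴿ_ = _+R_
  _*ᴿ_ = _*R_

  -ᴿ_ : R → R
  -ᴿ x = (-L num x) / den x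

  +ᴿ≡+R : ∀ x y → x +ᴿ y ≡ x +R y
  +ᴿ≡+R x y = ≡.refl

  *ᴿ≡*R : ∀ x y → x *ᴿ y ≡ x *R y
  *ᴿ≡*R x y = ≡.refl

module _ where
  private
    module F = Fractions
    toF : R → F.Fraction
    toF x = num x , den x
  open Algebra.Definitions _≃_

  opaque
    unfolding _+ᴿ_ _*ᴿ_ -ᴿ_

    +ᴿ-cong : Congruent₂ _+ᴿ_
    +ᴿ-cong {x} {x'} {y} {y'} eq eq' = crossMul (F.⊞-cong (toF x) (toF x') (toF y) (toF y') (crossMul≈ eq) (crossMul≈ eq'))

    *ᴿ-cong : Congruent₂ _*ᴿ_
    *ᴿ-cong {x} {x'} {y} {y'} eq eq' = crossMul (F.⊡-cong (toF x) (toF x') (toF y) (toF y') (crossMul≈ eq) (crossMul≈ eq'))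

    -ᴿ-cong : Congruent₁ -ᴿ_
    -ᴿ-cong {x} {x'} eq = crossMul (F.⊟-cong (toF x) (toF x') (crossMul≈ eq))

    +ᴿ-assoc : Associative _+ᴿ_
    +ᴿ-assoc x y z = crossMul (F.⊞-assoc (toF x) (toF y) (toF z))

    +ᴿ-comm : Commutative _+ᴿ_
    +ᴿ-comm x y = crossMul (F.⊞-comm (toF x) (toF y))

    +ᴿ-identityˡ : LeftIdentity zeroR _+ᴿ_
    +ᴿ-identityˡ x = crossMul (F.⊞-identityˡ (toF x))

    -ᴿ-inverseʳ : RightInverse zeroR -ᴿ_ _+ᴿ_
    -ᴿ-inverseʳ x = crossMul (F.⊟-inverseʳ (toF x))

    *ᴿ-assoc : Associative _*ᴿ_
    *ᴿ-assoc x y z = crossMul (F.⊡-assoc (toF x) (toF y) (toF z))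

    *ᴿ-comm : Commutative _*ᴿ_
    *ᴿ-comm x y = crossMul (F.⊡-comm (toF x) (toF y))

    *ᴿ-identityˡ : LeftIdentity oneR _*ᴿ_
    *ᴿ-identityˡ x = crossMul (F.⊡-identityˡ (toF x))

    *ᴿ-distribʳ : _DistributesOverʳ_ _*ᴿ_ _+ᴿ_
    *ᴿ-distribʳ z x y = crossMul (F.⊡-distribʳ (toF z) (toF x) (toF y))

fractionRing : CommutativeRing 0ℓ 0ℓ
fractionRing = mkCommutativeRing ≃-isEquivalence {_+ᴿ_} {_*ᴿ_} { -ᴿ_ } {zeroR} {oneR}
  +ᴿ-cong *ᴿ-cong -ᴿ-cong +ᴿ-assoc +ᴿ-comm +ᴿ-identityˡ -ᴿ-inverseʳ *ᴿ-assoc *ᴿ-comm *ᴿ-identityˡ *ᴿ-distribʳ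

open CommutativeRing laurentRing using () renaming (*-identityʳ to *L-identityʳ)
open CommutativeRing fractionRing
  using (+-cong; +-congˡ; *-cong; *-congˡ; *-congʳ; +-assoc; +-comm; +-identityˡ; +-identityʳ;
         *-assoc; *-comm; *-identityˡ; *-identityʳ; zeroˡ; zeroʳ; distribˡ; distribʳ; -‿cong; -‿inverseʳ)
  renaming (refl to ≃-refl; sym to ≃-sym; trans to ≃-trans; reflexive to ≃-reflexive)
open Algebra.Properties.Ring (CommutativeRing.ring fractionRing) using (-1*x≈-x; -‿distribˡ-*)

num-cong : ∀ {p r} ds → p ≋ r → (p / ds) ≃ (r / ds)
num-cong ds eq = crossMul (*L-cong eq ≋-refl)

fromL : LPoly → R
fromL p = p / []

fromL-cong : ∀ {p r} → p ≋ r → fromL p ≃ fromL r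
fromL-cong = num-cong []

fromL-injective : ∀ {p r} → fromL p ≃ fromL r → p ≋ r
fromL-injective eq = ≋-trans (≋-sym (*L-identityʳ _)) (≋-trans (crossMul≈ eq) (*L-identityʳ _))

opaque
  unfolding _+ᴿ_ _*ᴿ_ -ᴿ_

  fromL-++ : ∀ p r → fromL (p ++ r) ≃ fromL p +ᴿ fromL r
  fromL-++ p r = fromL-cong (++-cong (≋-sym (*L-identityʳ p)) (≋-sym (*L-identityʳ r)))

-- The embedding of ℤ[q,q⁻¹]

emb : Aelt → LPoly
emb a = num (embA a)

emb-++ : ∀ p r → emb (p ++ r) ≡ emb p ++ emb r
emb-++ p r = List.map-++ _ p r

emb-*A : ∀ p r → emb (p *A r) ≡ emb p *L emb r
emb-*A []            r = ≡.refl
emb-*A ((c , d) ∷ p) r = ≡.trans (emb-++ _ (p *A r))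
  (≡.cong₂ _++_ (≡.trans (≡.sym (List.map-∘ r)) (≡.trans (List.map-cong (λ _ → ≡.refl) r) (List.map-∘ r))) (emb-*A p r))

embA-+ : ∀ a b → embA (a +A b) ≃ embA a +ᴿ embA b
embA-+ a b = ≃-trans (≃-reflexive (≡.cong fromL (emb-++ a b))) (fromL-++ (emb a) (emb b))

opaque
  unfolding _+ᴿ_ _*ᴿ_ -ᴿ_

  embA-* : ∀ a b → embA (a *A b) ≃ embA a *ᴿ embA b
  embA-* a b = ≃-reflexive (≡.cong fromL (emb-*A a b))

coeffL-emb-0 : ∀ a i → coeffL (emb a) i 0ℤ ≡ coeffA a i
coeffL-emb-0 []            i = ≡.refl
coeffL-emb-0 ((c , d) ∷ a) i with d ℤ.≟ i
... | yes _ = ≡.cong (λ z → c ℤ.+ z) (coeffL-emb-0 a i)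
... | no  _ = coeffL-emb-0 a i

coeffL-emb-≢0 : ∀ a i j → j ≢ 0ℤ → coeffL (emb a) i j ≡ 0ℤ
coeffL-emb-≢0 []            i j j≢0 = ≡.refl
coeffL-emb-≢0 ((c , d) ∷ a) i j j≢0 = ≡.trans (coeffL-∷ c d 0ℤ (emb a) i j)
  (≡.trans (≡.cong₂ ℤ._+_ (≡.trans (≡.cong (λ z → c ℤ.* ([ d ≟ i ] ℤ.* z)) ([≟]-≢ {0ℤ} {j} (j≢0 ∘ ≡.sym))) (e c [ d ≟ i ])) (coeffL-emb-≢0 a i j j≢0)) ≡.refl)
  where
  e : ∀ c x → c ℤ.* (x ℤ.* 0ℤ) ≡ 0ℤ
  e = ℤ-Solver.solve-∀

emb-cong : ∀ {a b} → a ≈A b → emb a ≋ emb b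
emb-cong {a} {b} a≈b = coeffwise λ i j → go i j (j ℤ.≟ 0ℤ)
  where
  go : ∀ i j → _ → coeffL (emb a) i j ≡ coeffL (emb b) i j
  go i j (yes ≡.refl) = ≡.trans (coeffL-emb-0 a i) (≡.trans (a≈b i) (≡.sym (coeffL-emb-0 b i)))
  go i j (no j≢0)     = ≡.trans (coeffL-emb-≢0 a i j j≢0) (≡.sym (coeffL-emb-≢0 b i j j≢0))

embA-cong : ∀ {a b} → a ≈A b → embA a ≃ embA b
embA-cong a≈b = fromL-cong (emb-cong a≈b)

-- Quantum parameters of ℚ(q)[K,K⁻¹]

qp : ℤ → R
qp a = fromL (mon 1ℤ a 0ℤ)

opaque
  unfolding _*ᴿ_

  qp-+ : ∀ a b → qp (a ℤ.+ b) ≃ qp a *ᴿ qp b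
  qp-+ a b = ≃-refl

  KR*K⁻¹R : KR *ᴿ K⁻¹R ≃ oneR
  KR*K⁻¹R = ≃-refl

1/[q-q⁻¹] : R
1/[q-q⁻¹] = mon 1ℤ 1ℤ 0ℤ / (q²-1 ∷ [])

0∷ : ∀ a b p → (0ℤ , a , b) ∷ p ≋ p
0∷ a b p = coeffwise λ i j → ≡.trans (coeffL-∷ 0ℤ a b p i j) (ℤ.+-identityˡ _)

opaque
  unfolding _+ᴿ_ _*ᴿ_ -ᴿ_

  [q-q⁻¹]-inverse : (qp 1ℤ +ᴿ (-ᴿ qp -1ℤ)) *ᴿ 1/[q-q⁻¹] ≃ oneR
  [q-q⁻¹]-inverse = crossMul (≋-trans (++-comm (mon 1ℤ (+ 2) 0ℤ) (mon -1ℤ 0ℤ 0ℤ))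
    (++-cong (≋-refl {mon -1ℤ 0ℤ 0ℤ}) (≋-sym (0∷ 1ℤ 0ℤ (mon 1ℤ (+ 2) 0ℤ)))))

open FiniteSums fractionRing

fromL-applyUpTo : ∀ (g : ℕ → Monomial) n → fromL (applyUpTo g n) ≃ ∑< n (λ j → fromL (g j ∷ []))
fromL-applyUpTo g zero    = ≃-refl
fromL-applyUpTo g (suc n) = ≃-trans (fromL-++ (g 0 ∷ []) (applyUpTo (g ∘ suc) n)) (+-congˡ {fromL (g 0 ∷ [])} {fromL (applyUpTo (g ∘ suc) n)} {∑< n (λ j → fromL (g (suc j) ∷ []))} (fromL-applyUpTo (g ∘ suc) n))

emb-qintA : ∀ n → emb (qintA n) ≡ applyUpTo (λ j → 1ℤ , + (2 ℕ.* j) ℤ.- + n ℤ.+ 1ℤ , 0ℤ) n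
emb-qintA n = ≡.trans (≡.sym (List.map-∘ (upTo n))) (List.map-upTo _ n)

qint : ∀ n → embA (qintA n) ≃ (qp (+ n) +ᴿ (-ᴿ qp (ℤ.- + n))) *ᴿ 1/[q-q⁻¹]
qint n = ≃-trans (≃-reflexive (≡.cong fromL (emb-qintA n)))
  (≃-trans (fromL-applyUpTo (λ j → 1ℤ , + (2 ℕ.* j) ℤ.- + n ℤ.+ 1ℤ , 0ℤ) n)
           (QuantumIntegers.qint-sum fractionRing qp qp-+ 1/[q-q⁻¹] [q-q⁻¹]-inverse n))

polyToL-evens : ∀ e m → polyToL e (evens m) ≋ applyUpTo (λ j → 1ℤ , + (2 ℕ.* j ℕ.+ e) , 0ℤ) (suc m)
polyToL-evens e zero    = ≋-refl
polyToL-evens e (suc m) = ++-cong (≋-refl {mon 1ℤ (+ e) 0ℤ}) (≋-trans (0∷ (+ suc e) 0ℤ _)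
  (≋-trans (polyToL-evens (2 ℕ.+ e) m) (≋-reflexive (applyUpTo-cong (λ j → ≡.cong (λ n → 1ℤ , + n , 0ℤ) (shift j)) (suc m)))))
  where
  shift : ∀ j → 2 ℕ.* j ℕ.+ (2 ℕ.+ e) ≡ 2 ℕ.* suc j ℕ.+ e
  shift j = ≡.trans (≡.sym (ℕ.+-assoc (2 ℕ.* j) 2 e)) (≡.cong (ℕ._+ e) (≡.trans (ℕ.+-comm (2 ℕ.* j) 2) (≡.sym (ℕ.*-suc 2 j))))
  applyUpTo-cong : ∀ {f g : ℕ → Monomial} → (∀ j → f j ≡ g j) → ∀ n → applyUpTo f n ≡ applyUpTo g n
  applyUpTo-cong {f} {g} eq n = ≡.trans (≡.sym (List.map-upTo f n)) (≡.trans (List.map-cong eq (upTo n)) (List.map-upTo g n))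

opaque
  unfolding _+ᴿ_ _*ᴿ_ -ᴿ_

  -- Here q^m {m+1} = 1 + q² + ... + q^(2m), which is exactly the denominator of `inv-qint-suc`.
  qintA-inverse : ∀ m → embA (qintA (suc m)) *ᴿ inv-qint-suc m ≃ oneR
  qintA-inverse m = crossMul (≋-trans (*L-identityʳ _) (≋-trans (*L-comm (emb (qintA (suc m))) (mon 1ℤ (+ m) 0ℤ))
    (≋-trans (≋-reflexive (≡.trans (mon-*L 1ℤ (+ m) 0ℤ (emb (qintA (suc m)))) (≡.trans (≡.cong ((1ℤ , + m , 0ℤ) ·ₘ_) (≡.sym (List.map-∘ (upTo (suc m)))))
      (≡.trans (≡.sym (List.map-∘ (upTo (suc m)))) (≡.trans (List.map-cong (λ j → ≡.cong (λ x → 1ℤ , x , 0ℤ) (e (+ m) (+ (2 ℕ.* j)))) (upTo (suc m)))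
        (List.map-upTo (λ j → 1ℤ , + (2 ℕ.* j ℕ.+ 0) , 0ℤ) (suc m)))))))
    (≋-trans (≋-sym (polyToL-evens 0 m)) (≋-trans (≋-sym (*L-identityʳ _)) (≋-sym (*L-identityˡ _)))))))
    where
    e : ∀ m x → m ℤ.+ (x ℤ.- (1ℤ ℤ.+ m) ℤ.+ 1ℤ) ≡ x ℤ.+ 0ℤ
    e = ℤ-Solver.solve-∀

qint-inverse : ∀ m → (qp (+ suc m) +ᴿ (-ᴿ qp (ℤ.- + suc m))) *ᴿ 1/[q-q⁻¹] *ᴿ inv-qint-suc m ≃ oneR
qint-inverse m = ≃-trans (*-congʳ {inv-qint-suc m} (≃-sym (qint (suc m)))) (qintA-inverse m)

quantumParameters : QuantumParameters fractionRing
quantumParameters = record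
  { qp = qp ; qp-+ = qp-+ ; qp-0 = ≃-refl ; κ = KR ; κ⁻¹ = K⁻¹R ; δ = 1/[q-q⁻¹] ; κκ⁻¹≈1 = KR*K⁻¹R
  ; δ-inverse = [q-q⁻¹]-inverse ; ι = inv-qint-suc ; ι-inverse = qint-inverse }

module Q = QuantumBinomials quantumParameters

opaque
  unfolding _+ᴿ_ _*ᴿ_ -ᴿ_

  Kbr≃y : ∀ a → Kbr a ≃ Q.y a
  Kbr≃y a = num-cong (q²-1 ∷ []) (≋-reflexive (≡.cong₂ (λ x z → (1ℤ , x , 1ℤ) ∷ (-1ℤ , z , -1ℤ) ∷ []) (e₁ a) (e₂ a)))
    where
    e₁ : ∀ a → a ℤ.+ 1ℤ ≡ a ℤ.+ 0ℤ ℤ.+ 0ℤ ℤ.+ 1ℤ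
    e₁ = ℤ-Solver.solve-∀
    e₂ : ∀ a → 1ℤ ℤ.- a ≡ 0ℤ ℤ.+ (ℤ.- a ℤ.+ 0ℤ) ℤ.+ 0ℤ ℤ.+ 1ℤ
    e₂ = ℤ-Solver.solve-∀

Kprod≃falling : ∀ c t → Kprod c t ≃ Q.falling c t
Kprod≃falling c zero    = ≃-refl
Kprod≃falling c (suc t) = ≃-trans (≃-reflexive (≡.sym (*ᴿ≡*R (Kbr c) (Kprod (c ℤ.- 1ℤ) t)))) $  *-cong (Kbr≃y c) (Kprod≃falling (c ℤ.- 1ℤ) t)

inv-qfact≃ifact : ∀ n → inv-qfact n ≃ Q.ifact n
inv-qfact≃ifact zero    = ≃-refl
inv-qfact≃ifact (suc n) = ≃-trans (≃-reflexive (≡.sym (*ᴿ≡*R (inv-qint-suc n) (inv-qfact n)))) $  *-congˡ {inv-qint-suc n} (inv-qfact≃ifact n)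

qfact≃fact : ∀ n → qfact n ≃ Q.fact n
qfact≃fact zero    = ≃-refl
qfact≃fact (suc n) = ≃-trans (≃-reflexive (≡.sym (*ᴿ≡*R (embA (qintA (suc n))) (qfact n)))) $ *-cong (qint (suc n)) (qfact≃fact n)

Kbin≃kbin : ∀ c t → Kbin c t ≃ Q.kbin c t
Kbin≃kbin c t = ≃-trans (≃-reflexive (≡.sym (*ᴿ≡*R (Kprod c t) (inv-qfact t)))) $ *-cong (Kprod≃falling c t) (inv-qfact≃ifact t)

qfactorials≃factorials : ∀ a b c → qfact a *R inv-qfact b *R inv-qfact c ≃ Q.fact a *ᴿ Q.ifact b *ᴿ Q.ifact c
qfactorials≃factorials a b c = ≃-trans
  (≃-reflexive (≡.sym (≡.trans (*ᴿ≡*R (qfact a *ᴿ inv-qfact b) (inv-qfact c)) (≡.cong (_*R inv-qfact c) (*ᴿ≡*R (qfact a) (inv-qfact b))))))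
  (*-cong (*-cong (qfact≃fact a) (inv-qfact≃ifact b)) (inv-qfact≃ifact c))

-- Case analysis with an abstract motive, which keeps Agda from normalising
-- the two branches.
qbinℕ-elim : ∀ (P : R → Set) n k → (k ℕ.≤ n → P (qfact n *R inv-qfact k *R inv-qfact (n ℕ.∸ k))) →
  (¬ k ℕ.≤ n → P zeroR) → P (qbinℕ n k)
qbinℕ-elim P n k yes-case no-case with k ℕ.≤? n
... | yes k≤n = yes-case k≤n
... | no k≰n  = no-case k≰n

qbinℕ≃B : ∀ n k → qbinℕ n k ≃ Q.B n k
qbinℕ≃B n k = qbinℕ-elim (_≃ Q.B n k) n k (λ k≤n → ≃-trans (qfactorials≃factorials n k (n ℕ.∸ k)) (quotient k≤n))
  (λ k≰n → ≃-sym (Q.B-vanishes (ℕ.≰⇒> k≰n)))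
  where
  quotient : k ℕ.≤ n → Q.fact n *ᴿ Q.ifact k *ᴿ Q.ifact (n ℕ.∸ k) ≃ Q.B n k
  quotient k≤n = ≡.subst (λ n' → Q.fact n' *ᴿ Q.ifact k *ᴿ Q.ifact (n ℕ.∸ k) ≃ Q.B n' k) (ℕ.m+[n∸m]≡n k≤n) (≃-sym (Q.B-factorials k (n ℕ.∸ k)))

qbin≃Bℤ : ∀ n k → qbin (+ n) k ≃ Q.Bℤ n k
qbin≃Bℤ n (+ k)    = qbinℕ≃B n k
qbin≃Bℤ n -[1+ k ] = ≃-refl

-- The recursion of `B` carried out in ℤ[q,q⁻¹]. It shows that quantum binomials lie there and
-- provides the coefficients for applications of the multiplication relation.
qbinA : ℕ → ℕ → Aelt
qbinA n       zero    = 1A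
qbinA zero    (suc k) = []
qbinA (suc n) (suc k) = ((1ℤ , + suc k) ∷ []) *A qbinA n (suc k) +A ((1ℤ , + k ℤ.- + n) ∷ []) *A qbinA n k

qbinAℤ : ℕ → ℤ → Aelt
qbinAℤ n (+ k)    = qbinA n k
qbinAℤ n -[1+ k ] = []

qbinA≃B : ∀ n k → embA (qbinA n k) ≃ Q.B n k
qbinA≃B n       zero    = ≃-refl
qbinA≃B zero    (suc k) = ≃-refl
qbinA≃B (suc n) (suc k) = ≃-trans
  (embA-+ (((1ℤ , + suc k) ∷ []) *A qbinA n (suc k)) (((1ℤ , + k ℤ.- + n) ∷ []) *A qbinA n k))
  (+-cong (≃-trans (embA-* ((1ℤ , + suc k) ∷ []) (qbinA n (suc k))) (*-congˡ {qp (+ suc k)} (qbinA≃B n (suc k))))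
          (≃-trans (embA-* ((1ℤ , + k ℤ.- + n) ∷ []) (qbinA n k)) (*-congˡ {qp (+ k ℤ.- + n)} (qbinA≃B n k))))

qbinAℤ≃qbin : ∀ n k → embA (qbinAℤ n k) ≃ qbin (+ n) k
qbinAℤ≃qbin n (+ k)    = ≃-trans (qbinA≃B n k) (≃-sym (qbinℕ≃B n k))
qbinAℤ≃qbin n -[1+ k ] = ≃-refl

-- Evaluation of terms and soundness of the relations

ℤ-induction : (P : ℤ → Set) → P 0ℤ → (∀ c → P c → P (c ℤ.+ 1ℤ)) → (∀ c → P (c ℤ.+ 1ℤ) → P c) → ∀ c → P c
ℤ-induction P p₀ up down (+ zero)      = p₀
ℤ-induction P p₀ up down (+ suc n)     = ≡.subst P (ℤ.+-comm (+ n) 1ℤ) (up (+ n) (ℤ-induction P p₀ up down (+ n)))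
ℤ-induction P p₀ up down -[1+ zero ]   = down -1ℤ p₀
ℤ-induction P p₀ up down -[1+ suc n ]  = down -[1+ suc n ] (ℤ-induction P p₀ up down -[1+ n ])

-- `eval` with the opaque operations, so that evaluated terms do not unfold to lists of monomials.
ev : Tm → R
ev (X c t) = Kbin c t
ev 𝟘       = zeroR
ev (u ⊕ v) = ev u +ᴿ ev v
ev (u ⊗ v) = ev u *ᴿ ev v
ev (a · u) = embA a *ᴿ ev u

ev≡eval : ∀ u → ev u ≡ eval u
ev≡eval (X c t) = ≡.refl
ev≡eval 𝟘       = ≡.refl
ev≡eval (u ⊕ v) = ≡.trans (+ᴿ≡+R (ev u) (ev v)) (≡.cong₂ _+R_ (ev≡eval u) (ev≡eval v))
ev≡eval (u ⊗ v) = ≡.trans (*ᴿ≡*R (ev u) (ev v)) (≡.cong₂ _*R_ (ev≡eval u) (ev≡eval v))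
ev≡eval (a · u) = ≡.trans (*ᴿ≡*R (embA a) (ev u)) (≡.cong (embA a *R_) (ev≡eval u))

opaque
  unfolding -ᴿ_

  embA-neg : ∀ c e → embA ((ℤ.- c , e) ∷ []) ≃ -ᴿ embA ((c , e) ∷ [])
  embA-neg c e = ≃-reflexive (≡.cong₂ (λ x y → fromL (mon x y 0ℤ)) (≡.sym (ℤ.-1*i≡-i c)) (≡.sym (ℤ.+-identityˡ e)))

embA-1A : ∀ x → embA -1A *ᴿ x ≃ -ᴿ x
embA-1A x = ≃-trans (*-congʳ (embA-neg 1ℤ 0ℤ)) (-1*x≈-x x)

ev-ΣT : ∀ f n → ev (ΣT (map f (upTo n))) ≃ ∑< n (ev ∘ f)
ev-ΣT f n = ≃-trans (≃-reflexive (≡.cong (ev ∘ ΣT) (List.map-upTo f n))) (go f n)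
  where
  go : ∀ f n → ev (ΣT (applyUpTo f n)) ≃ ∑< n (ev ∘ f)
  go f zero    = ≃-refl
  go f (suc n) = +-congˡ (go (f ∘ suc) n)

-- The substitution d = b - c turns t and s into n - d and m + d, which is the shape of the general
-- product formula.
Kbin-product : ∀ c b t s n m → + n ≡ + t ℤ.- c ℤ.+ b → + m ≡ + s ℤ.- b ℤ.+ c → (α β : ℕ → Aelt) →
  (∀ j → embA (α j) ≃ qbin (+ t ℤ.- c ℤ.+ b) ((c ℤ.+ + j) ℤ.- c)) →
  (∀ j → embA (β j) ≃ qbin (+ s ℤ.- b ℤ.+ c) ((c ℤ.+ + j) ℤ.- b)) →
  Kbin c t *ᴿ Kbin b s ≃ ∑< (suc n) (λ j → embA (α j) *ᴿ (embA (β j) *ᴿ Kbin (c ℤ.+ + j) (t ℕ.+ s)))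
Kbin-product c b t s n m eqn eqm α β α≃ β≃ =
  ≃-trans (*-cong (≃-trans (Kbin≃kbin c t) (Q.kbinℤ-≡ {t = + t} ≡.refl t≡)) (≃-trans (Kbin≃kbin b s) (Q.kbinℤ-≡ {t = + s} (e₁ b c) s≡)))
  (≃-trans (Q.kbinℤ-product n m d c)
  (∑-cong (suc n) λ j → *-cong (≃-sym (α≃B j)) (*-cong (≃-sym (β≃B j)) (≃-sym (≃-trans (Kbin≃kbin (c ℤ.+ + j) (t ℕ.+ s))
     (≃-reflexive (≡.cong (Q.kbin (c ℤ.+ + j)) (≡.sym n+m≡t+s))))))))
  where
  d = b ℤ.- c
  e₁ : ∀ b c → b ≡ c ℤ.+ (b ℤ.- c)
  e₁ = ℤ-Solver.solve-∀
  e₂ : ∀ t b c → t ≡ t ℤ.- c ℤ.+ b ℤ.- (b ℤ.- c)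
  e₂ = ℤ-Solver.solve-∀
  e₃ : ∀ s b c → s ≡ s ℤ.- b ℤ.+ c ℤ.+ (b ℤ.- c)
  e₃ = ℤ-Solver.solve-∀
  e₄ : ∀ t s b c → t ℤ.- c ℤ.+ b ℤ.+ (s ℤ.- b ℤ.+ c) ≡ t ℤ.+ s
  e₄ = ℤ-Solver.solve-∀
  e₅ : ∀ c j → c ℤ.+ j ℤ.- c ≡ j
  e₅ = ℤ-Solver.solve-∀
  e₆ : ∀ c b j → c ℤ.+ j ℤ.- b ≡ j ℤ.- (b ℤ.- c)
  e₆ = ℤ-Solver.solve-∀
  t≡ : + t ≡ + n ℤ.- d
  t≡ = ≡.trans (e₂ (+ t) b c) (≡.cong (ℤ._- d) (≡.sym eqn))
  s≡ : + s ≡ + m ℤ.+ d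
  s≡ = ≡.trans (e₃ (+ s) b c) (≡.cong (ℤ._+ d) (≡.sym eqm))
  n+m≡t+s : n ℕ.+ m ≡ t ℕ.+ s
  n+m≡t+s = ℤ.+-injective (≡.trans (≡.cong₂ ℤ._+_ eqn eqm) (e₄ (+ t) (+ s) b c))
  α≃B : ∀ j → embA (α j) ≃ Q.B n j
  α≃B j = ≃-trans (α≃ j) (≃-trans (≃-reflexive (≡.cong₂ qbin (≡.sym eqn) (e₅ c (+ j)))) (qbin≃Bℤ n (+ j)))
  β≃B : ∀ j → embA (β j) ≃ Q.Bℤ m (+ j ℤ.- d)
  β≃B j = ≃-trans (β≃ j) (≃-trans (≃-reflexive (≡.cong₂ qbin (≡.sym eqm) (e₆ c b (+ j)))) (qbin≃Bℤ m (+ j ℤ.- d)))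

ev-Xℤ : ∀ c t → ev (Xℤ c t) ≃ Q.kbinℤ c t
ev-Xℤ c (+ t)     = Kbin≃kbin c t
ev-Xℤ c -[1+ t ]  = ≃-refl

Kbin-recurrence : ∀ c t → 1 ℕ.≤ t → Kbin (c ℤ.+ + 2) t ≃ ev (qt+q-t t · X (c ℤ.+ 1ℤ) t ⊕ -1A · X c t ⊕ Xℤ c (+ t ℤ.- + 2))
Kbin-recurrence c (suc t) _ = ≃-trans (Kbin≃kbin (c ℤ.+ + 2) (suc t)) (≃-trans (recurrence t) (≃-sym
  (+-cong (+-cong (*-cong (embA-+ ((1ℤ , + suc t) ∷ []) ((1ℤ , ℤ.- + suc t) ∷ [])) (Kbin≃kbin (c ℤ.+ 1ℤ) (suc t)))
                  (≃-trans (embA-1A (Kbin c (suc t))) (-‿cong (Kbin≃kbin c (suc t)))))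
          (ev-Xℤ c (+ suc t ℤ.- + 2)))))
  where
  recurrence : ∀ t → Q.kbin (c ℤ.+ + 2) (suc t) ≃ (qp (+ suc t) +ᴿ qp (ℤ.- + suc t)) *ᴿ Q.kbin (c ℤ.+ 1ℤ) (suc t)
    +ᴿ (-ᴿ Q.kbin c (suc t)) +ᴿ Q.kbinℤ c (+ suc t ℤ.- + 2)
  -- For t = 1 the last binomial has lower index -1 and is zero by convention, as is its counterpart
  -- in the relation.
  recurrence zero    = Q.kbinℤ-recurrence c -1ℤ
  recurrence (suc w) = Q.kbinℤ-recurrence c (+ w)

ev-sound : ∀ {u v} → u ~ v → ev u ≃ ev v
ev-sound ~refl             = ≃-refl
ev-sound (~sym r)          = ≃-sym (ev-sound r)
ev-sound (~trans r r')     = ≃-trans (ev-sound r) (ev-sound r')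
ev-sound (~⊕ r r')         = +-cong (ev-sound r) (ev-sound r')
ev-sound (~⊗ r r')         = *-cong (ev-sound r) (ev-sound r')
ev-sound (~· a≈ r)         = *-cong (embA-cong a≈) (ev-sound r)
ev-sound (⊕-assoc u v w)   = +-assoc (ev u) (ev v) (ev w)
ev-sound (⊕-comm u v)      = +-comm (ev u) (ev v)
ev-sound (⊕-zero u)        = +-identityʳ (ev u)
ev-sound (⊕-inv u)         = ≃-trans (+-congˡ (embA-1A (ev u))) (-‿inverseʳ (ev u))
ev-sound (⊗-assoc u v w)   = *-assoc (ev u) (ev v) (ev w)
ev-sound (⊗-comm u v)      = *-comm (ev u) (ev v)
ev-sound (⊗-distr u v w)   = distribˡ (ev u) (ev v) (ev w)
ev-sound (·-distrA a b u)  = ≃-trans (*-congʳ (embA-+ a b)) (distribʳ (ev u) (embA a) (embA b))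
ev-sound (·-distrT a u v)  = distribˡ (embA a) (ev u) (ev v)
ev-sound (·-assoc a b u)   = ≃-trans (*-congʳ (embA-* a b)) (*-assoc (embA a) (embA b) (ev u))
ev-sound (·-one u)         = *-identityˡ (ev u)
ev-sound (·-⊗ a u v)       = ≃-sym (*-assoc (embA a) (ev u) (ev v))
ev-sound (rel-mult c b t s n m eqn eqm α β α≈ β≈) = ≃-trans
  (Kbin-product c b t s n m eqn eqm α β (λ j → ≈R⇒≃ (α≈ j)) (λ j → ≈R⇒≃ (β≈ j)))
  (≃-sym (ev-ΣT (λ j → α j · β j · X (c ℤ.+ + j) (t ℕ.+ s)) (suc n)))
ev-sound (rel-rec c t 1≤t) = Kbin-recurrence c t 1≤t

-- Generation of the Cartan subalgebra

u-+ᴿ : ∀ {x y} → InU x → InU y → InU (x +ᴿ y)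
u-+ᴿ {x} {y} p r = ≡.subst InU (≡.sym (+ᴿ≡+R x y)) (u-+ p r)

u-*ᴿ : ∀ {x y} → InU x → InU y → InU (x *ᴿ y)
u-*ᴿ {x} {y} p r = ≡.subst InU (≡.sym (*ᴿ≡*R x y)) (u-* p r)

u-≃ : ∀ {x y} → x ≃ y → InU x → InU y
u-≃ eq = u-resp (≃⇒≈R eq)

u-neg : ∀ {x} → InU x → InU (-ᴿ x)
u-neg {x} p = u-≃ (embA-1A x) (u-*ᴿ (u-A -1A) p)

u-qp : ∀ a → InU (qp a)
u-qp a = u-A ((1ℤ , a) ∷ [])

-- The generators have c = 0. For fixed t, the K⁻¹-form of Pascal's rule reaches all other c in both
-- directions, at the price of binomials with smaller t.
kbin∈U : ∀ t c → InU (Q.kbin c t)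
kbin∈U zero    c = u-≃ (≃-sym (Q.kbin-0 c)) (u-A 1A)
kbin∈U (suc t) = ℤ-induction (λ c → InU (Q.kbin c (suc t))) (u-≃ (Kbin≃kbin 0ℤ (suc t)) (u-gen (suc t)))
  (λ c p → u-≃ (≃-sym (Q.kbinℤ-pascal⁻¹ c (+ t)))
     (u-+ᴿ (u-*ᴿ (u-qp (+ suc t)) p) (u-*ᴿ (u-*ᴿ u-K⁻¹ (u-qp (+ t ℤ.- c))) (kbin∈U t c))))
  (λ c p → u-≃ (≃-sym (Q.kbin-pascal⁻¹-solved c t))
     (u-*ᴿ (u-qp (ℤ.- + suc t)) (u-+ᴿ p (u-neg (u-*ᴿ (u-*ᴿ u-K⁻¹ (u-qp (+ t ℤ.- c))) (kbin∈U t c))))))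

Kbin∈U : ∀ c t → InU (Kbin c t)
Kbin∈U c t = u-≃ (≃-sym (Kbin≃kbin c t)) (kbin∈U t c)

Kbin-difference : ∀ e → Kbin 1ℤ 1 +ᴿ embA ((-1ℤ , e) ∷ []) *ᴿ Kbin 0ℤ 1 ≃ Q.kbin 1ℤ 1 +ᴿ (-ᴿ (qp e *ᴿ Q.kbin 0ℤ 1))
Kbin-difference e = +-cong (Kbin≃kbin 1ℤ 1)
  (≃-trans (*-cong (embA-neg 1ℤ e) (Kbin≃kbin 0ℤ 1)) (≃-sym (-‿distribˡ-* (qp e) (Q.kbin 0ℤ 1))))

U-generated : ∀ x → InU x → Σ Tm (λ u → ev u ≃ x)
U-generated _ u-K       = X 1ℤ 1 ⊕ ((-1ℤ , -1ℤ) ∷ []) · X 0ℤ 1 , ≃-trans (Kbin-difference -1ℤ) (≃-sym Q.κ≈kbin)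
U-generated _ u-K⁻¹     = X 1ℤ 1 ⊕ ((-1ℤ , 1ℤ) ∷ []) · X 0ℤ 1 , ≃-trans (Kbin-difference 1ℤ) (≃-sym Q.κ⁻¹≈kbin)
U-generated _ (u-gen t) = X 0ℤ t , ≃-refl
-- In the absence of a unit among the terms, scalars are multiples of [K;0;0] = 1.
U-generated _ (u-A a)   = a · X 0ℤ 0 , ≃-trans (*-congˡ (≃-trans (Kbin≃kbin 0ℤ 0) (Q.kbin-0 0ℤ))) (*-identityʳ (embA a))
U-generated _ (u-+ {x} {y} p r) with U-generated x p | U-generated y r
... | u , eq | v , eq' = u ⊕ v , ≃-trans (+-cong eq eq') (≃-reflexive (+ᴿ≡+R x y))
U-generated _ (u-* {x} {y} p r) with U-generated x p | U-generated y r
... | u , eq | v , eq' = u ⊗ v , ≃-trans (*-cong eq eq') (≃-reflexive (*ᴿ≡*R x y))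
U-generated _ (u-resp {x} x≈y p) with U-generated x p
... | u , eq = u , ≃-trans eq (≈R⇒≃ x≈y)

-- The presented algebra

~-isEquivalence : IsEquivalence _~_
~-isEquivalence = record { refl = ~refl ; sym = ~sym ; trans = ~trans }

~-reflexive : ∀ {u v} → u ≡ v → u ~ v
~-reflexive ≡.refl = ~refl

additiveGroup : AbelianGroup 0ℓ 0ℓ
additiveGroup = record
  { _∙_ = _⊕_ ; ε = 𝟘 ; _⁻¹ = -1A ·_
  ; isAbelianGroup = record
    { isGroup = record
      { isMonoid = record
        { isSemigroup = record
          { isMagma = record { isEquivalence = ~-isEquivalence ; ∙-cong = ~⊕ }
          ; assoc = ⊕-assoc }
        ; identity = (λ u → ~trans (⊕-comm 𝟘 u) (⊕-zero u)) , ⊕-zero }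
      ; inverse = (λ u → ~trans (⊕-comm (-1A · u) u) (⊕-inv u)) , ⊕-inv
      ; ⁻¹-cong = ~· λ _ → ≡.refl }
    ; comm = ⊕-comm } }

open AbelianGroup additiveGroup using () renaming (identityˡ to ⊕-identityˡ; ∙-congˡ to ⊕-congˡ; ∙-congʳ to ⊕-congʳ)
open Algebra.Properties.Group (AbelianGroup.group additiveGroup) using () renaming (∙-cancelˡ to ⊕-cancelˡ; x∙y⁻¹≈ε⇒x≈y to ⊖≈𝟘⇒~)
module ~-Reasoning = Relation.Binary.Reasoning.Setoid (AbelianGroup.setoid additiveGroup)

·-congˡ : ∀ {a u v} → u ~ v → a · u ~ a · v
·-congˡ = ~· λ _ → ≡.refl

-- Multiplication by the zero scalar gives an element equal to its own double, which cancellation in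
-- the additive group forces to be zero.
[]·~𝟘 : ∀ u → [] · u ~ 𝟘
[]·~𝟘 u = ~sym (⊕-cancelˡ ([] · u) 𝟘 ([] · u) (~trans (⊕-zero _) (·-distrA [] [] u)))

⊗𝟘~𝟘 : ∀ u → u ⊗ 𝟘 ~ 𝟘
⊗𝟘~𝟘 u = ~sym (⊕-cancelˡ (u ⊗ 𝟘) 𝟘 (u ⊗ 𝟘) (~trans (⊕-zero _) (~trans (~⊗ ~refl (~sym (⊕-zero 𝟘))) (⊗-distr u 𝟘 𝟘))))

⊗-· : ∀ a u v → u ⊗ (a · v) ~ a · (u ⊗ v)
⊗-· a u v = begin
  u ⊗ (a · v)   ≈⟨ ⊗-comm u (a · v) ⟩
  (a · v) ⊗ u   ≈⟨ ·-⊗ a v u ⟨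
  a · (v ⊗ u)   ≈⟨ ·-congˡ (⊗-comm v u) ⟩
  a · (u ⊗ v)   ∎
  where open ~-Reasoning

⊕-swap₂₃ : ∀ u v w x → (u ⊕ v) ⊕ (w ⊕ x) ~ (u ⊕ w) ⊕ (v ⊕ x)
⊕-swap₂₃ u v w x = begin
  (u ⊕ v) ⊕ (w ⊕ x)   ≈⟨ ⊕-assoc u v (w ⊕ x) ⟩
  u ⊕ (v ⊕ (w ⊕ x))   ≈⟨ ⊕-congˡ (⊕-assoc v w x) ⟨
  u ⊕ ((v ⊕ w) ⊕ x)   ≈⟨ ⊕-congˡ (⊕-congʳ (⊕-comm v w)) ⟩
  u ⊕ ((w ⊕ v) ⊕ x)   ≈⟨ ⊕-congˡ (⊕-assoc w v x) ⟩
  u ⊕ (w ⊕ (v ⊕ x))   ≈⟨ ⊕-assoc u w (v ⊕ x) ⟨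
  (u ⊕ w) ⊕ (v ⊕ x)   ∎
  where open ~-Reasoning

-- The oldest term of the recurrence has coefficient -1, so solving for it gives a recurrence of the
-- same form with the roles of c and c + 2 exchanged.
recurrence-down : ∀ c t → 1 ℕ.≤ t → X c t ~ qt+q-t t · X (c ℤ.+ 1ℤ) t ⊕ -1A · X (c ℤ.+ + 2) t ⊕ Xℤ c (+ t ℤ.- + 2)
recurrence-down c t 1≤t = ⊕-cancelˡ x₂ _ _ (begin
  x₂ ⊕ x₀                           ≈⟨ ⊕-congʳ (rel-rec c t 1≤t) ⟩
  (u ⊕ -1A · x₀ ⊕ w) ⊕ x₀           ≈⟨ ⊕-assoc (u ⊕ -1A · x₀) w x₀ ⟩
  (u ⊕ -1A · x₀) ⊕ (w ⊕ x₀)         ≈⟨ ⊕-swap₂₃ u (-1A · x₀) w x₀ ⟩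
  (u ⊕ w) ⊕ (-1A · x₀ ⊕ x₀)         ≈⟨ ⊕-congˡ (~trans (⊕-comm _ _) (⊕-inv x₀)) ⟩
  (u ⊕ w) ⊕ 𝟘                       ≈⟨ ⊕-congˡ (⊕-inv x₂) ⟨
  (u ⊕ w) ⊕ (x₂ ⊕ -1A · x₂)         ≈⟨ ⊕-comm _ _ ⟩
  (x₂ ⊕ -1A · x₂) ⊕ (u ⊕ w)         ≈⟨ ⊕-assoc x₂ (-1A · x₂) (u ⊕ w) ⟩
  x₂ ⊕ (-1A · x₂ ⊕ (u ⊕ w))         ≈⟨ ⊕-congˡ (⊕-assoc (-1A · x₂) u w) ⟨
  x₂ ⊕ (-1A · x₂ ⊕ u ⊕ w)           ≈⟨ ⊕-congˡ (⊕-congʳ (⊕-comm (-1A · x₂) u)) ⟩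
  x₂ ⊕ (u ⊕ -1A · x₂ ⊕ w)           ∎)
  where
  open ~-Reasoning
  x₂ = X (c ℤ.+ + 2) t
  x₀ = X c t
  u = qt+q-t t · X (c ℤ.+ 1ℤ) t
  w = Xℤ c (+ t ℤ.- + 2)

-- Propagation along the recurrence needs only linear closure. It is used for the elements fixed by
-- an X(c,0) and for the terms that have a normal form.
record Submodule (S : Tm → Set) : Set where
  field
    S-~ : ∀ {u v} → u ~ v → S u → S v
    S-⊕ : ∀ {u v} → S u → S v → S (u ⊕ v)
    S-· : ∀ a {u} → S u → S (a · u)

  S-𝟘 : ∀ {u} → S u → S 𝟘
  S-𝟘 {u} s = S-~ ([]·~𝟘 u) (S-· [] s)

  -- Backwards and forwards along the recurrence from two consecutive c.
  S-X : ∀ t → 1 ℕ.≤ t → (∀ b → S (Xℤ b (+ t ℤ.- + 2))) → ∀ c → S (X c t) → S (X (c ℤ.+ 1ℤ) t) → ∀ b → S (X b t)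
  S-X t 1≤t lower c s₀ s₁ b = ≡.subst (λ b → S (X b t)) (e₁ c b) (proj₁ (ℤ-induction P (base s₀ s₁) up down (b ℤ.- c)))
    where
    P : ℤ → Set
    P k = S (X (c ℤ.+ k) t) × S (X (c ℤ.+ k ℤ.+ 1ℤ) t)
    e₁ : ∀ c b → c ℤ.+ (b ℤ.- c) ≡ b
    e₁ = ℤ-Solver.solve-∀
    e₂ : ∀ c k → c ℤ.+ k ℤ.+ 1ℤ ≡ c ℤ.+ (k ℤ.+ 1ℤ)
    e₂ = ℤ-Solver.solve-∀
    e₃ : ∀ c k → c ℤ.+ k ℤ.+ + 2 ≡ c ℤ.+ (k ℤ.+ 1ℤ) ℤ.+ 1ℤ
    e₃ = ℤ-Solver.solve-∀
    base : S (X c t) → S (X (c ℤ.+ 1ℤ) t) → P 0ℤ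
    base = ≡.subst (λ d → S (X d t) → S (X (d ℤ.+ 1ℤ) t) → P 0ℤ) (ℤ.+-identityʳ c) _,_
    up : ∀ k → P k → P (k ℤ.+ 1ℤ)
    up k (s , s') = ≡.subst (λ d → S (X d t)) (e₂ c k) s' , ≡.subst (λ d → S (X d t)) (e₃ c k)
      (S-~ (~sym (rel-rec (c ℤ.+ k) t 1≤t)) (S-⊕ (S-⊕ (S-· _ s') (S-· _ s)) (lower (c ℤ.+ k))))
    down : ∀ k → P (k ℤ.+ 1ℤ) → P k
    down k (s , s') = S-~ (~sym (recurrence-down (c ℤ.+ k) t 1≤t))
      (S-⊕ (S-⊕ (S-· _ s₁′) (S-· _ (≡.subst (λ d → S (X d t)) (≡.sym (e₃ c k)) s'))) (lower (c ℤ.+ k))) , s₁′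
      where
      s₁′ = ≡.subst (λ d → S (X d t)) (≡.sym (e₂ c k)) s

-- The relation leaves the representatives of the quantum binomials open; here they are chosen as
-- `qbinA`, with b written as c + d.
product : ∀ c d t s n m → + n ≡ + t ℤ.+ d → + s ≡ + m ℤ.+ d →
  X c t ⊗ X (c ℤ.+ d) s ~ ΣT (map (λ j → qbinA n j · qbinAℤ m (+ j ℤ.- d) · X (c ℤ.+ + j) (t ℕ.+ s)) (upTo (suc n)))
product c d t s n m eqn eqm = rel-mult c (c ℤ.+ d) t s n m eqn′ eqm′ (qbinA n) (λ j → qbinAℤ m (+ j ℤ.- d))
  (λ j → ≃⇒≈R (≃-trans (qbinAℤ≃qbin n (+ j)) (≃-reflexive (≡.cong₂ qbin eqn′ (e₃ c (+ j))))))
  (λ j → ≃⇒≈R (≃-trans (qbinAℤ≃qbin m (+ j ℤ.- d)) (≃-reflexive (≡.cong₂ qbin eqm′ (e₄ c d (+ j))))))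
  where
  e₁ : ∀ c d t → t ℤ.+ d ≡ t ℤ.- c ℤ.+ (c ℤ.+ d)
  e₁ = ℤ-Solver.solve-∀
  e₂ : ∀ c d m → m ≡ m ℤ.+ d ℤ.- (c ℤ.+ d) ℤ.+ c
  e₂ = ℤ-Solver.solve-∀
  e₃ : ∀ c j → j ≡ c ℤ.+ j ℤ.- c
  e₃ = ℤ-Solver.solve-∀
  e₄ : ∀ c d j → j ℤ.- d ≡ c ℤ.+ j ℤ.- (c ℤ.+ d)
  e₄ = ℤ-Solver.solve-∀
  eqn′ : + n ≡ + t ℤ.- c ℤ.+ (c ℤ.+ d)
  eqn′ = ≡.trans eqn (e₁ c d (+ t))
  eqm′ : + m ≡ + s ℤ.- (c ℤ.+ d) ℤ.+ c
  eqm′ = ≡.trans (e₂ c d (+ m)) (≡.cong (λ x → x ℤ.- (c ℤ.+ d) ℤ.+ c) (≡.sym eqm))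

product₀ : ∀ c t s → X c t ⊗ X c s ~ ΣT (map (λ j → qbinA t j · qbinA s j · X (c ℤ.+ + j) (t ℕ.+ s)) (upTo (suc t)))
product₀ c t s = ~trans (~⊗ ~refl (~-reflexive (≡.cong (λ d → X d s) (≡.sym (ℤ.+-identityʳ c)))))
  (~trans (product c 0ℤ t s t s (≡.sym (ℤ.+-identityʳ (+ t))) (≡.sym (ℤ.+-identityʳ (+ s))))
          (~-reflexive (≡.cong ΣT (List.map-cong (λ j → ≡.cong (λ k → qbinA t j · qbinAℤ s k · X (c ℤ.+ + j) (t ℕ.+ s)) (ℤ.+-identityʳ (+ j))) (upTo (suc t))))))

1·1·~ : ∀ u → 1A · 1A · u ~ u
1·1·~ u = ~trans (·-one _) (·-one u)

X+0 : ∀ c s → X (c ℤ.+ 0ℤ) s ~ X c s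
X+0 c s = ~-reflexive (≡.cong (λ d → X d s) (ℤ.+-identityʳ c))

-- All X(c,0) coincide

module _ (e : Tm) where
  Fixes : Tm → Set
  Fixes u = e ⊗ u ~ u

  fixesSubmodule : Submodule Fixes
  fixesSubmodule = record
    { S-~ = λ u~v eu → ~trans (~⊗ ~refl (~sym u~v)) (~trans eu u~v)
    ; S-⊕ = λ {u} {v} eu ev → ~trans (⊗-distr e u v) (~⊕ eu ev)
    ; S-· = λ a {u} eu → ~trans (⊗-· a e u) (·-congˡ eu) }

  Fixes-⊗ : ∀ {u v} → Fixes u → Fixes (u ⊗ v)
  Fixes-⊗ {u} {v} eu = ~trans (~sym (⊗-assoc e u v)) (~⊗ eu ~refl)

  Fixes-cancelˡ : ∀ {u v} → Fixes u → Fixes (u ⊕ v) → Fixes v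
  Fixes-cancelˡ {u} {v} eu euv = ⊕-cancelˡ u (e ⊗ v) v (~trans (⊕-congʳ (~sym eu)) (~trans (~sym (⊗-distr e u v)) euv))

  Fixes-cancelʳ : ∀ {u v} → Fixes v → Fixes (u ⊕ v) → Fixes u
  Fixes-cancelʳ {u} {v} ev euv = Fixes-cancelˡ ev (Submodule.S-~ fixesSubmodule (⊕-comm u v) euv)

X₀-fixes-same : ∀ c s → Fixes (X c 0) (X c s)
X₀-fixes-same c s = ~trans (product₀ c 0 s) (~trans (⊕-zero _) (~trans (1·1·~ _) (X+0 c s)))

-- An extreme case of the conditions, n = 1 and m = 0: the summand j = 0 contains {0 over -1} = 0,
-- and j = 1 leaves the single term X(c+1,1).
X₀-fixes-next : ∀ c → Fixes (X c 0) (X (c ℤ.+ 1ℤ) 1)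
X₀-fixes-next c = ~trans (product c 1ℤ 0 1 1 0 ≡.refl ≡.refl)
  (~trans (⊕-congʳ (~trans (·-one _) ([]·~𝟘 _))) (~trans (⊕-identityˡ _) (~trans (⊕-zero _) (1·1·~ _))))

X₁-squared : ∀ c → X c 1 ⊗ X c 1 ~ X c 2 ⊕ X (c ℤ.+ 1ℤ) 2
X₁-squared c = ~trans (product₀ c 1 1) (~⊕ (~trans (1·1·~ _) (X+0 c 2)) (~trans (⊕-zero _) (1·1·~ _)))

module _ (c : ℤ) where
  private
    e = X c 0
    open Submodule (fixesSubmodule e)

  X₀-fixes-X₁ : ∀ b → Fixes e (X b 1)
  X₀-fixes-X₁ = S-X 1 (ℕ.s≤s ℕ.z≤n) (λ _ → ⊗𝟘~𝟘 e) c (X₀-fixes-same c 1) (X₀-fixes-next c)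

  -- The recurrence cannot be used at t = 2, since its last summand X(b,0) is not yet known to be
  -- fixed. Instead X(b,2) + X(b+1,2) is fixed, being the square of X(b,1), so the property passes
  -- between neighbours in either direction.
  X₀-fixes-X₂ : ∀ b → Fixes e (X b 2)
  X₀-fixes-X₂ b = ≡.subst (λ b → Fixes e (X b 2)) (e₁ c b)
    (ℤ-induction (λ k → Fixes e (X (c ℤ.+ k) 2))
      (S-~ (~sym (X+0 c 2)) (X₀-fixes-same c 2))
      (λ k fixed → ≡.subst (λ b → Fixes e (X b 2)) (e₂ c k) (Fixes-cancelˡ e fixed (pair (c ℤ.+ k))))
      (λ k fixed → Fixes-cancelʳ e (≡.subst (λ b → Fixes e (X b 2)) (≡.sym (e₂ c k)) fixed) (pair (c ℤ.+ k)))
      (b ℤ.- c))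
    where
    e₁ : ∀ c b → c ℤ.+ (b ℤ.- c) ≡ b
    e₁ = ℤ-Solver.solve-∀
    e₂ : ∀ c k → c ℤ.+ k ℤ.+ 1ℤ ≡ c ℤ.+ (k ℤ.+ 1ℤ)
    e₂ = ℤ-Solver.solve-∀
    pair : ∀ b → Fixes e (X b 2 ⊕ X (b ℤ.+ 1ℤ) 2)
    pair b = S-~ (X₁-squared b) (Fixes-⊗ e (X₀-fixes-X₁ b))

  X₀-fixes-X₀ : ∀ b → Fixes e (X b 0)
  X₀-fixes-X₀ b = Fixes-cancelˡ e (S-⊕ (S-· _ (X₀-fixes-X₂ (b ℤ.+ 1ℤ))) (S-· _ (X₀-fixes-X₂ b)))
    (S-~ (rel-rec b 2 (ℕ.s≤s ℕ.z≤n)) (X₀-fixes-X₂ (b ℤ.+ + 2)))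

X₀~X₀ : ∀ b c → X b 0 ~ X c 0
X₀~X₀ b c = ~trans (~sym (X₀-fixes-X₀ c b)) (~trans (⊗-comm _ _) (X₀-fixes-X₀ b c))

-- Normal forms

Coefficients : ℕ → Set
Coefficients zero    = Aelt
Coefficients (suc T) = Coefficients T × Aelt × Aelt

-- A single generator suffices at t = 0, where all X(c,0) agree; a second one would destroy
-- independence.
normal : ∀ T → Coefficients T → Tm
normal zero    a           = a · X 0ℤ 0
normal (suc T) (v , a , b) = normal T v ⊕ (a · X 0ℤ (suc T) ⊕ b · X 1ℤ (suc T))

Vanishes : ∀ T → Coefficients T → Set
Vanishes zero    a           = a ≈A []
Vanishes (suc T) (v , a , b) = Vanishes T v × a ≈A [] × b ≈A []

normal-vanishes : ∀ T v → Vanishes T v → normal T v ~ 𝟘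
normal-vanishes zero    a           a≈0               = ~trans (~· a≈0 ~refl) ([]·~𝟘 _)
normal-vanishes (suc T) (v , a , b) (v≈0 , a≈0 , b≈0) = ~trans
  (~⊕ (normal-vanishes T v v≈0) (~trans (~⊕ (~trans (~· a≈0 ~refl) ([]·~𝟘 _)) (~trans (~· b≈0 ~refl) ([]·~𝟘 _))) (⊕-zero 𝟘)))
  (⊕-zero 𝟘)

zeros : ∀ T → Coefficients T
zeros zero    = []
zeros (suc T) = zeros T , [] , []

normal-zeros : ∀ T → normal T (zeros T) ~ 𝟘
normal-zeros T = normal-vanishes T (zeros T) (vanish T)
  where
  vanish : ∀ T → Vanishes T (zeros T)
  vanish zero    _ = ≡.refl
  vanish (suc T)   = vanish T , (λ _ → ≡.refl) , (λ _ → ≡.refl)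

infixl 6 _+C_
_+C_ : ∀ {T} → Coefficients T → Coefficients T → Coefficients T
_+C_ {zero}  a           a'            = a +A a'
_+C_ {suc T} (v , a , b) (v' , a' , b') = v +C v' , a +A a' , b +A b'

normal-+C : ∀ T v v' → normal T (v +C v') ~ normal T v ⊕ normal T v'
normal-+C zero    a           a'             = ·-distrA a a' _
normal-+C (suc T) (v , a , b) (v' , a' , b') = ~trans
  (~⊕ (normal-+C T v v') (~trans (~⊕ (·-distrA a a' _) (·-distrA b b' _)) (⊕-swap₂₃ _ _ _ _)))
  (⊕-swap₂₃ _ _ _ _)

_*C_ : ∀ {T} → Aelt → Coefficients T → Coefficients T
_*C_ {zero}  c a           = c *A a
_*C_ {suc T} c (v , a , b) = c *C v , c *A a , c *A b

normal-*C : ∀ T c v → normal T (c *C v) ~ c · normal T v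
normal-*C zero    c a           = ·-assoc c a _
normal-*C (suc T) c (v , a , b) = ~trans
  (~⊕ (normal-*C T c v) (~trans (~⊕ (·-assoc c a _) (·-assoc c b _)) (~sym (·-distrT c _ _))))
  (~sym (·-distrT c _ _))

NormalAt : ℕ → Tm → Set
NormalAt T u = Σ (Coefficients T) λ v → u ~ normal T v

Normal : Tm → Set
Normal u = Σ ℕ λ T → NormalAt T u

-- Padding with zero coefficients brings two normal forms to the same height, so that they can be
-- added.
raise : ∀ k {T u} → NormalAt T u → NormalAt (k ℕ.+ T) u
raise zero    nu = nu
raise (suc k) {T} nu with raise k {T} nu
... | v , u~v = (v , [] , []) , ~trans u~v (~sym (~trans (⊕-congˡ (~trans (~⊕ ([]·~𝟘 _) ([]·~𝟘 _)) (⊕-zero 𝟘))) (⊕-zero _)))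

normalSubmodule : Submodule Normal
normalSubmodule = record
  { S-~ = λ { u~v (T , v , u~nv) → T , v , ~trans (~sym u~v) u~nv }
  ; S-⊕ = λ { {u} {u'} (T , nu) (T' , nu') →
      add (T' ℕ.+ T) (raise T' nu) (≡.subst (λ T″ → NormalAt T″ u') (ℕ.+-comm T T') (raise T nu')) }
  ; S-· = λ { c (T , v , u~) → T , c *C v , ~trans (·-congˡ u~) (~sym (normal-*C T c v)) } }
  where
  add : ∀ T {u u'} → NormalAt T u → NormalAt T u' → Normal (u ⊕ u')
  add T (v , u~) (v' , u'~) = T , v +C v' , ~trans (~⊕ u~ u'~) (~sym (normal-+C T v v'))

open Submodule normalSubmodule

normal-X₀ : ∀ t → Normal (X 0ℤ t)
normal-X₀ zero    = 0 , 1A , ~sym (·-one _)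
normal-X₀ (suc t) = suc t , (zeros t , 1A , []) ,
  ~sym (~trans (~⊕ (normal-zeros t) (~trans (~⊕ (·-one _) ([]·~𝟘 _)) (⊕-zero _))) (⊕-identityˡ _))

normal-X₁ : ∀ t → Normal (X 1ℤ (suc t))
normal-X₁ t = suc t , (zeros t , [] , 1A) ,
  ~sym (~trans (~⊕ (normal-zeros t) (~trans (~⊕ ([]·~𝟘 _) (·-one _)) (⊕-identityˡ _))) (⊕-identityˡ _))

normal-𝟘 : Normal 𝟘
normal-𝟘 = S-𝟘 (normal-X₀ 0)

-- The recursion descends by two because the recurrence involves t - 2; at t = 1 its last summand is
-- `𝟘`.
normal-X : ∀ t c → Normal (X c t)
normal-X zero          c = S-~ (X₀~X₀ 0ℤ c) (normal-X₀ 0)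
normal-X (suc zero)      = S-X 1 (ℕ.s≤s ℕ.z≤n) (λ _ → normal-𝟘) 0ℤ (normal-X₀ 1) (normal-X₁ 0)
normal-X (suc (suc t))   = S-X (2 ℕ.+ t) (ℕ.s≤s ℕ.z≤n) (normal-X t) 0ℤ (normal-X₀ (2 ℕ.+ t)) (normal-X₁ (suc t))

normal-ΣT : ∀ (f : ℕ → Tm) js → (∀ j → Normal (f j)) → Normal (ΣT (map f js))
normal-ΣT f []       nf = normal-𝟘
normal-ΣT f (j ∷ js) nf = S-⊕ (nf j) (normal-ΣT f js nf)

normal-product₀ : ∀ c t s → Normal (X c t ⊗ X c s)
normal-product₀ c t s = S-~ (~sym (product₀ c t s)) (normal-ΣT _ (upTo (suc t)) λ j → S-· _ (S-· _ (normal-X _ _)))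

-- For neighbouring c the conditions become n = t + 1 and m = s, so they hold for every t and s.
-- Together with `normal-product₀` and commutativity this covers all products of two generators.
normal-product₁ : ∀ t s → Normal (X 0ℤ t ⊗ X 1ℤ (suc s))
normal-product₁ t s = S-~ (~sym (product 0ℤ 1ℤ t (suc s) (t ℕ.+ 1) s ≡.refl (≡.cong +_ (ℕ.+-comm 1 s))))
  (normal-ΣT _ (upTo (suc (t ℕ.+ 1))) λ j → S-· _ (S-· _ (normal-X _ _)))

normal-⊗-linear : ∀ u → (∀ t → Normal (u ⊗ X 0ℤ t)) → (∀ t → Normal (u ⊗ X 1ℤ (suc t))) → ∀ T v → Normal (u ⊗ normal T v)
normal-⊗-linear u n₀ n₁ zero    a           = S-~ (~sym (⊗-· a u _)) (S-· a (n₀ 0))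
normal-⊗-linear u n₀ n₁ (suc T) (v , a , b) = S-~ (~sym (⊗-distr u _ _))
  (S-⊕ (normal-⊗-linear u n₀ n₁ T v)
       (S-~ (~sym (⊗-distr u _ _)) (S-⊕ (S-~ (~sym (⊗-· a u _)) (S-· a (n₀ (suc T)))) (S-~ (~sym (⊗-· b u _)) (S-· b (n₁ T))))))

normal-⊗ : ∀ {u v} → Normal u → Normal v → Normal (u ⊗ v)
normal-⊗ {u} {v} (T , x , u~) (T' , x' , v~) = S-~ (~⊗ (~sym u~) (~sym v~))
  (normal-⊗-linear (normal T x)
    (λ t → S-~ (⊗-comm _ _) (normal-⊗-linear (X 0ℤ t) (normal-product₀ 0ℤ t) (normal-product₁ t) T x))
    (λ t → S-~ (⊗-comm _ _) (normal-⊗-linear (X 1ℤ (suc t))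
      (λ s → S-~ (⊗-comm _ _) (normal-product₁ s t)) (λ s → normal-product₀ 1ℤ (suc t) (suc s)) T x))
    T' x')

normal-all : ∀ u → Normal u
normal-all (X c t) = normal-X t c
normal-all 𝟘       = normal-𝟘
normal-all (u ⊕ v) = S-⊕ (normal-all u) (normal-all v)
normal-all (u ⊗ v) = normal-⊗ (normal-all u) (normal-all v)
normal-all (a · u) = S-· a (normal-all u)

-- Independence of the normal forms

open import Algebra.Properties.Group (AbelianGroup.group ℤ.+-0-abelianGroup) using (∙-cancelˡ)

-- A function of bounded support that repeats itself must repeat the value zero.
periodic-vanishes : ∀ (f : ℤ → ℤ) M → (∀ x → M ℕ.< ℤ.∣ x ∣ → f x ≡ 0ℤ) → ∀ P → (∀ x → f x ≡ f (x ℤ.+ + suc P)) → ∀ x → f x ≡ 0ℤ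
periodic-vanishes f M vanish P periodic x = ≡.trans (shift k x) (vanish _ far)
  where
  -- Enough periods to leave the support: after k of them the distance from 0 is at least k - |x|,
  -- which exceeds M.
  k = suc M ℕ.+ ℤ.∣ x ∣
  shift : ∀ k x → f x ≡ f (x ℤ.+ + (k ℕ.* suc P))
  shift zero    x = ≡.cong f (≡.sym (ℤ.+-identityʳ x))
  shift (suc k) x = ≡.trans (periodic x) (≡.trans (shift k (x ℤ.+ + suc P)) (≡.cong f (ℤ.+-assoc x (+ suc P) (+ (k ℕ.* suc P)))))
  e : ∀ x y → y ≡ x ℤ.+ y ℤ.+ ℤ.- x
  e = ℤ-Solver.solve-∀
  far : M ℕ.< ℤ.∣ x ℤ.+ + (k ℕ.* suc P) ∣
  far = ℕ.+-cancelʳ-≤ ℤ.∣ x ∣ (suc M) _ (begin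
    k                                                            ≤⟨ ℕ.m≤m*n k (suc P) ⟩
    k ℕ.* suc P                                                  ≡⟨ ≡.cong ℤ.∣_∣ (e x (+ (k ℕ.* suc P))) ⟩
    ℤ.∣ x ℤ.+ + (k ℕ.* suc P) ℤ.+ ℤ.- x ∣                        ≤⟨ ℤ.∣i+j∣≤∣i∣+∣j∣ (x ℤ.+ + (k ℕ.* suc P)) (ℤ.- x) ⟩
    ℤ.∣ x ℤ.+ + (k ℕ.* suc P) ∣ ℕ.+ ℤ.∣ ℤ.- x ∣                  ≡⟨ ≡.cong (λ m → ℤ.∣ x ℤ.+ + (k ℕ.* suc P) ∣ ℕ.+ m) (ℤ.∣-i∣≡∣i∣ x) ⟩
    ℤ.∣ x ℤ.+ + (k ℕ.* suc P) ∣ ℕ.+ ℤ.∣ x ∣                      ∎)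
    where open ℕ.≤-Reasoning

-- Multiplication by an element of ℤ[q,q⁻¹] acts on every power of K separately. Rows of different
-- index are compared so that an outermost row, a single monomial, can be treated as one in row 0.
SameRow : LPoly → ℤ → LPoly → ℤ → Set
SameRow p j p' j' = ∀ i → coeffL p i j ≡ coeffL p' i j'

emb-*-row : ∀ a {p j p' j'} → SameRow p j p' j' → SameRow (emb a *L p) j (emb a *L p') j'
emb-*-row []            eq i = ≡.refl
emb-*-row ((c , d) ∷ a) {p} {j} {p'} {j'} eq i = ≡.trans (expand p j) (≡.trans
  (≡.cong₂ ℤ._+_ (≡.cong (c ℤ.*_) (eq (i ℤ.- d))) (emb-*-row a eq i)) (≡.sym (expand p' j')))
  where
  expand : ∀ p j → coeffL (emb ((c , d) ∷ a) *L p) i j ≡ c ℤ.* coeffL p (i ℤ.- d) j ℤ.+ coeffL (emb a *L p) i j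
  expand p j = ≡.trans (≡.cong (λ r → coeffL r i j) (*L-∷ (c , d , 0ℤ) (emb a) p))
    (≡.trans (coeffL-++ ((c , d , 0ℤ) ·ₘ p) (emb a *L p) i j)
      (≡.cong (ℤ._+ coeffL (emb a *L p) i j) (≡.trans (coeffL-·ₘ c d 0ℤ p i j) (≡.cong (λ j → c ℤ.* coeffL p (i ℤ.- d) j) (ℤ.+-identityʳ j)))))

emb-*-row-0 : ∀ a {p j} → SameRow p j [] j → SameRow (emb a *L p) j [] j
emb-*-row-0 a {p} {j} eq i = ≡.trans (emb-*-row a eq i) (≡.cong (λ r → coeffL r i j) (*L-zeroʳ (emb a)))

emb-*-row-mon : ∀ a {p j} s e → (∀ i → coeffL p i j ≡ s ℤ.* [ e ≟ i ]) → ∀ i → coeffL (emb a *L p) i j ≡ s ℤ.* coeffA a (i ℤ.- e)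
emb-*-row-mon a {p} {j} s e row i = ≡.trans (emb-*-row a {p} {j} {mon s e 0ℤ} {0ℤ} (λ i → ≡.trans (row i) (≡.sym (≡.trans (coeffL-∷ s e 0ℤ [] i 0ℤ) (e₁ s [ e ≟ i ])))) i)
  (≡.trans (coeff≡ (*L-comm (emb a) (mon s e 0ℤ)) i 0ℤ) (≡.trans (coeffL-mon-* s e 0ℤ (emb a) i 0ℤ) (≡.cong (s ℤ.*_) (coeffL-emb-0 a (i ℤ.- e)))))
  where
  e₁ : ∀ s x → s ℤ.* (x ℤ.* 1ℤ) ℤ.+ 0ℤ ≡ s ℤ.* x
  e₁ = ℤ-Solver.solve-∀

-- The product `kcleared` formed in ℤ[q,q⁻¹,K,K⁻¹], where its coefficients are accessible.
KprodL : ℤ → ℕ → LPoly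
KprodL c zero    = 1L
KprodL c (suc t) = (mon 1ℤ c 1ℤ ++ mon -1ℤ (ℤ.- c) -1ℤ) *L KprodL (c ℤ.- 1ℤ) t

-- The sum c + (c-1) + ... + (c-t+1), the power of q that accompanies K^t when every factor
-- contributes its K-part.
topExp : ℤ → ℕ → ℤ
topExp c zero    = 0ℤ
topExp c (suc t) = c ℤ.+ topExp (c ℤ.- 1ℤ) t

-- Each of the t summands grows by one. This is the origin of the factors q^t and q^(-t) that
-- separate c = 0 from c = 1.
topExp-1 : ∀ c t → topExp (c ℤ.+ 1ℤ) t ≡ topExp c t ℤ.+ + t
topExp-1 c zero    = ≡.refl
topExp-1 c (suc t) = ≡.trans (≡.cong (λ d → c ℤ.+ 1ℤ ℤ.+ topExp d t) (e₁ c))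
  (≡.trans (≡.cong (λ x → c ℤ.+ 1ℤ ℤ.+ x) (topExp-1 (c ℤ.- 1ℤ) t)) (e₂ c (topExp (c ℤ.- 1ℤ) t) (+ t)))
  where
  e₁ : ∀ c → c ℤ.+ 1ℤ ℤ.- 1ℤ ≡ c ℤ.- 1ℤ ℤ.+ 1ℤ
  e₁ = ℤ-Solver.solve-∀
  e₂ : ∀ c x t → c ℤ.+ 1ℤ ℤ.+ (x ℤ.+ t) ≡ c ℤ.+ x ℤ.+ (1ℤ ℤ.+ t)
  e₂ = ℤ-Solver.solve-∀

sgn : ℕ → ℤ
sgn zero    = 1ℤ
sgn (suc t) = ℤ.- sgn t

sgn²≡1 : ∀ t → sgn t ℤ.* sgn t ≡ 1ℤ
sgn²≡1 zero    = ≡.refl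
sgn²≡1 (suc t) = ≡.trans (e (sgn t)) (sgn²≡1 t)
  where
  e : ∀ s → ℤ.- s ℤ.* ℤ.- s ≡ s ℤ.* s
  e = ℤ-Solver.solve-∀

coeffL-KprodL : ∀ c t i j → coeffL (KprodL c (suc t)) i j ≡ coeffL (KprodL (c ℤ.- 1ℤ) t) (i ℤ.- c) (j ℤ.- 1ℤ) ℤ.- coeffL (KprodL (c ℤ.- 1ℤ) t) (i ℤ.+ c) (j ℤ.+ 1ℤ)
coeffL-KprodL c t i j = ≡.trans (≡.cong (λ r → coeffL r i j) (*L-distribʳ p (mon 1ℤ c 1ℤ) (mon -1ℤ (ℤ.- c) -1ℤ)))
  (≡.trans (coeffL-++ (mon 1ℤ c 1ℤ *L p) _ i j) (≡.cong₂ ℤ._+_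
    (≡.trans (coeffL-mon-* 1ℤ c 1ℤ p i j) (ℤ.*-identityˡ _))
    (≡.trans (coeffL-mon-* -1ℤ (ℤ.- c) -1ℤ p i j) (≡.trans (ℤ.-1*i≡-i _) (≡.cong (λ x → ℤ.- coeffL p x (j ℤ.+ 1ℤ)) (≡.cong (λ z → i ℤ.+ z) (ℤ.neg-involutive c)))))))
  where
  p = KprodL (c ℤ.- 1ℤ) t

KprodL-outside : ∀ c t j → t ℕ.< ℤ.∣ j ∣ → SameRow (KprodL c t) j [] j
KprodL-outside c zero    j t<j i = ≡.trans (coeffL-∷ 1ℤ 0ℤ 0ℤ [] i j)
  (≡.trans (≡.cong (λ x → 1ℤ ℤ.* ([ 0ℤ ≟ i ] ℤ.* x) ℤ.+ 0ℤ) ([≟]-≢ {0ℤ} {j} (λ { ≡.refl → ℕ.<-irrefl ≡.refl t<j }))) (e [ 0ℤ ≟ i ]))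
  where
  e : ∀ x → 1ℤ ℤ.* (x ℤ.* 0ℤ) ℤ.+ 0ℤ ≡ 0ℤ
  e = ℤ-Solver.solve-∀
KprodL-outside c (suc t) j t<j i = ≡.trans (coeffL-KprodL c t i j) (≡.cong₂ ℤ._-_
  (KprodL-outside (c ℤ.- 1ℤ) t (j ℤ.- 1ℤ) (near (j ℤ.- 1ℤ) 1ℤ (e₁ j) ℕ.≤-refl) (i ℤ.- c))
  (KprodL-outside (c ℤ.- 1ℤ) t (j ℤ.+ 1ℤ) (near (j ℤ.+ 1ℤ) -1ℤ (e₂ j) ℕ.≤-refl) (i ℤ.+ c)))
  where
  e₁ : ∀ j → j ≡ j ℤ.- 1ℤ ℤ.+ 1ℤ
  e₁ = ℤ-Solver.solve-∀
  e₂ : ∀ j → j ≡ j ℤ.+ 1ℤ ℤ.+ -1ℤ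
  e₂ = ℤ-Solver.solve-∀
  near : ∀ j' d → j ≡ j' ℤ.+ d → ℤ.∣ d ∣ ℕ.≤ 1 → t ℕ.< ℤ.∣ j' ∣
  near j' d j≡ d≤1 = ℕ.+-cancelʳ-≤ 1 (suc t) ℤ.∣ j' ∣ (begin
    suc t ℕ.+ 1                ≡⟨ ℕ.+-comm (suc t) 1 ⟩
    suc (suc t)                ≤⟨ t<j ⟩
    ℤ.∣ j ∣                    ≡⟨ ≡.cong ℤ.∣_∣ j≡ ⟩
    ℤ.∣ j' ℤ.+ d ∣             ≤⟨ ℤ.∣i+j∣≤∣i∣+∣j∣ j' d ⟩
    ℤ.∣ j' ∣ ℕ.+ ℤ.∣ d ∣       ≤⟨ ℕ.+-monoʳ-≤ ℤ.∣ j' ∣ d≤1 ⟩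
    ℤ.∣ j' ∣ ℕ.+ 1             ∎)
    where open ℕ.≤-Reasoning

1L-row : ∀ i → coeffL 1L i 0ℤ ≡ 1ℤ ℤ.* [ 0ℤ ≟ i ]
1L-row i = ≡.trans (coeffL-∷ 1ℤ 0ℤ 0ℤ [] i 0ℤ) (e [ 0ℤ ≟ i ])
  where
  e : ∀ x → 1ℤ ℤ.* (x ℤ.* 1ℤ) ℤ.+ 0ℤ ≡ 1ℤ ℤ.* x
  e = ℤ-Solver.solve-∀

KprodL-top : ∀ c t i → coeffL (KprodL c t) i (+ t) ≡ 1ℤ ℤ.* [ topExp c t ≟ i ]
KprodL-top c zero    i = 1L-row i
KprodL-top c (suc t) i = begin
  coeffL (KprodL c (suc t)) i (+ suc t)
    ≡⟨ coeffL-KprodL c t i (+ suc t) ⟩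
  coeffL p (i ℤ.- c) (+ t) ℤ.- coeffL p (i ℤ.+ c) (+ suc t ℤ.+ 1ℤ)
    ≡⟨ ≡.cong₂ ℤ._-_ (KprodL-top (c ℤ.- 1ℤ) t (i ℤ.- c)) (KprodL-outside (c ℤ.- 1ℤ) t (+ suc t ℤ.+ 1ℤ) (ℕ.m≤m+n (suc t) 1) (i ℤ.+ c)) ⟩
  1ℤ ℤ.* [ topExp (c ℤ.- 1ℤ) t ≟ i ℤ.- c ] ℤ.- 0ℤ
    ≡⟨ ℤ.+-identityʳ _ ⟩
  1ℤ ℤ.* [ topExp (c ℤ.- 1ℤ) t ≟ i ℤ.- c ]
    ≡⟨ ≡.cong (1ℤ ℤ.*_) ([≟]-shift c (topExp (c ℤ.- 1ℤ) t) i) ⟨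
  1ℤ ℤ.* [ topExp c (suc t) ≟ i ] ∎
  where
  open ≡.≡-Reasoning
  p = KprodL (c ℤ.- 1ℤ) t

-- To reach K^(-t) every factor must contribute its K⁻¹-part, which brings one sign and one negated
-- exponent each.
KprodL-bottom : ∀ c t i → coeffL (KprodL c t) i (ℤ.- + t) ≡ sgn t ℤ.* [ ℤ.- topExp c t ≟ i ]
KprodL-bottom c zero    i = 1L-row i
KprodL-bottom c (suc t) i = begin
  coeffL (KprodL c (suc t)) i (ℤ.- + suc t)
    ≡⟨ coeffL-KprodL c t i (ℤ.- + suc t) ⟩
  coeffL p (i ℤ.- c) (ℤ.- + suc t ℤ.- 1ℤ) ℤ.- coeffL p (i ℤ.+ c) (ℤ.- + suc t ℤ.+ 1ℤ)
    ≡⟨ ≡.cong₂ ℤ._-_ (KprodL-outside (c ℤ.- 1ℤ) t (ℤ.- + suc t ℤ.- 1ℤ) (ℕ.s≤s (ℕ.m≤n⇒m≤1+n (ℕ.m≤m+n t 0))) (i ℤ.- c))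
         (≡.trans (≡.cong (coeffL p (i ℤ.+ c)) (e₁ (+ t))) (KprodL-bottom (c ℤ.- 1ℤ) t (i ℤ.+ c))) ⟩
  0ℤ ℤ.- sgn t ℤ.* [ ℤ.- topExp (c ℤ.- 1ℤ) t ≟ i ℤ.+ c ]
    ≡⟨ e₂ (sgn t) _ ⟩
  ℤ.- sgn t ℤ.* [ ℤ.- topExp (c ℤ.- 1ℤ) t ≟ i ℤ.+ c ]
    ≡⟨ ≡.cong (λ x → ℤ.- sgn t ℤ.* [ ℤ.- topExp (c ℤ.- 1ℤ) t ≟ i ℤ.+ x ]) (ℤ.neg-involutive c) ⟨
  ℤ.- sgn t ℤ.* [ ℤ.- topExp (c ℤ.- 1ℤ) t ≟ i ℤ.- (ℤ.- c) ]
    ≡⟨ ≡.cong (ℤ.- sgn t ℤ.*_) ([≟]-shift (ℤ.- c) (ℤ.- topExp (c ℤ.- 1ℤ) t) i) ⟨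
  ℤ.- sgn t ℤ.* [ ℤ.- c ℤ.+ ℤ.- topExp (c ℤ.- 1ℤ) t ≟ i ]
    ≡⟨ ≡.cong (λ x → ℤ.- sgn t ℤ.* [ x ≟ i ]) (ℤ.neg-distrib-+ c (topExp (c ℤ.- 1ℤ) t)) ⟨
  ℤ.- sgn t ℤ.* [ ℤ.- topExp c (suc t) ≟ i ] ∎
  where
  open ≡.≡-Reasoning
  p = KprodL (c ℤ.- 1ℤ) t
  e₁ : ∀ t → ℤ.- (1ℤ ℤ.+ t) ℤ.+ 1ℤ ≡ ℤ.- t
  e₁ = ℤ-Solver.solve-∀
  e₂ : ∀ s x → 0ℤ ℤ.- s ℤ.* x ≡ ℤ.- s ℤ.* x
  e₂ = ℤ-Solver.solve-∀

qdiffA : ℕ → Aelt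
qdiffA t = (1ℤ , + t) ∷ (-1ℤ , ℤ.- + t) ∷ []

pairL : ℕ → Aelt → Aelt → LPoly
pairL t a b = emb a *L KprodL 0ℤ t ++ emb b *L KprodL 1ℤ t

-- The normal form multiplied by the common denominator `qcleared T`, built up level by level
-- without division.
cleared : ∀ T → Coefficients T → LPoly
cleared zero    a           = emb a *L KprodL 0ℤ 0
cleared (suc T) (v , a , b) = emb (qdiffA (suc T)) *L cleared T v ++ pairL (suc T) a b

coeffL-pairL : ∀ t a b i j → coeffL (pairL t a b) i j ≡ coeffL (emb a *L KprodL 0ℤ t) i j ℤ.+ coeffL (emb b *L KprodL 1ℤ t) i j
coeffL-pairL t a b i j = coeffL-++ (emb a *L KprodL 0ℤ t) (emb b *L KprodL 1ℤ t) i j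

-- The part up to T has K-degrees between -T and T, so the rows T + 1 and -(T+1) of the next level
-- see the top pair alone.
cleared-outside : ∀ T v j → T ℕ.< ℤ.∣ j ∣ → SameRow (cleared T v) j [] j
cleared-outside zero    a           j T<j = emb-*-row-0 a (KprodL-outside 0ℤ 0 j T<j)
cleared-outside (suc T) (v , a , b) j T<j i = ≡.trans (coeffL-++ (emb (qdiffA (suc T)) *L cleared T v) _ i j)
  (≡.cong₂ ℤ._+_ (emb-*-row-0 (qdiffA (suc T)) {cleared T v} {j} (cleared-outside T v j (ℕ.<-trans (ℕ.n<1+n T) T<j)) i)
    (≡.trans (coeffL-pairL (suc T) a b i j)
      (≡.cong₂ ℤ._+_ (emb-*-row-0 a (KprodL-outside 0ℤ (suc T) j T<j) i) (emb-*-row-0 b (KprodL-outside 1ℤ (suc T) j T<j) i))))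

coeffA-bounded : ∀ a → Σ ℕ λ M → ∀ x → M ℕ.< ℤ.∣ x ∣ → coeffA a x ≡ 0ℤ
coeffA-bounded a with coeffL-bounded (emb a)
... | M , vanish = M , λ x M<x → ≡.trans (≡.sym (coeffL-emb-0 a x)) (vanish x 0ℤ M<x)

-- The coefficients of K^S and K^{-S} give a(x) + b(x ∓ S) = 0 for all x, so b
-- is 2S-periodic, hence zero.
pair-independent : ∀ T a b → (∀ i → coeffL (pairL (suc T) a b) i (+ suc T) ≡ 0ℤ) →
  (∀ i → coeffL (pairL (suc T) a b) i (ℤ.- + suc T) ≡ 0ℤ) → a ≈A [] × b ≈A []
pair-independent T a b top bottom = a≈0 , b≈0
  where
  S = + suc T
  e = topExp 0ℤ (suc T)
  topExp₁ : topExp 1ℤ (suc T) ≡ e ℤ.+ S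
  topExp₁ = topExp-1 0ℤ (suc T)

  upper : ∀ x → coeffA a x ℤ.+ coeffA b (x ℤ.- S) ≡ 0ℤ
  upper x = ≡.trans (≡.cong₂ (λ y z → coeffA a y ℤ.+ coeffA b z) (e₁ x e) (≡.trans (e₂ x e S) (≡.cong (λ w → x ℤ.+ e ℤ.- w) (≡.sym topExp₁))))
    (≡.trans (≡.cong₂ ℤ._+_ (row a 0ℤ) (row b 1ℤ))
    (≡.trans (≡.sym (coeffL-pairL (suc T) a b (x ℤ.+ e) S)) (top (x ℤ.+ e))))
    where
    e₁ : ∀ x e → x ≡ x ℤ.+ e ℤ.- e
    e₁ = ℤ-Solver.solve-∀
    e₂ : ∀ x e S → x ℤ.- S ≡ x ℤ.+ e ℤ.- (e ℤ.+ S)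
    e₂ = ℤ-Solver.solve-∀
    row : ∀ a c → coeffA a (x ℤ.+ e ℤ.- topExp c (suc T)) ≡ coeffL (emb a *L KprodL c (suc T)) (x ℤ.+ e) S
    row a c = ≡.sym (≡.trans (emb-*-row-mon a {KprodL c (suc T)} {S} 1ℤ (topExp c (suc T)) (KprodL-top c (suc T)) (x ℤ.+ e)) (ℤ.*-identityˡ _))

  lower : ∀ x → coeffA a x ℤ.+ coeffA b (x ℤ.+ S) ≡ 0ℤ
  lower x = begin
    coeffA a x ℤ.+ coeffA b (x ℤ.+ S)
      ≡⟨ ≡.cong₂ (λ y z → coeffA a y ℤ.+ coeffA b z) (e₁ x e) (≡.trans (e₂ x e S) (≡.cong (λ w → x ℤ.- e ℤ.- ℤ.- w) (≡.sym topExp₁))) ⟩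
    α ℤ.+ β
      ≡⟨ ≡.trans (≡.cong (ℤ._* (α ℤ.+ β)) (sgn²≡1 (suc T))) (ℤ.*-identityˡ _) ⟨
    s ℤ.* s ℤ.* (α ℤ.+ β)
      ≡⟨ e₃ s α β ⟩
    s ℤ.* (s ℤ.* α ℤ.+ s ℤ.* β)
      ≡⟨ ≡.cong (s ℤ.*_) (≡.trans (≡.cong₂ ℤ._+_ (row a 0ℤ) (row b 1ℤ))
           (≡.trans (≡.sym (coeffL-pairL (suc T) a b (x ℤ.- e) (ℤ.- S))) (bottom (x ℤ.- e)))) ⟩
    s ℤ.* 0ℤ
      ≡⟨ ℤ.*-zeroʳ s ⟩
    0ℤ ∎
    where
    open ≡.≡-Reasoning
    s = sgn (suc T)
    α = coeffA a (x ℤ.- e ℤ.- ℤ.- e)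
    β = coeffA b (x ℤ.- e ℤ.- ℤ.- topExp 1ℤ (suc T))
    e₁ : ∀ x e → x ≡ x ℤ.- e ℤ.- ℤ.- e
    e₁ = ℤ-Solver.solve-∀
    e₂ : ∀ x e S → x ℤ.+ S ≡ x ℤ.- e ℤ.- ℤ.- (e ℤ.+ S)
    e₂ = ℤ-Solver.solve-∀
    e₃ : ∀ s α β → s ℤ.* s ℤ.* (α ℤ.+ β) ≡ s ℤ.* (s ℤ.* α ℤ.+ s ℤ.* β)
    e₃ = ℤ-Solver.solve-∀
    row : ∀ a c → s ℤ.* coeffA a (x ℤ.- e ℤ.- ℤ.- topExp c (suc T)) ≡ coeffL (emb a *L KprodL c (suc T)) (x ℤ.- e) (ℤ.- S)
    row a c = ≡.sym (emb-*-row-mon a {KprodL c (suc T)} {ℤ.- S} s (ℤ.- topExp c (suc T)) (KprodL-bottom c (suc T)) (x ℤ.- e))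

  b≈0 : b ≈A []
  b≈0 = periodic-vanishes (coeffA b) (proj₁ (coeffA-bounded b)) (proj₂ (coeffA-bounded b)) (T ℕ.+ suc T) λ x → begin
    coeffA b x
      ≡⟨ ≡.cong (coeffA b) (e₁ x S) ⟩
    coeffA b (x ℤ.+ S ℤ.- S)
      ≡⟨ ∙-cancelˡ (coeffA a (x ℤ.+ S)) _ _ (≡.trans (upper (x ℤ.+ S)) (≡.sym (lower (x ℤ.+ S)))) ⟩
    coeffA b (x ℤ.+ S ℤ.+ S)
      ≡⟨ ≡.cong (coeffA b) (ℤ.+-assoc x S S) ⟩
    coeffA b (x ℤ.+ + suc (T ℕ.+ suc T)) ∎
    where
    open ≡.≡-Reasoning
    e₁ : ∀ x S → x ≡ x ℤ.+ S ℤ.- S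
    e₁ = ℤ-Solver.solve-∀

  a≈0 : a ≈A []
  a≈0 x = ≡.trans (≡.sym (ℤ.+-identityʳ _)) (≡.trans (≡.cong (λ z → coeffA a x ℤ.+ z) (≡.sym (b≈0 (x ℤ.- S)))) (upper x))

-- Clearing denominators of normal forms

opaque
  unfolding _+ᴿ_ _*ᴿ_ -ᴿ_

  fromL-* : ∀ p r → fromL (p *L r) ≃ fromL p *ᴿ fromL r
  fromL-* p r = ≃-refl

  fromL-KprodL-factor : ∀ c → fromL (mon 1ℤ c 1ℤ ++ mon -1ℤ (ℤ.- c) -1ℤ) ≃ qp c *ᴿ KR +ᴿ (-ᴿ (qp (ℤ.- c) *ᴿ K⁻¹R))
  fromL-KprodL-factor c = fromL-cong (≋-reflexive (≡.cong₂ (λ x y → (1ℤ , x , 1ℤ) ∷ (-1ℤ , y , -1ℤ) ∷ []) (e₁ c) (e₂ (ℤ.- c))))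
    where
    e₁ : ∀ c → c ≡ c ℤ.+ 0ℤ ℤ.+ 0ℤ
    e₁ = ℤ-Solver.solve-∀
    e₂ : ∀ c → c ≡ 0ℤ ℤ.+ (c ℤ.+ 0ℤ) ℤ.+ 0ℤ
    e₂ = ℤ-Solver.solve-∀

fromL-KprodL : ∀ c t → fromL (KprodL c t) ≃ Q.kcleared c t
fromL-KprodL c zero    = ≃-refl
fromL-KprodL c (suc t) = ≃-trans (fromL-* (mon 1ℤ c 1ℤ ++ mon -1ℤ (ℤ.- c) -1ℤ) (KprodL (c ℤ.- 1ℤ) t)) (*-cong (fromL-KprodL-factor c) (fromL-KprodL (c ℤ.- 1ℤ) t))

embA-qdiffA : ∀ t → embA (qdiffA t) ≃ Q.qdiff (+ t)
embA-qdiffA t = ≃-trans (embA-+ ((1ℤ , + t) ∷ []) ((-1ℤ , ℤ.- + t) ∷ [])) (+-congˡ (embA-neg 1ℤ (ℤ.- + t)))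

qcleared-ev : ∀ T v → Q.qcleared T *ᴿ ev (normal T v) ≃ fromL (cleared T v)
qcleared-ev zero    a           = ≃-trans (*-identityˡ _) (≃-trans (*-congˡ (≃-trans (Kbin≃kbin 0ℤ 0) (Q.kbin-0 0ℤ))) (≃-sym (fromL-* (emb a) 1L)))
qcleared-ev (suc T) (v , a , b) = ≃-trans
  (*-congˡ (+-congˡ (+-cong (*-congˡ (Kbin≃kbin 0ℤ (suc T))) (*-congˡ (Kbin≃kbin 1ℤ (suc T))))))
  (≃-trans (Q.qcleared-pair T (ev (normal T v)) (fromL (cleared T v)) (embA a) (embA b) (qcleared-ev T v))
  (≃-sym (≃-trans (fromL-++ (emb (qdiffA (suc T)) *L cleared T v) (pairL (suc T) a b))
    (+-cong (≃-trans (fromL-* (emb (qdiffA (suc T))) (cleared T v)) (*-congʳ (embA-qdiffA (suc T))))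
      (≃-trans (fromL-++ (emb a *L KprodL 0ℤ (suc T)) (emb b *L KprodL 1ℤ (suc T)))
        (+-cong (≃-trans (fromL-* (emb a) (KprodL 0ℤ (suc T))) (*-congˡ (fromL-KprodL 0ℤ (suc T))))
                (≃-trans (fromL-* (emb b) (KprodL 1ℤ (suc T))) (*-congˡ (fromL-KprodL 1ℤ (suc T))))))))))

-- The coefficients are removed from the top: the two outermost rows force the top pair to vanish,
-- so the remaining normal form still evaluates to zero and the induction goes on.
normal-independent : ∀ T v → ev (normal T v) ≃ zeroR → Vanishes T v
normal-independent zero a ev≃0 x = ≡.trans (≡.sym (coeffL-emb-0 a x)) (coeff≡ emb≋0 x 0ℤ)
  where
  emb≋0 : emb a ≋ []
  emb≋0 = fromL-injective (≃-trans (≃-sym (≃-trans (*-congˡ (≃-trans (Kbin≃kbin 0ℤ 0) (Q.kbin-0 0ℤ))) (*-identityʳ (embA a)))) ev≃0)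
normal-independent (suc T) (v , a , b) ev≃0 = normal-independent T v lower≃0 , proj₁ a,b≈0 , proj₂ a,b≈0
  where
  cleared≋0 : cleared (suc T) (v , a , b) ≋ []
  cleared≋0 = fromL-injective (≃-trans (≃-sym (qcleared-ev (suc T) (v , a , b))) (≃-trans (*-congˡ ev≃0) (zeroʳ _)))
  row : ∀ j → T ℕ.< ℤ.∣ j ∣ → ∀ i → coeffL (pairL (suc T) a b) i j ≡ 0ℤ
  row j T<j i = ≡.trans (≡.sym (≡.trans (coeffL-++ (emb (qdiffA (suc T)) *L cleared T v) (pairL (suc T) a b) i j)
    (≡.trans (≡.cong (ℤ._+ coeffL (pairL (suc T) a b) i j) (emb-*-row-0 (qdiffA (suc T)) {cleared T v} {j} (cleared-outside T v j T<j) i)) (ℤ.+-identityˡ _))))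
    (coeff≡ cleared≋0 i j)
  a,b≈0 : a ≈A [] × b ≈A []
  a,b≈0 = pair-independent T a b (row (+ suc T) (ℕ.n<1+n T)) (row (ℤ.- + suc T) (ℕ.n<1+n T))
  pair≃0 : embA a *ᴿ Kbin 0ℤ (suc T) +ᴿ embA b *ᴿ Kbin 1ℤ (suc T) ≃ zeroR
  pair≃0 = ≃-trans (+-cong (≃-trans (*-congʳ (embA-cong (proj₁ a,b≈0))) (zeroˡ _)) (≃-trans (*-congʳ (embA-cong (proj₂ a,b≈0))) (zeroˡ _))) (+-identityˡ zeroR)
  lower≃0 : ev (normal T v) ≃ zeroR
  lower≃0 = ≃-trans (≃-sym (≃-trans (+-congˡ pair≃0) (+-identityʳ _))) ev≃0

-- Applied to the difference of the two terms: its normal form evaluates to zero, hence has zero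
-- coefficients, hence is `𝟘` in the presented algebra.
ev-complete : ∀ u v → ev u ≃ ev v → u ~ v
ev-complete u v eq with normal-all (u ⊕ -1A · v)
... | T , x , u-v~ = ⊖≈𝟘⇒~ u v (~trans u-v~ (normal-vanishes T x (normal-independent T x (≃-trans (≃-sym (ev-sound u-v~)) u-v≃0))))
  where
  u-v≃0 : ev (u ⊕ -1A · v) ≃ zeroR
  u-v≃0 = ≃-trans (+-cong eq (embA-1A (ev v))) (-‿inverseʳ (ev v))

theorem6p2 : (∀ c t → InU (Kbin c t))
    × (∀ x → InU x → Σ Tm (λ u → eval u ≈R x))
    × (∀ u v → u ~ v → eval u ≈R eval v)
    × (∀ u v → eval u ≈R eval v → u ~ v)
-- The components make evaluation an isomorphism from the presented algebra onto the Cartan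
-- subalgebra: its generators land there, it is onto, it respects the relations, and it is injective
-- modulo them.
theorem6p2 = Kbin∈U , generated , (λ u v u~v → ≃⇒≈R (≡.subst₂ _≃_ (ev≡eval u) (ev≡eval v) (ev-sound u~v))) ,
  (λ u v eq → ev-complete u v (≡.subst₂ _≃_ (≡.sym (ev≡eval u)) (≡.sym (ev≡eval v)) (≈R⇒≃ eq)))
  where
  generated : ∀ x → InU x → Σ Tm (λ u → eval u ≈R x)
  generated x x∈U with U-generated x x∈U
  ... | u , eq = u , ≃⇒≈R (≡.subst (_≃ x) (ev≡eval u) eq)
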